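{- Let $G$ be a finite simple undirected graph. (1) If $G$ is a complete graph, then $\mathcal{E}(G)=2\tau(G)$. (2) If $G$ is a bipartite graph, then $\mathcal{E}(G)\geq 2\tau(G)$. (3) If $G$ is a cycle, then $\mathcal{E}(G)\geq 2\tau(G)$.
   Context: All graphs are finite, simple and undirected. The energy $\mathcal{E}(G)$ is the sum of the absolute values of all eigenvalues (with multiplicity) of the adjacency matrix $A(G)$. The vertex cover number $\tau(G)$ is the minimum cardinality of a set $X\subseteq V(G)$ such that every edge of $G$ has at least one endpoint in $X$. -}

module Defs where

open import Level using (0ℓ)
open import Algebra.Bundles.Raw using (RawRing)
open import Data.Bool.Base using (Bool; if_then_else_)
open import Data.Fin.Base using (Fin; zero; suc; toℕ)
import Data.Fin.Properties as Fin
open import Data.Fin.Permutation using (Permutation′; _⟨$⟩ʳ_)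
open import Data.Fin.Subset using (Subset; ⊤; ∣_∣; _∈_)
open import Data.Fin.Subset.Properties using (∈⊤; _∈?_; anySubset?)
import Data.Integer.Base as ℤ
open import Data.Nat.Base as ℕ using (ℕ; zero; suc)
import Data.Nat.Properties as ℕ
open import Data.Nat.Induction using (<-wellFounded)
open import Data.Product.Base using (_×_; _,_; ∃; ∃-syntax; proj₁)
open import Data.Rational.Base as ℚ using (ℚ; 0ℚ; 1ℚ; Positive)
import Data.Rational.Properties as ℚ
open import Data.Rational.Solver using (module +-*-Solver)
open import Data.Sum.Base using (_⊎_; inj₁; inj₂)
open import Data.Vec.Functional using (Vector; foldr; removeAt)
open import Function.Bundles using (_⇔_)
open import Induction.WellFounded using (Acc; acc)
open import Relation.Binary.Core using (Rel)
open import Relation.Binary.Definitions using (Decidable; Symmetric)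
open import Relation.Binary.PropositionalEquality
open import Relation.Nullary.Decidable using (yes; no; does; _×-dec_; _⊎-dec_; _→-dec_)
open import Relation.Nullary.Negation using (¬_)
import Relation.Unary as U

-- Real numbers are Cauchy sequences of rationals with pointwise arithmetic,
-- identified by the setoid equality _≈_ (the difference tends to 0).

Cauchy : (ℕ → ℚ) → Set
Cauchy x = ∀ ε → 0ℚ ℚ.< ε →
  ∃[ N ] ∀ m n → N ℕ.≤ m → N ℕ.≤ n → ℚ.∣ x m ℚ.- x n ∣ ℚ.< ε

record ℝ : Set where
  constructor mkℝ
  field
    seq    : ℕ → ℚ
    cauchy : Cauchy seq

open ℝ public

infix 4 _≈_ _≤_ _≥_

_≈_ : Rel ℝ 0ℓ
x ≈ y = ∀ ε → 0ℚ ℚ.< ε → ∃[ N ] ∀ n → N ℕ.≤ n → ℚ.∣ seq x n ℚ.- seq y n ∣ ℚ.< ε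

_≤_ : Rel ℝ 0ℓ
x ≤ y = ∀ ε → 0ℚ ℚ.< ε → ∃[ N ] ∀ n → N ℕ.≤ n → seq x n ℚ.< seq y n ℚ.+ ε

_≥_ : Rel ℝ 0ℓ
x ≥ y = y ≤ x

private
  open +-*-Solver using (solve; _:=_; _:+_; _:-_; _:*_; :-_)

  abstract
    half : ∀ ε → 0ℚ ℚ.< ε → 0ℚ ℚ.< ℚ.½ ℚ.* ε
    half ε ε>0 = subst (ℚ._< ℚ.½ ℚ.* ε) (ℚ.*-zeroʳ ℚ.½) (ℚ.*-monoʳ-<-pos ℚ.½ ε>0)

    half+half : ∀ ε → ℚ.½ ℚ.* ε ℚ.+ ℚ.½ ℚ.* ε ≡ ε
    half+half ε = trans (sym (ℚ.*-distribʳ-+ ε ℚ.½ ℚ.½)) (ℚ.*-identityˡ ε)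

    abs-sym : ∀ p q → ℚ.∣ p ℚ.- q ∣ ≡ ℚ.∣ q ℚ.- p ∣
    abs-sym p q = trans (cong ℚ.∣_∣ (swap p q)) (ℚ.∣-p∣≡∣p∣ (q ℚ.- p))
      where
      swap : ∀ p q → p ℚ.- q ≡ ℚ.- (q ℚ.- p)
      swap = solve 2 (λ p q → p :- q := :- (q :- p)) refl

    abs-split : ∀ p q → ℚ.∣ p ∣ ℚ.≤ ℚ.∣ p ℚ.- q ∣ ℚ.+ ℚ.∣ q ∣
    abs-split p q = subst (λ z → ℚ.∣ z ∣ ℚ.≤ ℚ.∣ p ℚ.- q ∣ ℚ.+ ℚ.∣ q ∣)
      (cancel p q) (ℚ.∣p+q∣≤∣p∣+∣q∣ (p ℚ.- q) q)
      where
      cancel : ∀ p q → (p ℚ.- q) ℚ.+ q ≡ p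
      cancel = solve 2 (λ p q → (p :- q) :+ q := p) refl

    abs-diff : ∀ p q → ℚ.∣ p ∣ ℚ.- ℚ.∣ q ∣ ℚ.≤ ℚ.∣ p ℚ.- q ∣
    abs-diff p q = subst (ℚ.∣ p ∣ ℚ.- ℚ.∣ q ∣ ℚ.≤_) (cancel ℚ.∣ p ℚ.- q ∣ ℚ.∣ q ∣)
      (ℚ.+-monoˡ-≤ (ℚ.- ℚ.∣ q ∣) (abs-split p q))
      where
      cancel : ∀ a b → (a ℚ.+ b) ℚ.- b ≡ a
      cancel = solve 2 (λ a b → (a :+ b) :- b := a) refl

    abs-lipschitz : ∀ p q → ℚ.∣ ℚ.∣ p ∣ ℚ.- ℚ.∣ q ∣ ∣ ℚ.≤ ℚ.∣ p ℚ.- q ∣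
    abs-lipschitz p q with ℚ.∣p∣≡p∨∣p∣≡-p (ℚ.∣ p ∣ ℚ.- ℚ.∣ q ∣)
    ... | inj₁ eq = subst (ℚ._≤ ℚ.∣ p ℚ.- q ∣) (sym eq) (abs-diff p q)
    ... | inj₂ eq = subst₂ ℚ._≤_ (sym (trans eq (swap ℚ.∣ p ∣ ℚ.∣ q ∣))) (abs-sym q p) (abs-diff q p)
      where
      swap : ∀ p q → ℚ.- (p ℚ.- q) ≡ q ℚ.- p
      swap = solve 2 (λ p q → :- (p :- q) := q :- p) refl

    +-cauchy : ∀ {x y} → Cauchy x → Cauchy y → Cauchy (λ n → x n ℚ.+ y n)
    +-cauchy {x} {y} cx cy ε ε>0 with cx _ (half ε ε>0) | cy _ (half ε ε>0)
    ... | N , hN | M , hM = N ℕ.⊔ M , λ m n m≥ n≥ → begin-strict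
      ℚ.∣ (x m ℚ.+ y m) ℚ.- (x n ℚ.+ y n) ∣
        ≡⟨ cong ℚ.∣_∣ (regroup (x m) (y m) (x n) (y n)) ⟩
      ℚ.∣ (x m ℚ.- x n) ℚ.+ (y m ℚ.- y n) ∣
        ≤⟨ ℚ.∣p+q∣≤∣p∣+∣q∣ (x m ℚ.- x n) (y m ℚ.- y n) ⟩
      ℚ.∣ x m ℚ.- x n ∣ ℚ.+ ℚ.∣ y m ℚ.- y n ∣
        <⟨ ℚ.+-mono-< (hN m n (ℕ.m⊔n≤o⇒m≤o N M m≥) (ℕ.m⊔n≤o⇒m≤o N M n≥))
                      (hM m n (ℕ.m⊔n≤o⇒n≤o N M m≥) (ℕ.m⊔n≤o⇒n≤o N M n≥)) ⟩
      ℚ.½ ℚ.* ε ℚ.+ ℚ.½ ℚ.* ε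
        ≡⟨ half+half ε ⟩
      ε ∎
      where
      open ℚ.≤-Reasoning
      regroup : ∀ a b c d → (a ℚ.+ b) ℚ.- (c ℚ.+ d) ≡ (a ℚ.- c) ℚ.+ (b ℚ.- d)
      regroup = solve 4 (λ a b c d → (a :+ b) :- (c :+ d) := (a :- c) :+ (b :- d)) refl

    neg-cauchy : ∀ {x} → Cauchy x → Cauchy (λ n → ℚ.- x n)
    neg-cauchy {x} cx ε ε>0 with cx ε ε>0
    ... | N , hN = N , λ m n m≥ n≥ →
      subst (λ z → ℚ.∣ z ∣ ℚ.< ε) (swap (x n) (x m)) (hN n m n≥ m≥)
      where
      swap : ∀ p q → p ℚ.- q ≡ (ℚ.- q) ℚ.- (ℚ.- p)
      swap = solve 2 (λ p q → p :- q := (:- q) :- (:- p)) refl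

    abs-cauchy : ∀ {x} → Cauchy x → Cauchy (λ n → ℚ.∣ x n ∣)
    abs-cauchy {x} cx ε ε>0 with cx ε ε>0
    ... | N , hN = N , λ m n m≥ n≥ →
      ℚ.≤-<-trans (abs-lipschitz (x m) (x n)) (hN m n m≥ n≥)

    const-cauchy : ∀ q → Cauchy (λ _ → q)
    const-cauchy q ε ε>0 = 0 , λ _ _ _ _ →
      subst (λ z → ℚ.∣ z ∣ ℚ.< ε) (sym (ℚ.+-inverseʳ q)) ε>0

    bounded : ∀ {x} → Cauchy x →
      ∃[ K ] Positive K × ∃[ N ] ∀ n → N ℕ.≤ n → ℚ.∣ x n ∣ ℚ.≤ K
    bounded {x} cx with cx 1ℚ (ℚ.positive⁻¹ 1ℚ)
    ... | N , hN = 1ℚ ℚ.+ ℚ.∣ x N ∣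
      , ℚ.positive (ℚ.+-mono-<-≤ (ℚ.positive⁻¹ 1ℚ) (ℚ.0≤∣p∣ (x N)))
      , N , λ n n≥ → ℚ.≤-trans (abs-split (x n) (x N))
                       (ℚ.+-monoˡ-≤ ℚ.∣ x N ∣ (ℚ.<⇒≤ (hN n N n≥ ℕ.≤-refl)))

    ∣*∣-bound : ∀ B δ p q → .{{Positive B}} →
      ℚ.∣ p ∣ ℚ.≤ B → ℚ.∣ q ∣ ℚ.< δ → ℚ.∣ p ℚ.* q ∣ ℚ.< B ℚ.* δ
    ∣*∣-bound B δ p q p≤B q<δ = begin-strict
      ℚ.∣ p ℚ.* q ∣       ≡⟨ ℚ.∣p*q∣≡∣p∣*∣q∣ p q ⟩
      ℚ.∣ p ∣ ℚ.* ℚ.∣ q ∣ ≤⟨ ℚ.*-monoʳ-≤-nonNeg ℚ.∣ q ∣ {{ℚ.nonNegative (ℚ.0≤∣p∣ q)}} p≤B ⟩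
      B ℚ.* ℚ.∣ q ∣       <⟨ ℚ.*-monoʳ-<-pos B q<δ ⟩
      B ℚ.* δ             ∎
      where open ℚ.≤-Reasoning

    *-close : ∀ K L δ a b c d → .{{Positive K}} → .{{Positive L}} →
      ℚ.∣ a ∣ ℚ.≤ K → ℚ.∣ d ∣ ℚ.≤ L → ℚ.∣ a ℚ.- c ∣ ℚ.< δ → ℚ.∣ b ℚ.- d ∣ ℚ.< δ →
      ℚ.∣ a ℚ.* b ℚ.- c ℚ.* d ∣ ℚ.< K ℚ.* δ ℚ.+ L ℚ.* δ
    *-close K L δ a b c d a≤K d≤L a-c<δ b-d<δ = begin-strict
      ℚ.∣ a ℚ.* b ℚ.- c ℚ.* d ∣
        ≡⟨ cong ℚ.∣_∣ (regroup a b c d) ⟩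
      ℚ.∣ a ℚ.* (b ℚ.- d) ℚ.+ d ℚ.* (a ℚ.- c) ∣
        ≤⟨ ℚ.∣p+q∣≤∣p∣+∣q∣ (a ℚ.* (b ℚ.- d)) (d ℚ.* (a ℚ.- c)) ⟩
      ℚ.∣ a ℚ.* (b ℚ.- d) ∣ ℚ.+ ℚ.∣ d ℚ.* (a ℚ.- c) ∣
        <⟨ ℚ.+-mono-< (∣*∣-bound K δ a (b ℚ.- d) a≤K b-d<δ) (∣*∣-bound L δ d (a ℚ.- c) d≤L a-c<δ) ⟩
      K ℚ.* δ ℚ.+ L ℚ.* δ ∎
      where
      open ℚ.≤-Reasoning
      regroup : ∀ a b c d → a ℚ.* b ℚ.- c ℚ.* d ≡ a ℚ.* (b ℚ.- d) ℚ.+ d ℚ.* (a ℚ.- c)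
      regroup = solve 4 (λ a b c d → a :* b :- c :* d := a :* (b :- d) :+ d :* (a :- c)) refl

    share : ∀ K L ε → .{{Positive K}} → .{{Positive L}} → 0ℚ ℚ.< ε →
      ∃[ δ ] 0ℚ ℚ.< δ × K ℚ.* δ ℚ.+ L ℚ.* δ ≡ ε
    share K L ε ε>0 = (ℚ.1/ S) ℚ.* ε , δ>0 , sum
      where
      S : ℚ
      S = K ℚ.+ L
      instance
        S-pos : Positive S
        S-pos = ℚ.positive (ℚ.+-mono-< (ℚ.positive⁻¹ K) (ℚ.positive⁻¹ L))
        S≢0 : ℚ.NonZero S
        S≢0 = ℚ.pos⇒nonZero S
      δ>0 : 0ℚ ℚ.< (ℚ.1/ S) ℚ.* ε
      δ>0 = subst (ℚ._< (ℚ.1/ S) ℚ.* ε) (ℚ.*-zeroʳ (ℚ.1/ S))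
        (ℚ.*-monoʳ-<-pos (ℚ.1/ S) {{ℚ.1/pos⇒pos S}} ε>0)
      sum : K ℚ.* ((ℚ.1/ S) ℚ.* ε) ℚ.+ L ℚ.* ((ℚ.1/ S) ℚ.* ε) ≡ ε
      sum = trans (sym (ℚ.*-distribʳ-+ ((ℚ.1/ S) ℚ.* ε) K L))
        (trans (sym (ℚ.*-assoc S (ℚ.1/ S) ε))
          (trans (cong (ℚ._* ε) (ℚ.*-inverseʳ S)) (ℚ.*-identityˡ ε)))

    *-cauchy : ∀ {x y} → Cauchy x → Cauchy y → Cauchy (λ n → x n ℚ.* y n)
    *-cauchy {x} {y} cx cy ε ε>0 =
      let K , K>0 , Nx , bx = bounded {x} cx
          L , L>0 , Ny , by = bounded {y} cy
          δ , δ>0 , sum     = share K L ε {{K>0}} {{L>0}} ε>0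
          Mx , hx           = cx δ δ>0
          My , hy           = cy δ δ>0
      in (Nx ℕ.⊔ Ny) ℕ.⊔ (Mx ℕ.⊔ My) , λ m n m≥ n≥ →
        let m≥N = ℕ.m⊔n≤o⇒m≤o (Nx ℕ.⊔ Ny) (Mx ℕ.⊔ My) m≥
            n≥N = ℕ.m⊔n≤o⇒m≤o (Nx ℕ.⊔ Ny) (Mx ℕ.⊔ My) n≥
            m≥M = ℕ.m⊔n≤o⇒n≤o (Nx ℕ.⊔ Ny) (Mx ℕ.⊔ My) m≥
            n≥M = ℕ.m⊔n≤o⇒n≤o (Nx ℕ.⊔ Ny) (Mx ℕ.⊔ My) n≥
        in subst (ℚ.∣ x m ℚ.* y m ℚ.- x n ℚ.* y n ∣ ℚ.<_) sum
          (*-close K L δ (x m) (y m) (x n) (y n) {{K>0}} {{L>0}}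
            (bx m (ℕ.m⊔n≤o⇒m≤o Nx Ny m≥N)) (by n (ℕ.m⊔n≤o⇒n≤o Nx Ny n≥N))
            (hx m n (ℕ.m⊔n≤o⇒m≤o Mx My m≥M) (ℕ.m⊔n≤o⇒m≤o Mx My n≥M))
            (hy m n (ℕ.m⊔n≤o⇒n≤o Mx My m≥M) (ℕ.m⊔n≤o⇒n≤o Mx My n≥M)))

infixl 6 _+_ _-_
infixl 7 _*_
infix  8 -_

fromℚ : ℚ → ℝ
fromℚ q = mkℝ (λ _ → q) (const-cauchy q)

fromℕ : ℕ → ℝ
fromℕ n = fromℚ (ℤ.+ n ℚ./ 1)

0ℝ 1ℝ : ℝ
0ℝ = fromℚ 0ℚ
1ℝ = fromℚ 1ℚ

_+_ _*_ : ℝ → ℝ → ℝ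
x + y = mkℝ (λ n → seq x n ℚ.+ seq y n) (+-cauchy {seq x} {seq y} (cauchy x) (cauchy y))
x * y = mkℝ (λ n → seq x n ℚ.* seq y n) (*-cauchy {seq x} {seq y} (cauchy x) (cauchy y))

-_ : ℝ → ℝ
- x = mkℝ (λ n → ℚ.- seq x n) (neg-cauchy {seq x} (cauchy x))

_-_ : ℝ → ℝ → ℝ
x - y = x + (- y)

abs : ℝ → ℝ
abs x = mkℝ (λ n → ℚ.∣ seq x n ∣) (abs-cauchy {seq x} (cauchy x))

ℝ-rawRing : RawRing 0ℓ 0ℓ
ℝ-rawRing = record
  { Carrier = ℝ ; _≈_ = _≈_ ; _+_ = _+_ ; _*_ = _*_ ; -_ = -_ ; 0# = 0ℝ ; 1# = 1ℝ }

Matrix : Set → ℕ → Set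
Matrix A n = Vector (Vector A n) n

module LinearAlgebra (R : RawRing 0ℓ 0ℓ) where
  open RawRing R renaming
    (Carrier to A; _+_ to _⊕_; _*_ to _⊛_; -_ to ⊝_; 0# to 𝟘; 1# to 𝟙; _≈_ to _≋_)

  ∑ ∏ : ∀ {n} → Vector A n → A
  ∑ = foldr _⊕_ 𝟘
  ∏ = foldr _⊛_ 𝟙

  sign : ℕ → A
  sign zero    = 𝟙
  sign (suc k) = ⊝ (sign k)

  minor : ∀ {n} → Matrix A (suc n) → Fin (suc n) → Matrix A n
  minor M j i = removeAt (M (suc i)) j

  -- Laplace expansion along the first row.
  det : ∀ {n} → Matrix A n → A
  det {zero}  M = 𝟙
  det {suc n} M = ∑ λ j → sign (toℕ j) ⊛ (M zero j ⊛ det (minor M j))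

open LinearAlgebra ℝ-rawRing public

charPoly : ∀ {n} → Matrix ℝ n → ℝ → ℝ
charPoly A x = det λ i j → (if does (i Fin.≟ j) then x else 0ℝ) - A i j

-- λs lists all eigenvalues of A with multiplicity: the characteristic
-- polynomial is the product of the X - λᵢ.  Since ℝ is infinite, equality of
-- these polynomials is equality of their values at every x.
IsSpectrum : ∀ {n} → Matrix ℝ n → Vector ℝ n → Set
IsSpectrum A λs = ∀ x → charPoly A x ≈ ∏ λ i → x - λs i

record Graph (n : ℕ) : Set₁ where
  field
    Adj    : Rel (Fin n) 0ℓ
    adj?   : Decidable Adj
    symm   : Symmetric Adj
    irrefl : ∀ i → ¬ Adj i i

open Graph public using (Adj; adj?)

private
  variable
    n : ℕ

adjacency : Graph n → Matrix ℝ n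
adjacency G i j = if does (adj? G i j) then 1ℝ else 0ℝ

-- A relation rather than a function of G: as the λs are determined up to
-- order, so is e up to _≈_, and no root-finding procedure is needed.
IsEnergy : Graph n → ℝ → Set
IsEnergy G e = ∃[ λs ] IsSpectrum (adjacency G) λs × e ≈ ∑ (λ i → abs (λs i))

IsVertexCover : Graph n → Subset n → Set
IsVertexCover G X = ∀ i j → Adj G i j → i ∈ X ⊎ j ∈ X

IsMinimumVertexCover : Graph n → Subset n → Set
IsMinimumVertexCover G X =
  IsVertexCover G X × (∀ Y → IsVertexCover G Y → ∣ X ∣ ℕ.≤ ∣ Y ∣)

isVertexCover? : (G : Graph n) → U.Decidable (IsVertexCover G)
isVertexCover? G X =
  Fin.all? λ i → Fin.all? λ j → adj? G i j →-dec (i ∈? X ⊎-dec j ∈? X)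

minimumVertexCover : (G : Graph n) → ∃ (IsMinimumVertexCover G)
minimumVertexCover {n} G = descend ⊤ (λ _ _ _ → inj₁ ∈⊤) (<-wellFounded _)
  where
  descend : ∀ X → IsVertexCover G X → Acc ℕ._<_ ∣ X ∣ → ∃ (IsMinimumVertexCover G)
  descend X cover (acc smaller)
    with anySubset? (λ Y → isVertexCover? G Y ×-dec (∣ Y ∣ ℕ.<? ∣ X ∣))
  ... | yes (Y , cover′ , Y<X) = descend Y cover′ (smaller Y<X)
  ... | no  none = X , cover , λ Y cover′ → ℕ.≮⇒≥ λ Y<X → none (Y , cover′ , Y<X)

τ : Graph n → ℕ
τ G = ∣ proj₁ (minimumVertexCover G) ∣

IsComplete : Graph n → Set
IsComplete G = ∀ i j → i ≢ j → Adj G i j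

IsBipartite : Graph n → Set
IsBipartite {n} G =
  ∃ λ (side : Fin n → Bool) → ∀ i j → Adj G i j → side i ≢ side j

-- j follows i in the cyclic order 0, 1, …, n - 1, 0.
Next : Rel (Fin n) 0ℓ
Next {n} i j = toℕ j ≡ suc (toℕ i) ⊎ (suc (toℕ i) ≡ n × toℕ j ≡ 0)

IsCycle : Graph n → Set
IsCycle {n} G = 3 ℕ.≤ n × ∃ λ (v : Permutation′ n) → ∀ i j →
  Adj G (v ⟨$⟩ʳ i) (v ⟨$⟩ʳ j) ⇔ (Next i j ⊎ Next j i)

{-# OPTIONS --safe #-}

-- All claims are stable under double negation, so one may reason classically
-- about real numbers.  The adjacency matrix A is orthogonally diagonalised by
-- deflation: the roots λₖ of its characteristic polynomial are given, a root
-- has a unit eigenvector because det (λₖ I - A) = 0, and a product of plane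
-- rotations moves this vector to the first axis.  Hence there is an
-- orthonormal basis qₖ with A qₖ = λₖ qₖ.
--
-- For a permutation π, |Σᵢ qₖ(i) qₖ(π i)| ≤ 1 gives
-- Σ |λₖ| ≥ Σₖ λₖ Σᵢ qₖ(i) qₖ(π i) = Σᵢ A(i, π i).  For a bipartite graph König's
-- theorem provides an involution π that makes the right-hand side at least
-- 2τ; for an even cycle the rotation gives n = 2τ.  On a complete graph the
-- eigenvalues are n - 1 and -1, where |λ| is an affine function of λ, and
-- Σ λₖ = tr A = 0.  On an odd cycle with n ≥ 5 the eigenvalues lie in [-2, 2],
-- where |λ| has an even polynomial minorant of degree 6, and the power sums
-- Σ λₖ² = 2n, Σ λₖ⁴ = 6n and Σ λₖ⁶ = 20n give Σ |λₖ| ≥ n + 1 ≥ 2τ.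
module Submission where

open import Level using (0ℓ)
open import Algebra.Bundles using (CommutativeRing)
open import Algebra.Solver.Ring.AlmostCommutativeRing
  using (fromCommutativeRing; _-Raw-AlmostCommutative⟶_)
open import Data.Bool.Base as Bool using (Bool; true; false; if_then_else_)
import Data.Bool.Properties as Bool
open import Data.Fin.Base using (Fin; zero; suc; toℕ; fromℕ<; punchIn)
open import Data.Fin.Permutation
  using (Permutation′; permutation; _⟨$⟩ʳ_; _⟨$⟩ˡ_; inverseˡ; inverseʳ; flip; _∘ₚ_)
import Data.Fin.Properties as Fin
import Data.Integer.Base as ℤ
import Data.Integer.Properties as ℤ
open import Data.Maybe.Base using (Maybe; just; nothing)
import Data.Nat.Coprimality as Coprime
open import Data.Nat.Base as ℕ using (ℕ; zero; suc; z≤n; s≤s)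
open import Data.Nat.Divisibility using (_∣_; divides; ∣⇒≤; _∣?_)
open import Data.Nat.Induction using (<-wellFounded)
import Data.Nat.Properties as ℕ
open import Data.Product.Base using (_×_; _,_; ∃; ∃-syntax; proj₁; proj₂)
open import Data.Rational.Base as ℚ using (ℚ; 0ℚ; 1ℚ; mkℚ; *≤*)
import Data.Rational.Properties as ℚ
open import Data.Rational.Solver using (module +-*-Solver)
open import Data.Sum.Base as Sum using (_⊎_; inj₁; inj₂)
import Data.Vec.Base as Vec
import Data.Vec.Functional as Vector
open Vector using (Vector)
open import Function.Base using (_∘_; id; const)
open import Function.Bundles using (_⇔_; Equivalence)
open import Induction.WellFounded using (Acc; acc)
open import Relation.Binary.Core using (Rel)
open import Relation.Binary.Definitions using (Decidable; Symmetric)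
open import Relation.Binary.PropositionalEquality as ≡ using (_≡_; _≢_)
open import Relation.Nullary.Decidable
  using (Dec; yes; no; does; from-no; _×-dec_; _⊎-dec_; _→-dec_; ¬?)
open import Relation.Nullary.Negation using (¬_; contradiction)
import Relation.Unary as Unary
open import Defs using
  ( Matrix; module LinearAlgebra; Graph; Adj; adj?; minimumVertexCover; τ
  ; IsComplete; IsBipartite; Next; IsCycle )

import Algebra.Properties.CommutativeMonoid.Sum ℕ.+-0-commutativeMonoid as ℕSum

-- Deflation meets one obstacle. Once λ₀ is split off, the identity for the smaller characteristic
-- polynomial is known only after multiplication by x - λ₀, and this factor cannot be cancelled at x
-- = λ₀. Hence determinants are shown to be polynomial functions of x, and agreement at infinitely
-- many points other than λ₀ is enough.
--
-- On odd cycles the tight case is n = 5. The power sums of order two and four give only 2n/√3 by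
-- Hölder's inequality, which is less than n + 1 there, so the sixth one enters. The best even
-- minorant of degree 6 touches |x| at 0, √2 and 2 and gives (1 + √2) n / 2, about 1.207 n. Moving
-- √2 to 3/2 keeps the coefficients rational and gives 3190 n / 2646, about 1.2056 n, which exceeds
-- n + 1 exactly from n = 5 on.

infixl 1 _>>=_

_>>=_ : {A B : Set} → ¬ ¬ A → (A → ¬ ¬ B) → ¬ ¬ B
(¬¬a >>= f) ¬b = ¬¬a λ a → f a ¬b

return : {A : Set} → A → ¬ ¬ A
return a ¬a = ¬a a

¬¬-em : (A : Set) → ¬ ¬ (A ⊎ ¬ A)
¬¬-em A k = k (inj₂ λ a → k (inj₁ a))

-- Sums and determinants over a commutative ring with rational scalars

module CommutativeAlgebra
  (R : CommutativeRing 0ℓ 0ℓ)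
  (scalar : ℚ.+-*-rawRing -Raw-AlmostCommutative⟶ fromCommutativeRing R)
  where

  open CommutativeRing R renaming (Carrier to A) hiding (zero)
  private
    module L = LinearAlgebra rawRing
  open L using (∏; sign; minor)
  open Vector using (_∷_)
  import Algebra.Properties.Semiring.Sum semiring as Sums
  open import Algebra.Properties.Ring ring using (-0#≈0#; -‿involutive; -‿distribˡ-*)
  open import Relation.Binary.Reasoning.Setoid setoid

  ℚ-equal? : ∀ p q → Maybe (_-Raw-AlmostCommutative⟶_.⟦_⟧ scalar p ≈ _-Raw-AlmostCommutative⟶_.⟦_⟧ scalar q)
  ℚ-equal? p q with p ℚ.≟ q
  ... | yes ≡.refl = just refl
  ... | no  _      = nothing

  open import Algebra.Solver.Ring ℚ.+-*-rawRing (fromCommutativeRing R) scalar ℚ-equal?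
    using (solve; con; _:=_; _:+_; _:-_; _:*_; :-_) public

  private
    variable
      k m n : ℕ

  -- Opaque, because ∑ and det reduce on lengths of the form suc n, after which
  -- their arguments can no longer be inferred.
  opaque
    ∑ : Vector A n → A
    ∑ = L.∑

    det : Matrix A n → A
    det = L.det

    ∑-unfold : (u : Vector A n) → ∑ u ≡ L.∑ u
    ∑-unfold u = ≡.refl

    det-unfold : (M : Matrix A n) → det M ≡ L.det M
    det-unfold M = ≡.refl

    ∑-empty : (u : Vector A 0) → ∑ u ≈ 0#
    ∑-empty u = refl

    ∑-suc : (u : Vector A (suc n)) → ∑ u ≈ u zero + ∑ (u ∘ suc)
    ∑-suc u = refl

    ∑-cong : {u v : Vector A n} → (∀ i → u i ≈ v i) → ∑ u ≈ ∑ v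
    ∑-cong = Sums.sum-cong-≋

    ∑-0 : ∑ {n} (const 0#) ≈ 0#
    ∑-0 {n} = Sums.sum-replicate-zero n

    ∑-+ : (u v : Vector A n) → ∑ (λ i → u i + v i) ≈ ∑ u + ∑ v
    ∑-+ {n} = Sums.∑-distrib-+ {n}

    ∑-* : ∀ c (u : Vector A n) → ∑ (λ i → c * u i) ≈ c * ∑ u
    ∑-* {n} c u = sym (Sums.*-distribˡ-sum {n} c u)

    ∑-swap : (f : Fin m → Fin n → A) → ∑ (λ i → ∑ λ j → f i j) ≈ ∑ (λ j → ∑ λ i → f i j)
    ∑-swap {m} {n} = Sums.∑-comm {m} {n}

    ∑-permute : (u : Vector A n) (π : Permutation′ n) → ∑ u ≈ ∑ (λ i → u (π ⟨$⟩ʳ i))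
    ∑-permute {n} = Sums.∑-permute {n} {n}

    det-empty : (M : Matrix A 0) → det M ≈ 1#
    det-empty M = refl

    det-row : (M : Matrix A (suc n)) →
      det M ≈ ∑ λ j → sign (toℕ j) * (M zero j * det (minor M j))
    det-row M = refl

    det-cong : {M N : Matrix A n} → (∀ i j → M i j ≈ N i j) → det M ≈ det N
    det-cong {zero}  e = refl
    det-cong {suc n} e = ∑-cong λ j → *-congˡ {sign (toℕ j)}
      (*-cong (e zero j) (det-cong λ i k → e (suc i) (punchIn j k)))

  ∑-zero : {u : Vector A n} → (∀ i → u i ≈ 0#) → ∑ u ≈ 0#
  ∑-zero u≈0 = trans (∑-cong u≈0) ∑-0

  ∑-linear : ∀ c d (u v : Vector A n) → ∑ (λ i → c * u i + d * v i) ≈ c * ∑ u + d * ∑ v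
  ∑-linear {n} c d u v = trans (∑-+ _ _) (+-cong (∑-* c u) (∑-* d v))

  -- Row `r` is described by entrywise equations between three matrices, so the hypotheses restrict
  -- to minors as they stand: for the first row the minors coincide, otherwise linearity passes to
  -- them by induction.
  det-linear : ∀ r c d {M N P : Matrix A n} →
    (∀ j → M r j ≈ c * N r j + d * P r j) →
    (∀ i → i ≢ r → ∀ j → M i j ≈ N i j × M i j ≈ P i j) →
    det M ≈ c * det N + d * det P
  det-linear {suc n} zero c d {M} {N} {P} comb rest = trans (det-row M) (trans
    (∑-cong λ j → let s = sign (toℕ j) in begin
      s * (M zero j * det (minor M j))
        ≈⟨ *-congˡ (*-congʳ (comb j)) ⟩
      s * ((c * N zero j + d * P zero j) * det (minor M j))
        ≈⟨ solve 6 (λ s c d a b m → s :* ((c :* a :+ d :* b) :* m)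
             := c :* (s :* (a :* m)) :+ d :* (s :* (b :* m))) refl
             s c d (N zero j) (P zero j) (det (minor M j)) ⟩
      c * (s * (N zero j * det (minor M j))) + d * (s * (P zero j * det (minor M j)))
        ≈⟨ +-cong
             (*-congˡ (*-congˡ (*-congˡ (det-cong λ i k → proj₁ (rest (suc i) (λ ()) (punchIn j k))))))
             (*-congˡ (*-congˡ (*-congˡ (det-cong λ i k → proj₂ (rest (suc i) (λ ()) (punchIn j k)))))) ⟩
      c * (s * (N zero j * det (minor N j))) + d * (s * (P zero j * det (minor P j))) ∎)
    (trans (∑-linear c d _ _) (sym (+-cong (*-congˡ (det-row N)) (*-congˡ (det-row P))))))
  det-linear {suc n} (suc r) c d {M} {N} {P} comb rest = trans (det-row M) (trans
    (∑-cong λ j → let s = sign (toℕ j) in begin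
      s * (M zero j * det (minor M j))
        ≈⟨ *-congˡ (*-congˡ (det-linear r c d (λ k → comb (punchIn j k))
             (λ i i≢r k → rest (suc i) (i≢r ∘ Fin.suc-injective) (punchIn j k)))) ⟩
      s * (M zero j * (c * det (minor N j) + d * det (minor P j)))
        ≈⟨ solve 6 (λ s c d a x y → s :* (a :* (c :* x :+ d :* y))
             := c :* (s :* (a :* x)) :+ d :* (s :* (a :* y))) refl
             s c d (M zero j) (det (minor N j)) (det (minor P j)) ⟩
      c * (s * (M zero j * det (minor N j))) + d * (s * (M zero j * det (minor P j)))
        ≈⟨ +-cong (*-congˡ (*-congˡ (*-congʳ (proj₁ (rest zero (λ ()) j)))))
                  (*-congˡ (*-congˡ (*-congʳ (proj₂ (rest zero (λ ()) j))))) ⟩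
      c * (s * (N zero j * det (minor N j))) + d * (s * (P zero j * det (minor P j))) ∎)
    (trans (∑-linear c d _ _) (sym (+-cong (*-congˡ (det-row N)) (*-congˡ (det-row P))))))

  -- Transposition and alternation of the determinant

  _ᵀ : Vector (Vector A n) m → Vector (Vector A m) n
  (M ᵀ) i j = M j i

  -- Expanding along row 0 and then expanding every minor but the corner's along its first column
  -- gives a double sum. With the sums exchanged it is the same expansion begun with column 0: the
  -- remaining blocks `D i j` agree, and the minus sign moves from j to i.
  det-column : (M : Matrix A (suc n)) →
    det M ≈ ∑ λ i → sign (toℕ i) * (M i zero * det λ k l → M (punchIn i k) (suc l))
  det-column {zero}  M = trans (det-row M) (∑-cong λ { zero → *-congˡ (*-congˡ (det-cong λ ())) })
  det-column {suc n} M = begin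
    det M
      ≈⟨ trans (det-row M) (∑-suc _) ⟩
    corner + ∑ (λ j → - sign (toℕ j) * (M zero (suc j) * det (minor M (suc j))))
      ≈⟨ +-congˡ (∑-cong λ j → *-congˡ (*-congˡ (det-column (minor M (suc j))))) ⟩
    corner + ∑ (λ j → - sign (toℕ j) * (M zero (suc j) * ∑ λ i → sign (toℕ i) * (M (suc i) zero * D i j)))
      ≈⟨ +-congˡ (∑-cong λ j → trans (∑-* _ _) (*-congˡ (∑-* _ _))) ⟨
    corner + ∑ (λ j → ∑ λ i → - sign (toℕ j) * (M zero (suc j) * (sign (toℕ i) * (M (suc i) zero * D i j))))
      ≈⟨ +-congˡ (∑-swap _) ⟩
    corner + ∑ (λ i → ∑ λ j → - sign (toℕ j) * (M zero (suc j) * (sign (toℕ i) * (M (suc i) zero * D i j))))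
      ≈⟨ +-congˡ (∑-cong λ i → ∑-cong λ j → solve 5 (λ s t a b d →
           (:- s) :* (a :* (t :* (b :* d))) := (:- t) :* (b :* (s :* (a :* d)))) refl
           (sign (toℕ j)) (sign (toℕ i)) (M zero (suc j)) (M (suc i) zero) (D i j)) ⟩
    corner + ∑ (λ i → ∑ λ j → - sign (toℕ i) * (M (suc i) zero * (sign (toℕ j) * (M zero (suc j) * D i j))))
      ≈⟨ +-congˡ (∑-cong λ i → trans (∑-* _ _) (*-congˡ (∑-* _ _))) ⟩
    corner + ∑ (λ i → - sign (toℕ i) * (M (suc i) zero * ∑ λ j → sign (toℕ j) * (M zero (suc j) * D i j)))
      ≈⟨ +-congˡ (∑-cong λ i → *-congˡ (*-congˡ (det-row _))) ⟨
    corner + ∑ (λ i → - sign (toℕ i) * (M (suc i) zero * det λ k l → M (punchIn (suc i) k) (suc l)))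
      ≈⟨ ∑-suc _ ⟨
    ∑ (λ i → sign (toℕ i) * (M i zero * det λ k l → M (punchIn i k) (suc l))) ∎
    where
    corner : A
    corner = 1# * (M zero zero * det λ k l → M (suc k) (suc l))
    D : Fin (suc n) → Fin (suc n) → A
    D i j = det λ k l → M (suc (punchIn i k)) (suc (punchIn j l))

  det-ᵀ : (M : Matrix A n) → det (M ᵀ) ≈ det M
  det-ᵀ {zero}  M = det-cong λ ()
  det-ᵀ {suc n} M = trans (det-row _) (trans
    (∑-cong λ i → *-congˡ (*-congˡ (det-ᵀ λ k l → M (punchIn i k) (suc l))))
    (sym (det-column M)))

  -- In the expansion along row 0 the first two terms have equal minors and opposite signs, and
  -- every later minor again has its first two columns equal. Columns come before rows because this
  -- expansion deletes columns.
  det-equalColumns : (M : Matrix A (suc (suc n))) → (∀ i → M i zero ≈ M i (suc zero)) → det M ≈ 0#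
  det-equalColumns {n} M eq = begin
    det M
      ≈⟨ trans (det-row M) (trans (∑-suc _) (+-congˡ (∑-suc _))) ⟩
    1# * (M zero zero * det (minor M zero)) + (- 1# * (M zero (suc zero) * det (minor M (suc zero))) + ∑ (term M))
      ≈⟨ +-cong (*-congˡ (*-cong (eq zero) (det-cong minors))) (+-congˡ (∑-zero (vanish M eq))) ⟩
    1# * (M zero (suc zero) * det (minor M (suc zero))) + (- 1# * (M zero (suc zero) * det (minor M (suc zero))) + 0#)
      ≈⟨ solve 3 (λ e x z → e :* x :+ ((:- e) :* x :+ z) := z) refl 1# _ 0# ⟩
    0# ∎
    where
    term : ∀ {n} (M : Matrix A (suc (suc n))) → Fin n → A
    term M j = sign (suc (suc (toℕ j))) * (M zero (suc (suc j)) * det (minor M (suc (suc j))))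
    minors : ∀ i k → minor M zero i k ≈ minor M (suc zero) i k
    minors i zero    = sym (eq (suc i))
    minors i (suc k) = refl
    vanish : ∀ {n} (M : Matrix A (suc (suc n))) → (∀ i → M i zero ≈ M i (suc zero)) → ∀ j → term M j ≈ 0#
    vanish {suc n} M eq j = trans
      (*-congˡ (trans (*-congˡ (det-equalColumns (minor M (suc (suc j))) (eq ∘ suc))) (zeroʳ _))) (zeroʳ _)

  det-equalRows : (M : Matrix A (suc (suc n))) → (∀ j → M zero j ≈ M (suc zero) j) → det M ≈ 0#
  det-equalRows M eq = trans (sym (det-ᵀ M)) (det-equalColumns (M ᵀ) eq)

  module _ (M : Vector (Vector A (suc (suc n))) n) where
    private
      D : Vector A (suc (suc n)) → Vector A (suc (suc n)) → A
      D u v = det (u ∷ v ∷ M)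

      D-linearˡ : ∀ c d u v w → D (λ j → c * u j + d * v j) w ≈ c * D u w + d * D v w
      D-linearˡ c d u v w = det-linear zero c d (λ j → refl)
        λ { zero 0≢0 → contradiction ≡.refl 0≢0 ; (suc zero) _ j → refl , refl ; (suc (suc i)) _ j → refl , refl }

      D-linearʳ : ∀ c d u v w → D w (λ j → c * u j + d * v j) ≈ c * D w u + d * D w v
      D-linearʳ c d u v w = det-linear (suc zero) c d (λ j → refl)
        λ { zero _ j → refl , refl ; (suc zero) 1≢1 → contradiction ≡.refl 1≢1 ; (suc (suc i)) _ j → refl , refl }

      D-equal : ∀ u → D u u ≈ 0#
      D-equal u = det-equalRows _ λ j → refl

      D-swap : ∀ u v → D u v + D v u ≈ 0#
      D-swap u v = begin
        D u v + D v u
          -- The solver's constants are images of rationals, to which `0#` is equal only by a proof,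
          -- so it enters as the variable z. The subtractions undo the two zeros that become D u u
          -- and D v v.
          ≈⟨ solve 3 (λ z a b → a :+ b := (z :+ a) :+ (b :+ z) :- z :- z) refl 0# _ _ ⟩
        0# + D u v + (D v u + 0#) - 0# - 0#
          ≈⟨ +-congʳ (+-congʳ (+-cong (+-congʳ (D-equal u)) (+-congˡ (D-equal v)))) ⟨
        D u u + D u v + (D v u + D v v) - 0# - 0#
          ≈⟨ +-congʳ (+-congʳ (+-cong (unit (D u u) (D u v)) (unit (D v u) (D v v)))) ⟩
        1# * D u u + 1# * D u v + (1# * D v u + 1# * D v v) - 0# - 0#
          ≈⟨ +-congʳ (+-congʳ (+-cong (D-linearʳ 1# 1# u v u) (D-linearʳ 1# 1# u v v))) ⟨
        D u w + D v w - 0# - 0#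
          ≈⟨ +-congʳ (+-congʳ (unit (D u w) (D v w))) ⟩
        1# * D u w + 1# * D v w - 0# - 0#
          ≈⟨ +-congʳ (+-congʳ (D-linearˡ 1# 1# u v w)) ⟨
        D w w - 0# - 0#
          ≈⟨ +-congʳ (+-congʳ (D-equal w)) ⟩
        0# - 0# - 0#
          ≈⟨ solve 1 (λ z → z :- z :- z := :- z) refl 0# ⟩
        - 0#
          ≈⟨ -0#≈0# ⟩
        0# ∎
        where
        w : Vector A (suc (suc n))
        w j = 1# * u j + 1# * v j
        unit : ∀ a b → a + b ≈ 1# * a + 1# * b
        unit a b = sym (+-cong (*-identityˡ a) (*-identityˡ b))

    -- D is bilinear and alternating, so the expansion leaves (c² + s²) D u v. This two-row case is
    -- the source of the invariance of `det` under every rotation built later.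
    det-rotateRows : ∀ c s → c * c + s * s ≈ 1# → ∀ u v →
      det ((λ j → c * u j + s * v j) ∷ (λ j → - s * u j + c * v j) ∷ M) ≈ det (u ∷ v ∷ M)
    det-rotateRows c s c²+s²≈1 u v = begin
      D (λ j → c * u j + s * v j) w
        ≈⟨ D-linearˡ c s u v w ⟩
      c * D u w + s * D v w
        ≈⟨ +-cong (*-congˡ (D-linearʳ (- s) c u v u)) (*-congˡ (D-linearʳ (- s) c u v v)) ⟩
      c * (- s * D u u + c * D u v) + s * (- s * D v u + c * D v v)
        ≈⟨ solve 6 (λ c s uu uv vu vv → c :* ((:- s) :* uu :+ c :* uv) :+ s :* ((:- s) :* vu :+ c :* vv)
             := (c :* c :+ s :* s) :* uv :+ ((c :* s) :* (vv :- uu) :- (s :* s) :* (uv :+ vu))) refl c s _ _ _ _ ⟩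
      (c * c + s * s) * D u v + (c * s * (D v v - D u u) - s * s * (D u v + D v u))
        ≈⟨ +-cong (*-congʳ c²+s²≈1) (+-cong
             (*-congˡ (+-cong (D-equal v) (-‿cong (D-equal u))))
             (-‿cong (*-congˡ (D-swap u v)))) ⟩
      1# * D u v + (c * s * (0# - 0#) - s * s * 0#)
        ≈⟨ +-cong (*-identityˡ _) (+-cong (trans (*-congˡ (-‿inverseʳ 0#)) (zeroʳ _))
             (trans (-‿cong (zeroʳ _)) -0#≈0#)) ⟩
      D u v + (0# + 0#)
        ≈⟨ trans (+-congˡ (+-identityˡ 0#)) (+-identityʳ _) ⟩
      D u v ∎
      where
      w : Vector A (suc (suc n))
      w j = - s * u j + c * v j

  -- Matrix products and rotations

  infix 4 _≋_
  infixl 7 _·_ _▹_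

  _≋_ : Vector (Vector A n) m → Vector (Vector A n) m → Set
  M ≋ N = ∀ i j → M i j ≈ N i j

  _▹_ : Vector (Vector A n) m → Vector A n → Vector A m
  (M ▹ v) i = ∑ λ k → M i k * v k

  -- Each column of a product is definitionally a `_▹_`, so associativity and the unit laws are
  -- proved for vectors and reused for matrices.
  _·_ : Vector (Vector A n) m → Vector (Vector A k) n → Vector (Vector A k) m
  (M · N) i j = (M ▹ (N ᵀ) j) i

  δ : Matrix A n
  δ i j = if does (i Fin.≟ j) then 1# else 0#

  δ-sym : (i j : Fin n) → δ i j ≈ δ j i
  δ-sym zero    zero    = refl
  δ-sym zero    (suc j) = refl
  δ-sym (suc i) zero    = refl
  δ-sym (suc i) (suc j) = δ-sym i j

  ▹-cong : {M : Vector (Vector A n) m} {u v : Vector A n} → (∀ i → u i ≈ v i) → ∀ i → (M ▹ u) i ≈ (M ▹ v) i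
  ▹-cong u≈v i = ∑-cong λ k → *-congˡ (u≈v k)

  ·-cong : {M M′ : Vector (Vector A n) m} {N N′ : Vector (Vector A k) n} →
    M ≋ M′ → N ≋ N′ → M · N ≋ M′ · N′
  ·-cong M≋M′ N≋N′ i j = ∑-cong λ k → *-cong (M≋M′ i k) (N≋N′ k j)

  ▹-assoc : (M : Vector (Vector A n) m) (N : Vector (Vector A k) n) (v : Vector A k) →
    ∀ i → (M · N ▹ v) i ≈ (M ▹ (N ▹ v)) i
  ▹-assoc M N v i = begin
    ∑ (λ l → (∑ λ k → M i k * N k l) * v l)  ≈⟨ (∑-cong λ l → trans (*-comm _ _) (sym (∑-* (v l) _))) ⟩
    ∑ (λ l → ∑ λ k → v l * (M i k * N k l))  ≈⟨ ∑-swap _ ⟩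
    ∑ (λ k → ∑ λ l → v l * (M i k * N k l))
      ≈⟨ (∑-cong λ k → ∑-cong λ l → solve 3 (λ v a b → v :* (a :* b) := a :* (b :* v)) refl _ _ _) ⟩
    ∑ (λ k → ∑ λ l → M i k * (N k l * v l))  ≈⟨ (∑-cong λ k → ∑-* (M i k) _) ⟩
    ∑ (λ k → M i k * ∑ λ l → N k l * v l)    ∎

  ·-assoc : ∀ {l} (M : Vector (Vector A n) m) (N : Vector (Vector A k) n) (P : Vector (Vector A l) k) →
    (M · N) · P ≋ M · (N · P)
  ·-assoc M N P i j = ▹-assoc M N ((P ᵀ) j) i

  ·-ᵀ : (M : Vector (Vector A n) m) (N : Vector (Vector A k) n) → (M · N) ᵀ ≋ N ᵀ · M ᵀ
  ·-ᵀ M N i j = ∑-cong λ k → *-comm _ _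

  δ-▹ : (v : Vector A n) → ∀ i → (δ ▹ v) i ≈ v i
  δ-▹ {suc n} v zero    = trans (∑-suc _) (trans
    (+-cong (*-identityˡ _) (∑-zero λ k → zeroˡ _)) (+-identityʳ _))
  δ-▹ {suc n} v (suc i) = trans (∑-suc _) (trans
    (+-cong (zeroˡ _) (δ-▹ (v ∘ suc) i)) (+-identityˡ _))

  -- Invariance of `det` is carried as a field: it holds for plane rotations by alternation and
  -- passes to products and block extensions, from which all rotations here are built.
  record IsRotation (Q : Matrix A n) : Set where
    field
      rows    : Q · Q ᵀ ≋ δ
      columns : Q ᵀ · Q ≋ δ
      det-·   : ∀ M → det (Q · M) ≈ det M

    det-·ᵀ : ∀ M → det (M · Q ᵀ) ≈ det M
    det-·ᵀ M = begin
      det (M · Q ᵀ)      ≈⟨ det-ᵀ (M · Q ᵀ) ⟨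
      det ((M · Q ᵀ) ᵀ)  ≈⟨ det-cong (·-ᵀ M (Q ᵀ)) ⟩
      det (Q · M ᵀ)      ≈⟨ det-· (M ᵀ) ⟩
      det (M ᵀ)          ≈⟨ det-ᵀ M ⟩
      det M              ∎

  open IsRotation

  δ-isRotation : IsRotation (δ {n})
  δ-isRotation .rows    i j = trans (δ-▹ (δ j) i) (δ-sym j i)
  δ-isRotation .columns i j = trans (∑-cong λ k → *-congʳ (δ-sym k i)) (δ-▹ (λ k → δ k j) i)
  δ-isRotation .det-· M = det-cong λ i j → δ-▹ ((M ᵀ) j) i

  ·-isRotation : {Q P : Matrix A n} → IsRotation Q → IsRotation P → IsRotation (Q · P)
  ·-isRotation {Q = Q} {P} rQ rP .rows i j = begin
    (Q · P · (Q · P) ᵀ) i j    ≈⟨ ·-cong {M = Q · P} (λ _ _ → refl) (·-ᵀ Q P) i j ⟩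
    (Q · P · (P ᵀ · Q ᵀ)) i j  ≈⟨ ·-assoc Q P (P ᵀ · Q ᵀ) i j ⟩
    (Q · (P · (P ᵀ · Q ᵀ))) i j
      ≈⟨ ·-cong {M = Q} (λ _ _ → refl) (λ k l → trans (sym (·-assoc P (P ᵀ) (Q ᵀ) k l))
           (trans (·-cong {N = Q ᵀ} (rows rP) (λ _ _ → refl) k l) (δ-▹ (Q l) k))) i j ⟩
    (Q · Q ᵀ) i j              ≈⟨ rows rQ i j ⟩
    δ i j                      ∎
  ·-isRotation {Q = Q} {P} rQ rP .columns i j = begin
    ((Q · P) ᵀ · (Q · P)) i j  ≈⟨ ·-cong {N = Q · P} (·-ᵀ Q P) (λ _ _ → refl) i j ⟩
    (P ᵀ · Q ᵀ · (Q · P)) i j  ≈⟨ ·-assoc (P ᵀ) (Q ᵀ) (Q · P) i j ⟩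
    (P ᵀ · (Q ᵀ · (Q · P))) i j
      ≈⟨ ·-cong {M = P ᵀ} (λ _ _ → refl) (λ k l → trans (sym (·-assoc (Q ᵀ) Q P k l))
           (trans (·-cong {N = P} (columns rQ) (λ _ _ → refl) k l) (δ-▹ ((P ᵀ) l) k))) i j ⟩
    (P ᵀ · P) i j              ≈⟨ columns rP i j ⟩
    δ i j                      ∎
  ·-isRotation {Q = Q} {P} rQ rP .det-· M =
    trans (det-cong (·-assoc Q P M)) (trans (det-· rQ (P · M)) (det-· rP M))

  -- The block sum 1 ⊕ Q, which fixes the first axis.
  extend : Matrix A n → Matrix A (suc n)
  extend Q zero    = δ zero
  extend Q (suc i) = 0# ∷ Q i

  extend-▹-suc : (Q : Matrix A n) (v : Vector A (suc n)) →
    ∀ i → (extend Q ▹ v) (suc i) ≈ (Q ▹ (v ∘ suc)) i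
  extend-▹-suc Q v i = trans (∑-suc _) (trans (+-congʳ (zeroˡ _)) (+-identityˡ _))

  extend-isRotation : {Q : Matrix A n} → IsRotation Q → IsRotation (extend Q)
  extend-isRotation {Q = Q} rQ .rows zero    j       = trans (δ-▹ (extend Q j) zero) (first j)
    where
    first : ∀ j → extend Q j zero ≈ δ zero j
    first zero    = refl
    first (suc j) = refl
  extend-isRotation {Q = Q} rQ .rows (suc i) zero    = trans (extend-▹-suc Q (δ zero) i) (∑-zero λ k → zeroʳ _)
  extend-isRotation {Q = Q} rQ .rows (suc i) (suc j) = trans (extend-▹-suc Q (0# ∷ Q j) i) (rows rQ i j)
  extend-isRotation {Q = Q} rQ .columns zero    zero    =
    trans (∑-suc _) (trans (+-cong (*-identityˡ _) (∑-zero λ k → zeroˡ _)) (+-identityʳ _))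
  extend-isRotation {Q = Q} rQ .columns zero    (suc j) =
    trans (∑-suc _) (trans (+-cong (zeroʳ _) (∑-zero λ k → zeroˡ _)) (+-identityʳ _))
  extend-isRotation {Q = Q} rQ .columns (suc i) zero    =
    trans (∑-suc _) (trans (+-cong (zeroˡ _) (∑-zero λ k → zeroʳ _)) (+-identityʳ _))
  extend-isRotation {Q = Q} rQ .columns (suc i) (suc j) =
    trans (∑-suc _) (trans (+-cong (zeroˡ _) (columns rQ i j)) (+-identityˡ _))
  extend-isRotation {Q = Q} rQ .det-· M = trans (det-row _) (trans
    (∑-cong λ j → *-congˡ (*-cong (δ-▹ ((M ᵀ) j) zero) (trans
      (det-cong λ i k → extend-▹-suc Q ((M ᵀ) (punchIn j k)) i) (det-· rQ (minor M j)))))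
    (sym (det-row M)))

  givens : A → A → Matrix A (suc (suc n))
  givens c s zero          = c ∷ s ∷ const 0#
  givens c s (suc zero)    = - s ∷ c ∷ const 0#
  givens c s (suc (suc i)) = 0# ∷ 0# ∷ δ i

  givens-▹ : ∀ c s (v : Vector A (suc (suc n))) → ∀ i → (givens c s ▹ v) i ≈
    ((c * v zero + s * v (suc zero)) ∷ (- s * v zero + c * v (suc zero)) ∷ (λ i → v (suc (suc i)))) i
  givens-▹ c s v zero          = trans (∑-suc _) (+-congˡ (trans (∑-suc _)
    (trans (+-congˡ (∑-zero λ k → zeroˡ _)) (+-identityʳ _))))
  givens-▹ c s v (suc zero)    = trans (∑-suc _) (+-congˡ (trans (∑-suc _)
    (trans (+-congˡ (∑-zero λ k → zeroˡ _)) (+-identityʳ _))))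
  givens-▹ c s v (suc (suc i)) = trans (∑-suc _) (trans (+-cong (zeroˡ _) (trans (∑-suc _)
    (trans (+-cong (zeroˡ _) (δ-▹ (λ k → v (suc (suc k))) i)) (+-identityˡ _)))) (+-identityˡ _))

  givens-rows : ∀ c s → c * c + s * s ≈ 1# → givens {n} c s · givens c s ᵀ ≋ δ
  givens-rows c s c²+s²≈1 i j = trans (givens-▹ c s (givens c s j) i) (entry i j)
    where
    0+0 : ∀ {x y} → x * 0# + y * 0# ≈ 0#
    0+0 = trans (+-cong (zeroʳ _) (zeroʳ _)) (+-identityˡ _)
    entry : ∀ i j → ((c * givens c s j zero + s * givens c s j (suc zero)) ∷
      (- s * givens c s j zero + c * givens c s j (suc zero)) ∷ (λ i → givens c s j (suc (suc i)))) i ≈ δ i j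
    entry zero          zero          = c²+s²≈1
    entry zero          (suc zero)    = trans (solve 3 (λ c s z → c :* (:- s) :+ s :* c := z :- z) refl c s 0#) (-‿inverseʳ 0#)
    entry zero          (suc (suc j)) = 0+0
    entry (suc zero)    zero          = trans (solve 3 (λ c s z → (:- s) :* c :+ c :* s := z :- z) refl c s 0#) (-‿inverseʳ 0#)
    entry (suc zero)    (suc zero)    = trans (solve 2 (λ c s → (:- s) :* (:- s) :+ c :* c := c :* c :+ s :* s) refl c s) c²+s²≈1
    entry (suc zero)    (suc (suc j)) = 0+0
    entry (suc (suc i)) zero          = refl
    entry (suc (suc i)) (suc zero)    = refl
    entry (suc (suc i)) (suc (suc j)) = δ-sym j i

  givens-ᵀ : ∀ c s → givens {n} c s ᵀ ≋ givens c (- s)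
  givens-ᵀ c s zero          zero          = refl
  givens-ᵀ c s zero          (suc zero)    = refl
  givens-ᵀ c s zero          (suc (suc j)) = refl
  givens-ᵀ c s (suc zero)    zero          = sym (-‿involutive s)
  givens-ᵀ c s (suc zero)    (suc zero)    = refl
  givens-ᵀ c s (suc zero)    (suc (suc j)) = refl
  givens-ᵀ c s (suc (suc i)) zero          = refl
  givens-ᵀ c s (suc (suc i)) (suc zero)    = refl
  givens-ᵀ c s (suc (suc i)) (suc (suc j)) = δ-sym j i

  givens-isRotation : ∀ {c s} → c * c + s * s ≈ 1# → IsRotation (givens {n} c s)
  givens-isRotation {c = c} {s} c²+s²≈1 .rows = givens-rows c s c²+s²≈1
  givens-isRotation {c = c} {s} c²+s²≈1 .columns i j = trans
    (·-cong (givens-ᵀ c s) (λ k l → givens-ᵀ c s l k) i j)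
    (givens-rows c (- s) (trans (solve 2 (λ c s → c :* c :+ (:- s) :* (:- s) := c :* c :+ s :* s) refl c s) c²+s²≈1) i j)
  givens-isRotation {c = c} {s} c²+s²≈1 .det-· M = trans
    (det-cong λ i j → trans (givens-▹ c s ((M ᵀ) j) i) (split i j))
    (trans (det-rotateRows (λ i → M (suc (suc i))) c s c²+s²≈1 (M zero) (M (suc zero))) (det-cong (join)))
    where
    split : ∀ i j → ((c * M zero j + s * M (suc zero) j) ∷ (- s * M zero j + c * M (suc zero) j) ∷ (λ i → M (suc (suc i)) j)) i
      ≈ ((λ j → c * M zero j + s * M (suc zero) j) ∷ (λ j → - s * M zero j + c * M (suc zero) j) ∷ (λ i → M (suc (suc i)))) i j
    split zero          j = refl
    split (suc zero)    j = refl
    split (suc (suc i)) j = refl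
    join : (M zero ∷ M (suc zero) ∷ λ i → M (suc (suc i))) ≋ M
    join zero          j = refl
    join (suc zero)    j = refl
    join (suc (suc i)) j = refl

  -- Polynomial functions in Horner form, indexed by a bound for the degree

  data Poly : ℕ → (A → A) → Set where
    constant : ∀ {f} c → (∀ x → f x ≈ c) → Poly zero f
    horner   : ∀ {f g} c → Poly n g → (∀ x → f x ≈ c + x * g x) → Poly (suc n) f

  Poly-cong : {f g : A → A} → (∀ x → g x ≈ f x) → Poly n f → Poly n g
  Poly-cong g≈f (constant c eq) = constant c λ x → trans (g≈f x) (eq x)
  Poly-cong g≈f (horner c p eq) = horner c p λ x → trans (g≈f x) (eq x)

  Poly-const : ∀ c → Poly n (const c)
  Poly-const {zero}  c = constant c λ x → refl
  Poly-const {suc n} c = horner c (Poly-const 0#) λ x → sym (trans (+-congˡ (zeroʳ x)) (+-identityʳ c))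

  Poly-suc : {f : A → A} → Poly n f → Poly (suc n) f
  Poly-suc (constant c eq) = horner c (Poly-const 0#)
    λ x → trans (eq x) (sym (trans (+-congˡ (zeroʳ x)) (+-identityʳ c)))
  Poly-suc (horner c p eq) = horner c (Poly-suc p) eq

  Poly-linear : ∀ a b {f g : A → A} → Poly n f → Poly n g → Poly n (λ x → a * f x + b * g x)
  Poly-linear a b (constant c f≈c) (constant d g≈d) =
    constant (a * c + b * d) λ x → +-cong (*-congˡ (f≈c x)) (*-congˡ (g≈d x))
  Poly-linear a b (horner c p eqf) (horner d q eqg) =
    horner (a * c + b * d) (Poly-linear a b p q) λ x → trans
      (+-cong (*-congˡ (eqf x)) (*-congˡ (eqg x)))
      (solve 7 (λ a b c d x f g → a :* (c :+ x :* f) :+ b :* (d :+ x :* g)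
        := (a :* c :+ b :* d) :+ x :* (a :* f :+ b :* g)) refl a b c d x _ _)

  Poly-x* : {f : A → A} → Poly n f → Poly (suc n) (λ x → x * f x)
  Poly-x* p = horner 0# p λ x → sym (+-identityˡ _)

  Poly-* : ∀ a b {f : A → A} → Poly n f → Poly (suc n) (λ x → (a + b * x) * f x)
  Poly-* a b p = Poly-cong
    (λ x → solve 4 (λ a b x f → (a :+ b :* x) :* f := a :* f :+ b :* (x :* f)) refl a b x _)
    (Poly-linear a b (Poly-suc p) (Poly-x* p))

  Poly-∑ : {f : Fin m → A → A} → (∀ i → Poly n (f i)) → Poly n (λ x → ∑ λ i → f i x)
  Poly-∑ {zero}  p = Poly-cong (λ x → ∑-empty _) (Poly-const 0#)
  Poly-∑ {suc m} p = Poly-cong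
    (λ x → trans (∑-suc _) (sym (+-cong (*-identityˡ _) (*-identityˡ _))))
    (Poly-linear 1# 1# (p zero) (Poly-∑ (p ∘ suc)))

  -- Laplace expansion multiplies by one affine entry per row, so the degree is at most the size.
  Poly-det : {B C : Matrix A n} {M : A → Matrix A n} →
    (∀ x i j → M x i j ≈ B i j + C i j * x) → Poly n (λ x → det (M x))
  Poly-det {zero}  eq = Poly-cong (λ x → det-empty _) (Poly-const 1#)
  Poly-det {suc n} {B} {C} {M} eq = Poly-cong (λ x → det-row (M x)) (Poly-∑ λ j →
    Poly-cong
      (λ x → trans (*-congˡ (*-congʳ (eq x zero j)))
        (solve 5 (λ s b c x d → s :* ((b :+ c :* x) :* d) := (s :* b :+ (s :* c) :* x) :* d) refl
          (sign (toℕ j)) (B zero j) (C zero j) x _))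
      (Poly-* _ _ (Poly-det λ x i k → eq x (suc i) (punchIn j k))))

  Poly-∏ : (r : Vector A n) → Poly n (λ x → ∏ λ i → x - r i)
  Poly-∏ {zero}  r = Poly-const 1#
  Poly-∏ {suc n} r = Poly-cong
    (λ x → *-congʳ (trans (+-comm x _) (+-congˡ (sym (*-identityˡ x)))))
    (Poly-* (- r zero) 1# (Poly-∏ (r ∘ suc)))

  -- Synthetic division: for f = c + x g the difference is (x - b) g(b) + x (g(x) - g(b)), and g is
  -- divided by induction.
  factor : {f : A → A} → Poly (suc n) f → ∀ b →
    ∃[ h ] Poly n h × ∀ x → f x - f b ≈ (x - b) * h x
  factor {f = f} (horner c (constant d g≈d) eq) b = const d , constant d (λ x → refl) , λ x → begin
    f x - f b
      ≈⟨ +-cong (trans (eq x) (+-congˡ (*-congˡ (g≈d x)))) (-‿cong (trans (eq b) (+-congˡ (*-congˡ (g≈d b))))) ⟩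
    c + x * d - (c + b * d)
      ≈⟨ solve 4 (λ c x b d → c :+ x :* d :- (c :+ b :* d) := (x :- b) :* d) refl c x b d ⟩
    (x - b) * d ∎
  factor {f = f} (horner {g = g} c p@(horner _ _ _) eq) b with factor p b
  ... | h , q , g-split =
    _ , Poly-linear 1# 1# (Poly-const (g b)) (Poly-x* q) , λ x → begin
      f x - f b
        ≈⟨ +-cong (eq x) (-‿cong (eq b)) ⟩
      c + x * g x - (c + b * g b)
        ≈⟨ solve 5 (λ c x b u v → c :+ x :* u :- (c :+ b :* v) := (x :- b) :* v :+ x :* (u :- v)) refl c x b (g x) (g b) ⟩
      (x - b) * g b + x * (g x - g b)
        ≈⟨ +-congˡ (*-congˡ (g-split x)) ⟩
      (x - b) * g b + x * ((x - b) * h x)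
        ≈⟨ solve 4 (λ x b v h → (x :- b) :* v :+ x :* ((x :- b) :* h) := (x :- b) :* (v :+ x :* h)) refl x b (g b) (h x) ⟩
      (x - b) * (g b + x * h x)
        ≈⟨ *-congˡ (+-cong (*-identityˡ _) (*-identityˡ _)) ⟨
      (x - b) * (1# * g b + 1# * (x * h x)) ∎

  -- Characteristic matrices and orthogonal diagonalisation

  characteristicMatrix : Matrix A n → A → Matrix A n
  characteristicMatrix B x i j = (if does (i Fin.≟ j) then x else 0#) - B i j

  scalar-entry : ∀ x (i j : Fin n) → (if does (i Fin.≟ j) then x else 0#) ≈ x * δ i j
  scalar-entry x i j with does (i Fin.≟ j)
  ... | Bool.true  = sym (*-identityʳ x)
  ... | Bool.false = sym (zeroʳ x)

  characteristicMatrix-▹ : ∀ (B : Matrix A n) x v → ∀ i →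
    (characteristicMatrix B x ▹ v) i ≈ x * v i - (B ▹ v) i
  characteristicMatrix-▹ B x v i = begin
    ∑ (λ k → ((if does (i Fin.≟ k) then x else 0#) - B i k) * v k)
      ≈⟨ (∑-cong λ k → trans (*-congʳ (+-congʳ (scalar-entry x i k))) (trans
           (solve 4 (λ x d b v → (x :* d :- b) :* v := x :* (d :* v) :+ (:- (b :* v))) refl x (δ i k) (B i k) (v k))
           (+-congˡ (-‿cong (sym (*-identityˡ _)))))) ⟩
    ∑ (λ k → x * (δ i k * v k) + - (1# * (B i k * v k)))
      ≈⟨ (∑-cong λ k → +-congˡ (-‿distribˡ-* _ _)) ⟩
    ∑ (λ k → x * (δ i k * v k) + - 1# * (B i k * v k))
      ≈⟨ ∑-linear x (- 1#) _ _ ⟩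
    x * (δ ▹ v) i + - 1# * (B ▹ v) i
      ≈⟨ +-cong (*-congˡ (δ-▹ v i)) (trans (sym (-‿distribˡ-* _ _)) (-‿cong (*-identityˡ _))) ⟩
    x * v i - (B ▹ v) i ∎

  Eigenbasis : Matrix A n → Vector A n → Matrix A n → Set
  Eigenbasis B r Q = IsRotation Q × ∀ k i → (B ▹ Q k) i ≈ r k * Q k i

  module _
    (cancel : ∀ {x y} → ¬ x ≈ 0# → x * y ≈ 0# → y ≈ 0#)
    -- The plane rotation with entries c and s takes (x , y) to the first axis: its second
    -- coordinate is c y - s x.
    (unitVector : ∀ x y → ¬ ¬ (∃[ c ] ∃[ s ] c * c + s * s ≈ 1# × c * y ≈ s * x))
    (point : ℕ → A) (distinct : ∀ {i j} → i ≢ j → ¬ point i - point j ≈ 0#)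
    where

    -- A root splits off a linear factor, and the quotient vanishes at the later points because x -
    -- p 0 cancels there. An infinite sequence of points avoids matching their number with the
    -- degree.
    Poly-vanish : {f : A → A} → Poly n f → (p : ℕ → A) → (∀ {i j} → i ≢ j → ¬ p i - p j ≈ 0#) →
      (∀ i → f (p i) ≈ 0#) → ∀ x → f x ≈ 0#
    Poly-vanish (constant c eq) p dist zeros x = trans (eq x) (trans (sym (eq (p 0))) (zeros 0))
    Poly-vanish {f = f} q@(horner _ _ _) p dist zeros x with factor q (p 0)
    ... | h , r , split = begin
      f x                      ≈⟨ solve 2 (λ a b → a := (a :- b) :+ b) refl (f x) (f (p 0)) ⟩
      f x - f (p 0) + f (p 0)  ≈⟨ +-cong (trans (split x) (*-congˡ (Poly-vanish r (p ∘ suc) (λ i≢j → dist (i≢j ∘ ℕ.suc-injective)) h-zeros x))) (zeros 0) ⟩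
      (x - p 0) * 0# + 0#      ≈⟨ trans (+-identityʳ _) (zeroʳ _) ⟩
      0#                       ∎
      where
      h-zeros : ∀ i → h (p (suc i)) ≈ 0#
      h-zeros i = cancel (dist {suc i} {0} λ ()) (trans (sym (split (p (suc i))))
        (trans (+-cong (zeros (suc i)) (-‿cong (zeros 0))) (-‿inverseʳ 0#)))

    -- The tail is first turned to its own first axis; one rotation in the plane of the first two
    -- coordinates then clears the coordinate left over.
    aim : (v : Vector A (suc n)) →
      ¬ ¬ (∃[ Q ] IsRotation Q × ∀ i → (Q ▹ v) (suc i) ≈ 0#)
    aim {zero}  v = return (δ , δ-isRotation , λ ())
    aim {suc n} v = do
      Q , rQ , Qv≈0 ← aim (v ∘ suc)
      c , s , c²+s²≈1 , cy≈sx ← unitVector (v zero) ((Q ▹ (v ∘ suc)) zero)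
      let w = extend Q ▹ v
          G = givens c s
          w₀ : w zero ≈ v zero
          w₀ = δ-▹ v zero
          Gw≈0 : ∀ i → (G ▹ w) (suc i) ≈ 0#
          Gw≈0 = λ
            { zero → trans (givens-▹ c s w (suc zero)) (trans
                (+-cong (*-congˡ w₀) (trans (*-congˡ (extend-▹-suc Q v zero)) cy≈sx))
                (trans (+-congʳ (sym (-‿distribˡ-* _ _))) (-‿inverseˡ _)))
            ; (suc i) → trans (givens-▹ c s w (suc (suc i))) (trans (extend-▹-suc Q v (suc i)) (Qv≈0 i)) }
      return (G · extend Q , ·-isRotation (givens-isRotation c²+s²≈1) (extend-isRotation rQ) ,
        λ i → trans (▹-assoc G (extend Q) v (suc i)) (Gw≈0 i))

    -- The first row of a rotation P is a unit vector, so M ▹ P zero ≈ 0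
    -- says that M has a unit vector in its kernel.
    Kernel : Vector (Vector A (suc n)) m → Matrix A (suc n) → Set
    Kernel M P = IsRotation P × ∀ i → (M ▹ P zero) i ≈ 0#

    -- Row j of `P · Q` is Qᵀ applied to row j of `P`. Multiplying `P` by `Q` thus turns vectors
    -- found for M Qᵀ into vectors for M.
    transported : (M : Vector (Vector A n) m) (P Q : Matrix A n) →
      ∀ i j → (M ▹ (P · Q) j) i ≈ (M · Q ᵀ ▹ P j) i
    transported M P Q i j = trans (▹-cong {M = M} (λ k → ·-ᵀ P Q k j) i) (sym (▹-assoc M (Q ᵀ) (P j) i))

    aimed : (M : Vector (Vector A (suc n)) (suc m)) (Q : Matrix A (suc n)) →
      (∀ i → (Q ▹ M zero) (suc i) ≈ 0#) → ∀ j → (M · Q ᵀ) zero (suc j) ≈ 0#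
    aimed M Q QM₀≈0 j = trans (∑-cong λ k → *-comm _ _) (QM₀≈0 j)

    -- Row 0 of M Qᵀ lies on the first axis and kills every vector with first coordinate 0; the
    -- other rows kill (0, P zero) by the hypothesis on the block.
    kernel-step : (M : Vector (Vector A (suc (suc n))) (suc m)) {Q : Matrix A (suc (suc n))} {P : Matrix A (suc n)} →
      IsRotation Q → (∀ i → (Q ▹ M zero) (suc i) ≈ 0#) →
      Kernel (λ i j → (M · Q ᵀ) (suc i) (suc j)) P → ∃ (Kernel M)
    kernel-step M {Q} {P} rQ QM₀≈0 (rP , ker) =
      -- `extend P` has (0, P zero) as row 1. The quarter turn brings it to row 0 and, unlike a
      -- transposition, preserves `det`.
      swap · (extend P · Q) ,
      ·-isRotation (givens-isRotation 0²+1²≈1) (·-isRotation (extend-isRotation rP) rQ) ,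
      λ i → begin
        (M ▹ (swap · (extend P · Q)) zero) i
          ≈⟨ ▹-cong {M = M} (λ k → trans (givens-▹ 0# 1# (((extend P · Q) ᵀ) k) zero)
               (trans (+-cong (zeroˡ _) (*-identityˡ _)) (+-identityˡ _))) i ⟩
        (M ▹ (extend P · Q) (suc zero)) i
          ≈⟨ transported M (extend P) Q i (suc zero) ⟩
        (M · Q ᵀ ▹ (0# ∷ P zero)) i
          ≈⟨ trans (∑-suc _) (trans (+-congʳ (zeroʳ _)) (+-identityˡ _)) ⟩
        ∑ (λ k → (M · Q ᵀ) i (suc k) * P zero k)
          ≈⟨ vanish i ⟩
        0# ∎
      where
      swap : Matrix A (suc (suc _))
      swap = givens 0# 1#
      0²+1²≈1 : 0# * 0# + 1# * 1# ≈ 1#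
      0²+1²≈1 = trans (+-cong (zeroˡ _) (*-identityˡ _)) (+-identityˡ _)
      vanish : ∀ i → ∑ (λ k → (M · Q ᵀ) i (suc k) * P zero k) ≈ 0#
      vanish zero    = ∑-zero λ k → trans (*-congʳ (aimed M Q QM₀≈0 k)) (zeroˡ _)
      vanish (suc i) = ker i

    -- Turning row 0 to the first axis removes one equation and one unknown, until one unknown and
    -- no equation remain.
    kernel-wide : (M : Vector (Vector A (suc n)) n) → ¬ ¬ ∃ (Kernel M)
    kernel-wide {zero}  M = return (δ , δ-isRotation , λ ())
    kernel-wide {suc n} M = do
      Q , rQ , QM₀≈0 ← aim (M zero)
      P , ker ← kernel-wide λ i j → (M · Q ᵀ) (suc i) (suc j)
      return (kernel-step M rQ QM₀≈0 ker)

    det-lower : (M : Matrix A (suc n)) → (∀ j → M zero (suc j) ≈ 0#) →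
      det M ≈ M zero zero * det (minor M zero)
    det-lower M M₀≈0 = trans (det-row M) (trans (∑-suc _) (trans
      (+-cong (*-identityˡ _) (∑-zero λ j → trans (*-congˡ (trans (*-congʳ (M₀≈0 j)) (zeroˡ _))) (zeroʳ _)))
      (+-identityʳ _)))

    -- With the first row turned to the first axis, the determinant is the corner entry times that
    -- of a minor. If the corner is 0, row 0 vanishes and the other rows are fewer than the
    -- unknowns; otherwise the minor is singular and induction applies to it.
    kernel : (M : Matrix A (suc n)) → det M ≈ 0# → ¬ ¬ ∃ (Kernel M)
    kernel {n} M det≈0 = do
        Q , rQ , QM₀≈0 ← aim (M zero)
        inj₁ corner≈0 ← ¬¬-em ((M · Q ᵀ) zero zero ≈ 0#)
          where inj₂ corner≉0 → regular M det≈0 rQ QM₀≈0 corner≉0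
        P , rP , ker ← kernel-wide λ i → (M · Q ᵀ) (suc i)
        let vanish : ∀ i → (M · Q ᵀ ▹ P zero) i ≈ 0#
            vanish = λ
              { zero → ∑-zero λ
                { zero → trans (*-congʳ corner≈0) (zeroˡ _)
                ; (suc k) → trans (*-congʳ (aimed M Q QM₀≈0 k)) (zeroˡ _) }
              ; (suc i) → ker i }
        return (P · Q , ·-isRotation rP rQ , λ i → trans (transported M P Q i zero) (vanish i))
      where
      regular : ∀ {n} (M : Matrix A (suc n)) → det M ≈ 0# → ∀ {Q} → IsRotation Q →
        (∀ i → (Q ▹ M zero) (suc i) ≈ 0#) → ¬ (M · Q ᵀ) zero zero ≈ 0# → ¬ ¬ ∃ (Kernel M)
      regular {n} M det≈0 {Q} rQ QM₀≈0 corner≉0 = continue n M det≈0 rQ QM₀≈0 minor-det≈0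
        where
        minor-det≈0 : det (minor (M · Q ᵀ) zero) ≈ 0#
        minor-det≈0 = cancel corner≉0 (trans (sym (det-lower (M · Q ᵀ) (aimed M Q QM₀≈0)))
          (trans (det-·ᵀ rQ M) det≈0))
        continue : ∀ n (M : Matrix A (suc n)) → det M ≈ 0# → ∀ {Q} → IsRotation Q →
          (∀ i → (Q ▹ M zero) (suc i) ≈ 0#) → det (minor (M · Q ᵀ) zero) ≈ 0# → ¬ ¬ ∃ (Kernel M)
        -- Here the empty determinant 1 is 0, so every element is 0 and any rotation serves.
        continue zero    M det≈0 rQ QM₀≈0 d = return (δ , δ-isRotation ,
          λ i → trans (sym (*-identityˡ _)) (trans (*-congʳ (trans (sym (det-empty _)) d)) (zeroˡ _)))
        continue (suc n) M det≈0 rQ QM₀≈0 d = do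
          P , ker ← kernel _ d
          return (kernel-step M rQ QM₀≈0 ker)

    -- Q (x I) Qᵀ = x I because the rows of `Q` are orthonormal.
    characteristicMatrix-conjugate : (B : Matrix A n) {Q : Matrix A n} → IsRotation Q → ∀ x →
      characteristicMatrix (Q · (B · Q ᵀ)) x ≋ Q · (characteristicMatrix B x · Q ᵀ)
    characteristicMatrix-conjugate B {Q} rQ x i j = sym (begin
      (Q · (characteristicMatrix B x · Q ᵀ)) i j
        ≈⟨ ▹-cong {M = Q} (characteristicMatrix-▹ B x (Q j)) i ⟩
      ∑ (λ k → Q i k * (x * Q j k - (B ▹ Q j) k))
        ≈⟨ (∑-cong λ k → trans
             (solve 4 (λ q x r b → q :* (x :* r :- b) := x :* (q :* r) :+ :- (q :* b)) refl (Q i k) x (Q j k) _)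
             (+-congˡ (trans (-‿cong (sym (*-identityˡ _))) (-‿distribˡ-* _ _)))) ⟩
      ∑ (λ k → x * (Q i k * Q j k) + - 1# * (Q i k * (B ▹ Q j) k))
        ≈⟨ ∑-linear x (- 1#) _ _ ⟩
      x * (Q · Q ᵀ) i j + - 1# * (Q · (B · Q ᵀ)) i j
        ≈⟨ +-cong (trans (*-congˡ (rows rQ i j)) (sym (scalar-entry x i j)))
             (trans (sym (-‿distribˡ-* _ _)) (-‿cong (*-identityˡ _))) ⟩
      characteristicMatrix (Q · (B · Q ᵀ)) x i j ∎)

    det-conjugate : (B : Matrix A n) {Q : Matrix A n} → IsRotation Q → ∀ x →
      det (characteristicMatrix (Q · (B · Q ᵀ)) x) ≈ det (characteristicMatrix B x)
    det-conjugate B rQ x = trans (det-cong (characteristicMatrix-conjugate B rQ x))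
      (trans (det-· rQ _) (det-·ᵀ rQ _))

    conjugate-sym : (B : Matrix A n) → B ᵀ ≋ B → (Q : Matrix A n) → (Q · (B · Q ᵀ)) ᵀ ≋ Q · (B · Q ᵀ)
    conjugate-sym B symB Q i j = begin
      (Q · (B · Q ᵀ)) j i    ≈⟨ ·-ᵀ Q (B · Q ᵀ) i j ⟩
      ((B · Q ᵀ) ᵀ · Q ᵀ) i j  ≈⟨ ·-cong {N = Q ᵀ} (·-ᵀ B (Q ᵀ)) (λ _ _ → refl) i j ⟩
      (Q · B ᵀ · Q ᵀ) i j    ≈⟨ ·-assoc Q (B ᵀ) (Q ᵀ) i j ⟩
      (Q · (B ᵀ · Q ᵀ)) i j  ≈⟨ ·-cong {M = Q} (λ _ _ → refl) (·-cong {N = Q ᵀ} symB (λ _ _ → refl)) i j ⟩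
      (Q · (B · Q ᵀ)) i j    ∎

    conjugate-unconjugate : (B : Matrix A n) {Q : Matrix A n} → IsRotation Q →
      Q ᵀ · (Q · (B · Q ᵀ)) ≋ B · Q ᵀ
    conjugate-unconjugate B {Q} rQ i j = trans (sym (·-assoc (Q ᵀ) Q (B · Q ᵀ) i j))
      (trans (·-cong {N = B · Q ᵀ} (columns rQ) (λ _ _ → refl) i j) (δ-▹ (((B · Q ᵀ) ᵀ) j) i))

    spectral : (B : Matrix A n) → B ᵀ ≋ B → (r : Vector A n) →
      (∀ x → det (characteristicMatrix B x) ≈ ∏ λ i → x - r i) → ¬ ¬ ∃ (Eigenbasis B r)
    spectral {zero}  B symB r spec = return (δ , δ-isRotation , λ ())
    spectral {suc n} B symB r spec = do
      -- Row 0 of `Q` is a unit eigenvector, so column 0 of C = Q B Qᵀ is r₀ times the first unit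
      -- vector, and by symmetry row 0 is too.
      Q , rQ , ker ← kernel (characteristicMatrix B r₀)
        (trans (spec r₀) (trans (*-congʳ (-‿inverseʳ r₀)) (zeroˡ _)))
      let C = Q · (B · Q ᵀ)
          C′ : Matrix A n
          C′ i j = C (suc i) (suc j)
          eigen : ∀ i → (B ▹ Q zero) i ≈ r₀ * Q zero i
          eigen i = sym (equal (trans (sym (characteristicMatrix-▹ B r₀ (Q zero) i)) (ker i)))
          column : ∀ i → C i zero ≈ r₀ * δ i zero
          column i = trans (∑-cong λ k → trans (*-congˡ (eigen k))
            (solve 3 (λ q x p → q :* (x :* p) := x :* (q :* p)) refl (Q i k) r₀ (Q zero k)))
            (trans (∑-* r₀ _) (*-congˡ (rows rQ i zero)))
          row : ∀ j → C zero (suc j) ≈ 0#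
          row j = trans (conjugate-sym B symB Q (suc j) zero) (trans (column (suc j)) (zeroʳ r₀))
          difference : ∀ x → (x - r₀) * (det (characteristicMatrix C′ x) - ∏ (λ i → x - r (suc i))) ≈ 0#
          difference x = trans
            (solve 3 (λ a b c → a :* (b :- c) := a :* b :- a :* c) refl (x - r₀) _ _)
            (trans (+-congʳ (trans (*-congʳ (+-congˡ (-‿cong (sym (trans (column zero) (*-identityʳ r₀))))))
              (trans (sym (det-lower (characteristicMatrix C x) λ j → trans (+-identityˡ _) (trans (-‿cong (row j)) -0#≈0#)))
                (trans (det-conjugate B rQ x) (spec x)))))
              (-‿inverseʳ _))
          -- The factor x - r₀ cannot be cancelled at x = r₀. The two sides agree at the points `p`,
          -- which avoid r₀, and therefore everywhere as polynomials.
          spec′ : ∀ x → det (characteristicMatrix C′ x) ≈ ∏ λ i → x - r (suc i)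
          spec′ x = equal (Poly-vanish (Poly-difference C′) p p-distinct
            (λ i → cancel (p≉r₀ i) (difference (p i))) x)
      P , rP , eigenP ← spectral C′ (λ i j → conjugate-sym B symB Q (suc i) (suc j)) (r ∘ suc) spec′
      let skip : ∀ i k → (C ▹ extend P (suc k)) i ≈ ∑ λ l → C i (suc l) * P k l
          skip i k = trans (∑-suc _) (trans (+-congʳ (zeroʳ _)) (+-identityˡ _))
          eigen′ : ∀ k i → (C ▹ extend P k) i ≈ r k * extend P k i
          eigen′ = λ
            { zero i → trans (∑-cong λ j → *-comm _ _) (trans (δ-▹ (C i) zero)
                (trans (column i) (*-congˡ (δ-sym i zero))))
            ; (suc k) zero → trans (skip zero k)
                (trans (∑-zero λ l → trans (*-congʳ (row l)) (zeroˡ _)) (sym (zeroʳ _)))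
            ; (suc k) (suc i) → trans (skip (suc i) k) (eigenP k i) }
      return (extend P · Q , ·-isRotation (extend-isRotation rP) rQ , λ k i → begin
        (B ▹ (extend P · Q) k) i
          ≈⟨ transported B (extend P) Q i k ⟩
        (B · Q ᵀ ▹ extend P k) i
          ≈⟨ (∑-cong λ j → *-congʳ (conjugate-unconjugate B rQ i j)) ⟨
        (Q ᵀ · C ▹ extend P k) i
          ≈⟨ ▹-assoc (Q ᵀ) C (extend P k) i ⟩
        ∑ (λ j → Q j i * (C ▹ extend P k) j)
          ≈⟨ (∑-cong λ j → trans (*-congˡ (eigen′ k j))
               (solve 3 (λ q x p → q :* (x :* p) := x :* (p :* q)) refl (Q j i) (r k) (extend P k j))) ⟩
        ∑ (λ j → r k * (extend P k j * Q j i))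
          ≈⟨ ∑-* (r k) _ ⟩
        r k * (extend P · Q) k i ∎)
      where
      r₀ : A
      r₀ = r zero
      equal : ∀ {x y} → x - y ≈ 0# → x ≈ y
      equal {x} {y} x-y≈0 = trans (solve 2 (λ x y → x := (x :- y) :+ y) refl x y)
        (trans (+-congʳ x-y≈0) (+-identityˡ y))
      -- `point 0` is spent on the shift, which keeps every `p i` different from r₀.
      p : ℕ → A
      p i = r₀ + (point (suc i) - point 0)
      p-distinct : ∀ {i j} → i ≢ j → ¬ p i - p j ≈ 0#
      p-distinct {i} {j} i≢j eq = distinct (i≢j ∘ ℕ.suc-injective) (trans
        (solve 4 (λ a b c r → a :- b := (r :+ (a :- c)) :- (r :+ (b :- c))) refl
          (point (suc i)) (point (suc j)) (point 0) r₀) eq)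
      p≉r₀ : ∀ i → ¬ p i - r₀ ≈ 0#
      p≉r₀ i eq = distinct {suc i} {0} (λ ()) (trans
        (solve 3 (λ a c r → a :- c := (r :+ (a :- c)) :- r) refl (point (suc i)) (point 0) r₀) eq)
      Poly-difference : ∀ C → Poly n (λ x → det (characteristicMatrix C x) - ∏ (λ i → x - r (suc i)))
      Poly-difference C = Poly-cong
        (λ x → +-cong (sym (*-identityˡ _)) (trans (-‿cong (sym (*-identityˡ _))) (-‿distribˡ-* _ _)))
        (Poly-linear 1# (- 1#)
          (Poly-det {B = λ i j → - C i j} {C = δ} λ x i j →
            trans (+-comm _ _) (+-congˡ (trans (scalar-entry x i j) (*-comm x _))))
          (Poly-∏ (r ∘ suc)))

-- What the proof uses of the reals, as a record: over ℝ itself the relation _≈_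
-- unfolds and Agda can no longer infer the numbers it relates.
record RealField : Set₁ where
  field
    commutativeRing : CommutativeRing 0ℓ 0ℓ
  open CommutativeRing commutativeRing
  infix 4 _≼_
  field
    _≼_           : Carrier → Carrier → Set
    ∣_∣           : Carrier → Carrier
    scalar        : ℚ.+-*-rawRing -Raw-AlmostCommutative⟶ fromCommutativeRing commutativeRing
  open _-Raw-AlmostCommutative⟶_ scalar using (⟦_⟧)
  field
    scalar-cancel : ∀ {p q} → ⟦ p ⟧ ≈ ⟦ q ⟧ → p ≡ q
    scalar-mono   : ∀ {p q} → p ℚ.≤ q → ⟦ p ⟧ ≼ ⟦ q ⟧
    ≈-stable      : ∀ {x y} → ¬ ¬ x ≈ y → x ≈ y
    *-cancel      : ∀ {x y} → ¬ x ≈ 0# → x * y ≈ 0# → y ≈ 0#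
    -- Doubly negated because x ≉ 0 yields a positive lower bound for |x| only classically, and the
    -- root is built from that bound.
    inverseSqrt   : ∀ {x} → 0# ≼ x → ¬ x ≈ 0# → ¬ ¬ (∃[ w ] w * w * x ≈ 1#)
    ≼-reflexive   : ∀ {x y} → x ≈ y → x ≼ y
    ≼-trans       : ∀ {x y z} → x ≼ y → y ≼ z → x ≼ z
    ≼-antisym     : ∀ {x y} → x ≼ y → y ≼ x → x ≈ y
    ≼-stable      : ∀ {x y} → ¬ ¬ x ≼ y → x ≼ y
    ≼-sign        : ∀ x → ¬ ¬ (0# ≼ x ⊎ x ≼ 0#)
    +-mono-≼      : ∀ {x y u v} → x ≼ y → u ≼ v → x + u ≼ y + v
    *-nonNeg      : ∀ {x y} → 0# ≼ x → 0# ≼ y → 0# ≼ x * y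
    square-nonNeg : ∀ x → 0# ≼ x * x
    ∣∣-nonNeg     : ∀ {x} → 0# ≼ x → ∣ x ∣ ≈ x
    ∣∣-nonPos     : ∀ {x} → x ≼ 0# → ∣ x ∣ ≈ - x

-- Vertex covers, König's theorem and the cover number of complete graphs

module Combinatorics where

  open import Data.Bool.Base using (_∧_; _∨_)
  open import Data.Fin.Subset using (Subset; ⊤; ∣_∣; _∈_; _∉_)
  import Data.Fin.Subset.Properties as Subset
  open import Data.Nat.Base using (_+_; _*_; _∸_; _≤_; _<_; _%_; _/_; ⌈_/2⌉; NonZero)
  open import Data.Nat.DivMod
  open import Data.Vec.Base using ([]; _∷_; tabulate; lookup; there)
  import Data.Vec.Properties as Vec

  open ℕSum using (sum)

  private
    variable
      n : ℕ

  indicator : Bool → ℕ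
  indicator b = if b then 1 else 0

  card : (Fin n → Bool) → ℕ
  card b = sum (indicator ∘ b)

  card-tabulate : (b : Fin n → Bool) → ∣ tabulate b ∣ ≡ card b
  card-tabulate {zero}  b = ≡.refl
  card-tabulate {suc n} b with b zero
  ... | true  = ≡.cong suc (card-tabulate (b ∘ suc))
  ... | false = card-tabulate (b ∘ suc)

  card-lookup : (p : Subset n) → card (lookup p) ≡ ∣ p ∣
  card-lookup []          = ≡.refl
  card-lookup (true  ∷ p) = ≡.cong suc (card-lookup p)
  card-lookup (false ∷ p) = card-lookup p

  ∈-tabulate : {b : Fin n → Bool} {i : Fin n} → b i ≡ true → i ∈ tabulate b
  ∈-tabulate {b = b} {i} eq = Vec.lookup⇒[]= i _ (≡.trans (Vec.lookup∘tabulate b i) eq)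

  sum-mono : {f g : Fin n → ℕ} → (∀ i → f i ≤ g i) → sum f ≤ sum g
  sum-mono {zero}  f≤g = z≤n
  sum-mono {suc n} f≤g = ℕ.+-mono-≤ (f≤g zero) (sum-mono (f≤g ∘ suc))

  sum-mono-< : {f g : Fin n → ℕ} → (∀ i → f i ≤ g i) → ∀ i → f i < g i → sum f < sum g
  sum-mono-< {suc n} f≤g zero    f<g = ℕ.+-mono-<-≤ f<g (sum-mono (f≤g ∘ suc))
  sum-mono-< {suc n} f≤g (suc i) f<g = ℕ.+-mono-≤-< (f≤g zero) (sum-mono-< (f≤g ∘ suc) i f<g)

  sum-zero : sum {n} (const 0) ≡ 0
  sum-zero {n} = ℕSum.sum-replicate-zero n

  does-true : {P : Set} (P? : Dec P) → P → does P? ≡ true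
  does-true (yes _) _ = ≡.refl
  does-true (no ¬p) p = contradiction p ¬p

  does-mono : {P Q : Set} (P? : Dec P) (Q? : Dec Q) → (P → Q) → indicator (does P?) ≤ indicator (does Q?)
  does-mono (yes p) Q? f = ℕ.≤-reflexive (≡.cong indicator (≡.sym (does-true Q? (f p))))
  does-mono (no _)  Q? f = z≤n

  does-mono-< : {P Q : Set} (P? : Dec P) (Q? : Dec Q) → ¬ P → Q → indicator (does P?) < indicator (does Q?)
  does-mono-< (yes p) Q?      ¬p q = contradiction p ¬p
  does-mono-< (no _)  (yes _) ¬p q = s≤s z≤n
  does-mono-< (no _)  (no ¬q) ¬p q = contradiction q ¬q

  card-point : (u : Fin n) → card (λ i → does (i Fin.≟ u)) ≡ 1
  card-point {suc n} zero    = ≡.cong suc (sum-zero {n})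
  card-point {suc n} (suc u) = card-point u

  Cover : Rel (Fin n) 0ℓ → Subset n → Set
  Cover E p = ∀ i j → E i j → i ∈ p ⊎ j ∈ p

  cover? : {E : Rel (Fin n) 0ℓ} → Decidable E → ∀ p → Dec (Cover E p)
  cover? E? p = Fin.all? λ i → Fin.all? λ j → E? i j →-dec (i Subset.∈? p ⊎-dec j Subset.∈? p)

  module König {side : Fin n → Bool} where

    -- Counts vertices: an edge whose ends an involution exchanges counts twice, as it does in the
    -- sum of the matrix entries at (i, π i).
    matched : {E : Rel (Fin n) 0ℓ} → Decidable E → Permutation′ n → ℕ
    matched E? π = card λ i → does (E? i (π ⟨$⟩ʳ i))

    module Matching (E : Rel (Fin n) 0ℓ) (E? : Decidable E) (symm : Symmetric E)
      (bipartite : ∀ i j → E i j → side i ≢ side j)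
      (unique : ∀ {i j k} → E i j → E i k → j ≡ k) where

      partner : Fin n → Fin n
      partner i with Fin.any? (E? i)
      ... | yes (j , _) = j
      ... | no  _       = i

      partner-edge : ∀ {i j} → E i j → partner i ≡ j
      partner-edge {i} {j} e with Fin.any? (E? i)
      ... | yes (k , e′) = unique e′ e
      ... | no  none     = contradiction (j , e) none

      partner-none : ∀ {i} → ¬ ∃ (E i) → partner i ≡ i
      partner-none {i} none with Fin.any? (E? i)
      ... | yes e = contradiction e none
      ... | no  _ = ≡.refl

      partner-involutive : ∀ i → partner (partner i) ≡ i
      partner-involutive i = by (Fin.any? (E? i))
        where
        by : Dec (∃ (E i)) → partner (partner i) ≡ i
        by (yes (j , e)) = ≡.trans (≡.cong partner (partner-edge e)) (partner-edge (symm e))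
        by (no  none)    = ≡.trans (≡.cong partner (partner-none none)) (partner-none none)

      π : Permutation′ n
      π = permutation partner partner partner-involutive partner-involutive

      onSide : Bool → Fin n → Bool
      onSide s i = does (E? i (partner i)) ∧ does (side i Bool.≟ s)

      onSide-cover : ∀ s → Cover E (tabulate (onSide s))
      onSide-cover s i j e with side i Bool.≟ s | side j Bool.≟ s
      ... | yes i≡s | _       = inj₁ (∈-tabulate (≡.cong₂ _∧_
        (does-true (E? i (partner i)) (≡.subst (E i) (≡.sym (partner-edge e)) e)) (does-true (side i Bool.≟ s) i≡s)))
      ... | no  _   | yes j≡s = inj₂ (∈-tabulate (≡.cong₂ _∧_
        (does-true (E? j (partner j)) (≡.subst (E j) (≡.sym (partner-edge (symm e))) (symm e))) (does-true (side j Bool.≟ s) j≡s)))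
      ... | no  i≢s | no  j≢s = contradiction
        (≡.trans (Bool.¬-not i≢s) (≡.sym (Bool.¬-not j≢s))) (bipartite i j e)

      -- Every edge has one end on each side, so the matched vertices of either side form a cover.
      -- Both covers have at least `k` elements, and they are disjoint.
      bound : ∀ k → (∀ p → Cover E p → k ≤ ∣ p ∣) → k + k ≤ matched E? π
      bound k minimal = begin
        k + k
          ≤⟨ ℕ.+-mono-≤ (small true) (small false) ⟩
        card (onSide true) + card (onSide false)
          ≡⟨ ℕSum.∑-distrib-+ (indicator ∘ onSide true) (indicator ∘ onSide false) ⟨
        sum (λ i → indicator (onSide true i) + indicator (onSide false i))
          ≤⟨ sum-mono (λ i → one (does (E? i (partner i))) (side i)) ⟩
        matched E? π ∎
        where
        open ℕ.≤-Reasoning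
        small : ∀ s → k ≤ card (onSide s)
        small s = ≡.subst (k ≤_) (card-tabulate (onSide s)) (minimal _ (onSide-cover s))
        one : ∀ e s → indicator (e ∧ does (s Bool.≟ true)) + indicator (e ∧ does (s Bool.≟ false)) ≤ indicator e
        one true  true  = s≤s z≤n
        one true  false = s≤s z≤n
        one false _     = z≤n

    delete : Rel (Fin n) 0ℓ → Fin n → Fin n → Rel (Fin n) 0ℓ
    delete E u x i j = E i j × ¬ ((i ≡ u × j ≡ x) ⊎ (i ≡ x × j ≡ u))

    delete? : {E : Rel (Fin n) 0ℓ} → Decidable E → ∀ u x → Decidable (delete E u x)
    delete? E? u x i j = E? i j ×-dec ¬? ((i Fin.≟ u ×-dec j Fin.≟ x) ⊎-dec (i Fin.≟ x ×-dec j Fin.≟ u))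

    delete-symm : {E : Rel (Fin n) 0ℓ} → Symmetric E → ∀ u x → Symmetric (delete E u x)
    delete-symm symm u x (e , kept) = symm e , λ where
      (inj₁ (j≡u , i≡x)) → kept (inj₂ (i≡x , j≡u))
      (inj₂ (j≡x , i≡u)) → kept (inj₁ (i≡u , j≡x))

    size : {E : Rel (Fin n) 0ℓ} → Decidable E → ℕ
    size E? = sum λ i → card λ j → does (E? i j)

    delete-< : {E : Rel (Fin n) 0ℓ} (E? : Decidable E) → ∀ {u x} → E u x → size (delete? E? u x) < size E?
    delete-< E? {u} {x} e = sum-mono-<
      (λ i → sum-mono λ j → does-mono (delete? E? u x i j) (E? i j) proj₁) u
      (sum-mono-< (λ j → does-mono (delete? E? u x u j) (E? u j) proj₁) x
        (does-mono-< (delete? E? u x u x) (E? u x) (λ (_ , kept) → kept (inj₁ (≡.refl , ≡.refl))) e))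

    -- If deleting ux or uy leaves covers p and q of fewer than k vertices, then
    -- (p ∩ q) ∪ ((p ∪ q ∪ {u}) ∩ side s) covers E for both s; the two sets
    -- together have at most |p| + |q| + 1 < 2k elements.
    module Merge (E : Rel (Fin n) 0ℓ) (bipartite : ∀ i j → E i j → side i ≢ side j)
      {u x y : Fin n} (x≢y : x ≢ y) (ux : E u x) (uy : E u y) {p q : Subset n}
      (p-cover : Cover (delete E u x) p) (q-cover : Cover (delete E u y) q)
      (u∉p : u ∉ p) (u∉q : u ∉ q) where

      some both : Fin n → Bool
      some i = lookup p i ∨ lookup q i ∨ does (i Fin.≟ u)
      both i = lookup p i ∧ lookup q i

      merged : Bool → Fin n → Bool
      merged s i = both i ∨ (some i ∧ does (side i Bool.≟ s))

      ∈p⇒some : ∀ {i} → i ∈ p → some i ≡ true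
      ∈p⇒some i∈p rewrite Vec.[]=⇒lookup i∈p = ≡.refl

      ∈q⇒some : ∀ {i} → i ∈ q → some i ≡ true
      ∈q⇒some {i} i∈q rewrite Vec.[]=⇒lookup i∈q = Bool.∨-zeroʳ (lookup p i)

      u-some : some u ≡ true
      u-some rewrite does-true (u Fin.≟ u) ≡.refl =
        ≡.trans (≡.cong (lookup p u ∨_) (Bool.∨-zeroʳ (lookup q u))) (Bool.∨-zeroʳ (lookup p u))

      ∈both : ∀ {i} → i ∈ p → i ∈ q → both i ≡ true
      ∈both i∈p i∈q = ≡.cong₂ _∧_ (Vec.[]=⇒lookup i∈p) (Vec.[]=⇒lookup i∈q)

      other : ∀ {p : Subset n} {i} → u ∉ p → u ∈ p ⊎ i ∈ p → i ∈ p
      other u∉p (inj₁ u∈p) = contradiction u∈p u∉p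
      other u∉p (inj₂ i∈p) = i∈p

      u≢ : ∀ {i} → E u i → u ≢ i
      u≢ e u≡i = bipartite u _ e (≡.cong side u≡i)

      -- The edge ux survives the deletion of uy, so `q` covers it, and not at u.
      x∈q : x ∈ q
      x∈q = other u∉q (q-cover u x (ux , λ where
        (inj₁ (_ , x≡y)) → x≢y x≡y
        (inj₂ (_ , x≡u)) → u≢ ux (≡.sym x≡u)))

      y∈p : y ∈ p
      y∈p = other u∉p (p-cover u y (uy , λ where
        (inj₁ (_ , y≡x)) → x≢y (≡.sym y≡x)
        (inj₂ (_ , y≡u)) → u≢ uy (≡.sym y≡u)))

      Touched : Fin n → Fin n → Set
      Touched i j = both i ≡ true ⊎ both j ≡ true ⊎ (some i ≡ true × some j ≡ true)

      -- An edge other than ux and uy is covered by both `p` and `q`: at a common end, which then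
      -- lies in `both`, or at one end each, and then both ends lie in `some`.
      touched : ∀ i j → E i j → Touched i j
      touched i j e with (i Fin.≟ u ×-dec j Fin.≟ x) ⊎-dec (i Fin.≟ x ×-dec j Fin.≟ u)
                       | (i Fin.≟ u ×-dec j Fin.≟ y) ⊎-dec (i Fin.≟ y ×-dec j Fin.≟ u)
      ... | yes (inj₁ (≡.refl , ≡.refl)) | _ = inj₂ (inj₂ (u-some , ∈q⇒some x∈q))
      ... | yes (inj₂ (≡.refl , ≡.refl)) | _ = inj₂ (inj₂ (∈q⇒some x∈q , u-some))
      ... | no _ | yes (inj₁ (≡.refl , ≡.refl)) = inj₂ (inj₂ (u-some , ∈p⇒some y∈p))
      ... | no _ | yes (inj₂ (≡.refl , ≡.refl)) = inj₂ (inj₂ (∈p⇒some y∈p , u-some))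
      ... | no ¬ux | no ¬uy with p-cover i j (e , ¬ux) | q-cover i j (e , ¬uy)
      ... | inj₁ i∈p | inj₁ i∈q = inj₁ (∈both i∈p i∈q)
      ... | inj₁ i∈p | inj₂ j∈q = inj₂ (inj₂ (∈p⇒some i∈p , ∈q⇒some j∈q))
      ... | inj₂ j∈p | inj₁ i∈q = inj₂ (inj₂ (∈q⇒some i∈q , ∈p⇒some j∈p))
      ... | inj₂ j∈p | inj₂ j∈q = inj₂ (inj₁ (∈both j∈p j∈q))

      both⇒merged : ∀ {s i} → both i ≡ true → merged s i ≡ true
      both⇒merged {s} {i} eq = ≡.cong (_∨ (some i ∧ does (side i Bool.≟ s))) eq

      some⇒merged : ∀ {s i} → some i ≡ true → side i ≡ s → merged s i ≡ true
      some⇒merged {s} {i} eq i≡s = ≡.trans (≡.cong (both i ∨_)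
        (≡.cong₂ _∧_ eq (does-true (side i Bool.≟ s) i≡s))) (Bool.∨-zeroʳ (both i))

      merged-cover : ∀ s → Cover E (tabulate (merged s))
      merged-cover s i j e with touched i j e
      ... | inj₁ i-both         = inj₁ (∈-tabulate (both⇒merged {s} i-both))
      ... | inj₂ (inj₁ j-both)  = inj₂ (∈-tabulate (both⇒merged {s} j-both))
      ... | inj₂ (inj₂ (i-some , j-some)) with side i Bool.≟ s | side j Bool.≟ s
      ... | yes i≡s | _       = inj₁ (∈-tabulate (some⇒merged i-some i≡s))
      ... | no  _   | yes j≡s = inj₂ (∈-tabulate (some⇒merged j-some j≡s))
      ... | no  i≢s | no  j≢s = contradiction
        (≡.trans (Bool.¬-not i≢s) (≡.sym (Bool.¬-not j≢s))) (bipartite i j e)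

      -- A common vertex of `p` and `q` counts in both merged sets, any other only in the set of its
      -- own side; u adds at most 1.
      merged-card : card (merged true) + card (merged false) ≤ ∣ p ∣ + ∣ q ∣ + 1
      merged-card = begin
        card (merged true) + card (merged false)
          ≡⟨ ℕSum.∑-distrib-+ (indicator ∘ merged true) (indicator ∘ merged false) ⟨
        sum (λ i → indicator (merged true i) + indicator (merged false i))
          ≤⟨ sum-mono (λ i → count (lookup p i) (lookup q i) (does (i Fin.≟ u)) (side i)) ⟩
        sum (λ i → indicator (lookup p i) + indicator (lookup q i) + indicator (does (i Fin.≟ u)))
          ≡⟨ ℕSum.∑-distrib-+ (λ i → indicator (lookup p i) + indicator (lookup q i)) _ ⟩
        sum (λ i → indicator (lookup p i) + indicator (lookup q i)) + card (λ i → does (i Fin.≟ u))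
          ≡⟨ ≡.cong₂ _+_ (≡.trans (ℕSum.∑-distrib-+ (indicator ∘ lookup p) (indicator ∘ lookup q))
               (≡.cong₂ _+_ (card-lookup p) (card-lookup q))) (card-point u) ⟩
        ∣ p ∣ + ∣ q ∣ + 1 ∎
        where
        open ℕ.≤-Reasoning
        count : ∀ a b c s →
          indicator ((a ∧ b) ∨ ((a ∨ b ∨ c) ∧ does (s Bool.≟ true))) +
          indicator ((a ∧ b) ∨ ((a ∨ b ∨ c) ∧ does (s Bool.≟ false)))
          ≤ indicator a + indicator b + indicator c
        count true  true  _     _     = s≤s (s≤s z≤n)
        count true  false _     true  = s≤s z≤n
        count true  false _     false = s≤s z≤n
        count false true  _     true  = s≤s z≤n
        count false true  _     false = s≤s z≤n
        count false false true  true  = s≤s z≤n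
        count false false true  false = s≤s z≤n
        count false false false _     = z≤n

    module _ {E : Rel (Fin n) 0ℓ} (E? : Decidable E) where

      no-fork-unique : ¬ (∃[ u ] ∃[ x ] ∃[ y ] E u x × E u y × x ≢ y) → ∀ {i j l} → E i j → E i l → j ≡ l
      no-fork-unique none {i} {j} {l} e e′ with j Fin.≟ l
      ... | yes j≡l = j≡l
      ... | no  j≢l = contradiction (i , j , l , e , e′ , j≢l) none

      cover-delete : ∀ {u x p} → u ∈ p → Cover (delete E u x) p → Cover E p
      cover-delete {u} {x} u∈p cover i j e with (i Fin.≟ u ×-dec j Fin.≟ x) ⊎-dec (i Fin.≟ x ×-dec j Fin.≟ u)
      ... | yes (inj₁ (≡.refl , _)) = inj₁ u∈p
      ... | yes (inj₂ (_ , ≡.refl)) = inj₂ u∈p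
      ... | no  kept                = cover i j (e , kept)

      matched-delete : ∀ {u x} π → matched (delete? E? u x) π ≤ matched E? π
      matched-delete {u} {x} π = sum-mono λ i → does-mono (delete? E? u x i (π ⟨$⟩ʳ i)) (E? i (π ⟨$⟩ʳ i)) proj₁

    -- `k` stays fixed while edges are deleted. At a vertex with two neighbours, either one of the
    -- two deletions keeps all covers at size `k` or more, or `Merge` yields two covers of E with
    -- fewer than 2k elements together. Without such a vertex the edges form a matching.
    könig : (E : Rel (Fin n) 0ℓ) (E? : Decidable E) → Symmetric E → (∀ i j → E i j → side i ≢ side j) →
      ∀ k → (∀ p → Cover E p → k ≤ ∣ p ∣) → Acc _<_ (size E?) →
      ∃ λ (π : Permutation′ n) → k + k ≤ matched E? π
    könig E E? symm bipartite k minimal (acc smaller)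
      with Fin.any? (λ u → Fin.any? λ x → Fin.any? λ y → E? u x ×-dec E? u y ×-dec ¬? (x Fin.≟ y))
    ... | no none = M.π , M.bound k minimal
      where module M = Matching E E? symm bipartite (no-fork-unique E? none)
    ... | yes (u , x , y , ux , uy , x≢y)
      with Subset.anySubset? (λ p → cover? (delete? E? u x) p ×-dec ∣ p ∣ ℕ.<? k)
         | Subset.anySubset? (λ p → cover? (delete? E? u y) p ×-dec ∣ p ∣ ℕ.<? k)
    ... | no none | _ = let π , bound = könig (delete E u x) (delete? E? u x) (delete-symm symm u x)
                              (λ i j → bipartite i j ∘ proj₁) k
                              (λ p cover → ℕ.≮⇒≥ λ p<k → none (p , cover , p<k)) (smaller (delete-< E? ux))
                        in π , ℕ.≤-trans bound (matched-delete E? π)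
    ... | yes _ | no none = let π , bound = könig (delete E u y) (delete? E? u y) (delete-symm symm u y)
                                  (λ i j → bipartite i j ∘ proj₁) k
                                  (λ p cover → ℕ.≮⇒≥ λ p<k → none (p , cover , p<k)) (smaller (delete-< E? uy))
                            in π , ℕ.≤-trans bound (matched-delete E? π)
    ... | yes (p , p-cover , p<k) | yes (q , q-cover , q<k) = contradiction k+k<k+k (ℕ.n≮n (k + k))
      where
      module M = Merge E bipartite x≢y ux uy p-cover q-cover
        -- A set containing u also covers the deleted edge, so it would cover all of E with fewer
        -- than `k` vertices.
        (λ u∈p → ℕ.<⇒≱ p<k (minimal p (cover-delete E? u∈p p-cover)))
        (λ u∈q → ℕ.<⇒≱ q<k (minimal q (cover-delete E? u∈q q-cover)))
      open ℕ.≤-Reasoning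
      large : ∀ s → k ≤ card (M.merged s)
      large s = ≡.subst (k ≤_) (card-tabulate (M.merged s)) (minimal _ (M.merged-cover s))
      k+k<k+k : k + k < k + k
      k+k<k+k = begin-strict
        k + k                                      ≤⟨ ℕ.+-mono-≤ (large true) (large false) ⟩
        card (M.merged true) + card (M.merged false)  ≤⟨ M.merged-card ⟩
        ∣ p ∣ + ∣ q ∣ + 1                          ≡⟨ ≡.trans (ℕ.+-assoc ∣ p ∣ ∣ q ∣ 1) (≡.cong (∣ p ∣ +_) (ℕ.+-comm ∣ q ∣ 1)) ⟩
        ∣ p ∣ + suc ∣ q ∣                          <⟨ ℕ.+-mono-<-≤ p<k q<k ⟩
        k + k                                      ∎

  τ-minimal : (G : Graph n) → ∀ p → Cover (Adj G) p → τ G ≤ ∣ p ∣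
  τ-minimal G = proj₂ (proj₂ (minimumVertexCover G))

  bipartite-matching : (G : Graph n) → IsBipartite G →
    ∃ λ (π : Permutation′ n) → 2 * τ G ≤ card λ i → does (adj? G i (π ⟨$⟩ʳ i))
  bipartite-matching G (side , bipartite) =
    let π , bound = König.könig {side = side} (Adj G) (adj? G) (Graph.symm G) bipartite (τ G) (τ-minimal G) (<-wellFounded _)
    in π , ≡.subst (_≤ card λ i → does (adj? G i (π ⟨$⟩ʳ i))) (≡.cong (τ G +_) (≡.sym (ℕ.+-identityʳ (τ G)))) bound

  -- Meant for vertex covers: the complement of a cover is independent, hence has at most one
  -- element in a complete graph.
  ∣p∣≥m : ∀ {m} (p : Subset (suc m)) → (∀ i j → i ∉ p → j ∉ p → i ≡ j) → m ≤ ∣ p ∣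
  ∣p∣≥m {zero}  p           _    = z≤n
  ∣p∣≥m {suc m} (true  ∷ p) same = s≤s (∣p∣≥m p λ i j i∉p j∉p → Fin.suc-injective
    (same (suc i) (suc j) (λ i∈p → i∉p (Subset.drop-there i∈p)) (λ j∈p → j∉p (Subset.drop-there j∈p))))
  ∣p∣≥m {suc m} (false ∷ p) same = ≡.subst (_≤ ∣ p ∣) (Subset.∣⊤∣≡n (suc m))
    (Subset.p⊆q⇒∣p∣≤∣q∣ {p = ⊤} λ {i} _ → member i)
    where
    member : ∀ i → i ∈ p
    member i with i Subset.∈? p
    ... | yes i∈p = i∈p
    ... | no  i∉p with () ← same zero (suc i) (λ ()) (λ i∈p → i∉p (Subset.drop-there i∈p))

  τ-complete : ∀ {m} (G : Graph (suc m)) → IsComplete G → τ G ≡ m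
  τ-complete {m} G complete = ℕ.≤-antisym
    (≡.subst (τ G ≤_) (Subset.∣⊤∣≡n m) (τ-minimal G (false ∷ ⊤) cover))
    (∣p∣≥m (proj₁ (minimumVertexCover G)) same)
    where
    cover : Cover (Adj G) (false ∷ ⊤)
    cover zero    zero    e = contradiction e (Graph.irrefl G zero)
    cover zero    (suc j) e = inj₂ (there Subset.∈⊤)
    cover (suc i) j       e = inj₁ (there Subset.∈⊤)
    same : ∀ i j → i ∉ proj₁ (minimumVertexCover G) → j ∉ proj₁ (minimumVertexCover G) → i ≡ j
    same i j i∉ j∉ with i Fin.≟ j
    ... | yes i≡j = i≡j
    ... | no  i≢j with proj₁ (proj₂ (minimumVertexCover G)) i j (complete i j i≢j)
    ... | inj₁ i∈ = contradiction i∈ i∉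
    ... | inj₂ j∈ = contradiction j∈ j∉

  -- Cyclic rotations and covers of cycles

  even : ℕ → Bool
  even zero          = true
  even (suc zero)    = false
  even (suc (suc n)) = even n

  even-suc : ∀ n → even n ≡ true ⊎ even (suc n) ≡ true
  even-suc zero          = inj₁ ≡.refl
  even-suc (suc zero)    = inj₂ ≡.refl
  even-suc (suc (suc n)) = even-suc n

  card-even : ∀ n → card {n} (even ∘ toℕ) ≡ ⌈ n /2⌉
  card-even zero          = ≡.refl
  card-even (suc zero)    = ≡.refl
  card-even (suc (suc n)) = ≡.cong suc (card-even n)

  2*⌈n/2⌉-even : ∀ n → even n ≡ true → 2 * ⌈ n /2⌉ ≡ n
  2*⌈n/2⌉-even zero          _ = ≡.refl
  2*⌈n/2⌉-even (suc (suc n)) e = ≡.trans (ℕ.*-suc 2 ⌈ n /2⌉) (≡.cong (2 +_) (2*⌈n/2⌉-even n e))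

  2*⌈n/2⌉-odd : ∀ n → even n ≡ false → 2 * ⌈ n /2⌉ ≡ suc n
  2*⌈n/2⌉-odd (suc zero)    _ = ≡.refl
  2*⌈n/2⌉-odd (suc (suc n)) o = ≡.trans (ℕ.*-suc 2 ⌈ n /2⌉) (≡.cong (2 +_) (2*⌈n/2⌉-odd n o))

  module Rotation (n : ℕ) .{{_ : NonZero n}} where

    rotate : ℕ → Fin n → Fin n
    rotate k i = fromℕ< (m%n<n (k + toℕ i) n)

    toℕ-rotate : ∀ k i → toℕ (rotate k i) ≡ (k + toℕ i) % n
    toℕ-rotate k i = Fin.toℕ-fromℕ< (m%n<n (k + toℕ i) n)

    rotate-+ : ∀ k l i → rotate k (rotate l i) ≡ rotate (k + l) i
    rotate-+ k l i = Fin.toℕ-injective (begin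
      toℕ (rotate k (rotate l i))   ≡⟨ toℕ-rotate k (rotate l i) ⟩
      (k + toℕ (rotate l i)) % n    ≡⟨ ≡.cong (λ z → (k + z) % n) (toℕ-rotate l i) ⟩
      (k + (l + toℕ i) % n) % n     ≡⟨ %-distribˡ-+ k ((l + toℕ i) % n) n ⟩
      (k % n + (l + toℕ i) % n % n) % n  ≡⟨ ≡.cong (λ z → (k % n + z) % n) (m%n%n≡m%n (l + toℕ i) n) ⟩
      (k % n + (l + toℕ i) % n) % n ≡⟨ %-distribˡ-+ k (l + toℕ i) n ⟨
      (k + (l + toℕ i)) % n         ≡⟨ ≡.cong (_% n) (ℕ.+-assoc k l (toℕ i)) ⟨
      (k + l + toℕ i) % n           ≡⟨ toℕ-rotate (k + l) i ⟨
      toℕ (rotate (k + l) i)        ∎)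
      where open ≡.≡-Reasoning

    rotate-n : ∀ i → rotate n i ≡ i
    rotate-n i = Fin.toℕ-injective (≡.trans (toℕ-rotate n i) (≡.trans (≡.cong (_% n) (ℕ.+-comm n (toℕ i)))
      (≡.trans ([m+n]%n≡m%n (toℕ i) n) (m<n⇒m%n≡m (Fin.toℕ<n i)))))

    -- k + i leaves remainder i modulo n, so k is the quotient times n. This is what excludes fixed
    -- points of short rotations.
    rotate-fixed : ∀ k i → rotate k i ≡ i → n ∣ k
    rotate-fixed k i eq = divides ((k + toℕ i) / n) (ℕ.+-cancelʳ-≡ (toℕ i) _ _ (begin
      k + toℕ i                                ≡⟨ m≡m%n+[m/n]*n (k + toℕ i) n ⟩
      (k + toℕ i) % n + (k + toℕ i) / n * n    ≡⟨ ≡.cong (_+ (k + toℕ i) / n * n) (≡.trans (≡.sym (toℕ-rotate k i)) (≡.cong toℕ eq)) ⟩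
      toℕ i + (k + toℕ i) / n * n              ≡⟨ ℕ.+-comm (toℕ i) _ ⟩
      (k + toℕ i) / n * n + toℕ i              ∎))
      where open ≡.≡-Reasoning

    next : Permutation′ n
    next = permutation (rotate 1) (rotate (n ∸ 1))
      (λ i → ≡.trans (rotate-+ 1 (n ∸ 1) i) (full i))
      (λ i → ≡.trans (rotate-+ (n ∸ 1) 1 i) (≡.trans (≡.cong (λ k → rotate k i) (ℕ.+-comm (n ∸ 1) 1)) (full i)))
      where
      full : ∀ i → rotate (1 + (n ∸ 1)) i ≡ i
      full i = ≡.trans (≡.cong (λ k → rotate k i) (ℕ.suc-pred n)) (rotate-n i)

    Next⇒next : ∀ {i j} → Next i j → j ≡ next ⟨$⟩ʳ i
    Next⇒next {i} {j} (inj₁ j≡1+i) = Fin.toℕ-injective (≡.sym (≡.trans (toℕ-rotate 1 i)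
      (≡.trans (≡.cong (_% n) (≡.sym j≡1+i)) (m<n⇒m%n≡m (Fin.toℕ<n j)))))
    Next⇒next {i} {j} (inj₂ (1+i≡n , j≡0)) = Fin.toℕ-injective (≡.sym (≡.trans (toℕ-rotate 1 i)
      (≡.trans (≡.trans (≡.cong (_% n) 1+i≡n) (n%n≡0 n)) (≡.sym j≡0))))

    next⇒Next : ∀ i → Next i (next ⟨$⟩ʳ i)
    next⇒Next i with suc (toℕ i) ℕ.<? n
    ... | yes 1+i<n = inj₁ (≡.trans (toℕ-rotate 1 i) (m<n⇒m%n≡m 1+i<n))
    ... | no  1+i≮n = inj₂ (1+i≡n , ≡.trans (toℕ-rotate 1 i) (≡.trans (≡.cong (_% n) 1+i≡n) (n%n≡0 n)))
      where
      1+i≡n : suc (toℕ i) ≡ n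
      1+i≡n = ℕ.≤-antisym (Fin.toℕ<n i) (ℕ.≮⇒≥ 1+i≮n)

  module CycleGraph (G : Graph n) (3≤n : 3 ≤ n) (v : Permutation′ n)
    (adjacent : ∀ i j → Function.Bundles._⇔_ (Adj G (v ⟨$⟩ʳ i) (v ⟨$⟩ʳ j)) (Next i j ⊎ Next j i)) where

    instance
      n-nonZero : NonZero n
      n-nonZero = ℕ.>-nonZero (ℕ.≤-trans (s≤s z≤n) 3≤n)

    open Rotation n public

    σ ρ : Fin n → Fin n
    σ = next ⟨$⟩ʳ_
    ρ = next ⟨$⟩ˡ_

    adjacent⇒ : ∀ i j → Adj G (v ⟨$⟩ʳ i) (v ⟨$⟩ʳ j) → j ≡ σ i ⊎ j ≡ ρ i
    adjacent⇒ i j e with Equivalence.to (adjacent i j) e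
    ... | inj₁ ij = inj₁ (Next⇒next ij)
    ... | inj₂ ji = inj₂ (≡.trans (≡.sym (inverseˡ next)) (≡.cong ρ (≡.sym (Next⇒next ji))))

    adjacent-σ : ∀ i → Adj G (v ⟨$⟩ʳ i) (v ⟨$⟩ʳ (σ i))
    adjacent-σ i = Equivalence.from (adjacent i (σ i)) (inj₁ (next⇒Next i))

    adjacent-ρ : ∀ i → Adj G (v ⟨$⟩ʳ i) (v ⟨$⟩ʳ (ρ i))
    adjacent-ρ i = Equivalence.from (adjacent i (ρ i))
      (inj₂ (≡.subst (Next (ρ i)) (inverseʳ next) (next⇒Next (ρ i))))

    σ²-fixed : ∀ i → σ (σ i) ≡ i → n ∣ 2
    σ²-fixed i eq = rotate-fixed 2 i (≡.trans (≡.sym (rotate-+ 1 1 i)) eq)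

    σ⁴-fixed : ∀ i → σ (σ (σ (σ i))) ≡ i → n ∣ 4
    σ⁴-fixed i eq = rotate-fixed 4 i (≡.trans (≡.sym (≡.trans
      (≡.cong σ (≡.trans (≡.cong σ (rotate-+ 1 1 i)) (rotate-+ 1 2 i))) (rotate-+ 1 3 i))) eq)

    σ⁶-fixed : ∀ i → σ (σ (σ (σ (σ (σ i))))) ≡ i → n ∣ 6
    σ⁶-fixed i eq = rotate-fixed 6 i (≡.trans (≡.sym (≡.trans (≡.cong σ (≡.trans (≡.cong σ (≡.trans
      (≡.cong σ (≡.trans (≡.cong σ (rotate-+ 1 1 i)) (rotate-+ 1 2 i))) (rotate-+ 1 3 i))) (rotate-+ 1 4 i))) (rotate-+ 1 5 i))) eq)

    alternate : Fin n → Bool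
    alternate w = even (toℕ (v ⟨$⟩ˡ w))

    -- Of two consecutive positions one is even; the closing edge is covered at position 0, whatever
    -- the parity of n.
    alternate-cover : Cover (Adj G) (tabulate alternate)
    alternate-cover a b e = Sum.map ∈-tabulate ∈-tabulate (Sum.[ forward , Sum.swap ∘ forward ]′
      (Equivalence.to (adjacent (v ⟨$⟩ˡ a) (v ⟨$⟩ˡ b)) (≡.subst₂ (Adj G) (≡.sym (inverseʳ v)) (≡.sym (inverseʳ v)) e)))
      where
      forward : ∀ {i j : Fin n} → Next i j → even (toℕ i) ≡ true ⊎ even (toℕ j) ≡ true
      forward {i} (inj₁ j≡1+i)  rewrite j≡1+i = even-suc (toℕ i)
      forward     (inj₂ (_ , j≡0)) rewrite j≡0 = inj₂ ≡.refl

    τ≤ : 2 * τ G ≤ 2 * ⌈ n /2⌉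
    τ≤ = ℕ.*-monoʳ-≤ 2 (≡.subst (τ G ≤_) (begin
      ∣ tabulate alternate ∣     ≡⟨ card-tabulate alternate ⟩
      card alternate             ≡⟨ ℕSum.∑-permute (indicator ∘ alternate) v ⟩
      card (λ i → even (toℕ (v ⟨$⟩ˡ (v ⟨$⟩ʳ i))))  ≡⟨ ℕSum.sum-cong-≗ {n} (λ i → ≡.cong (indicator ∘ even ∘ toℕ) (inverseˡ v {i})) ⟩
      card {n} (even ∘ toℕ)      ≡⟨ card-even n ⟩
      ⌈ n /2⌉                    ∎) (τ-minimal G _ alternate-cover))
      where open ≡.≡-Reasoning

    -- `∘ₚ` applies its left factor first: a vertex goes to its position, one step on, and back to a
    -- vertex.
    rotation : Permutation′ n
    rotation = (flip v ∘ₚ next) ∘ₚ v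

    rotation-adjacent : ∀ w → Adj G w (rotation ⟨$⟩ʳ w)
    rotation-adjacent w = ≡.subst (λ z → Adj G z (rotation ⟨$⟩ʳ w)) (inverseʳ v) (adjacent-σ (v ⟨$⟩ˡ w))

  -- For n = 3 the shifts by 3 and -3 coincide, and the sixth power sum is 66, not 20n = 60. The
  -- triangle is therefore treated as a complete graph.
  triangle-complete : (G : Graph n) → n ≡ 3 → IsCycle G → IsComplete G
  triangle-complete G ≡.refl (_ , v , adjacent) a b a≢b =
    ≡.subst₂ (Adj G) (inverseʳ v) (inverseʳ v) (Equivalence.from (adjacent (v ⟨$⟩ˡ a) (v ⟨$⟩ˡ b))
      (all _ _ λ eq → a≢b (≡.trans (≡.sym (inverseʳ v)) (≡.trans (≡.cong (v ⟨$⟩ʳ_) eq) (inverseʳ v)))))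
    where
    all : ∀ (i j : Fin 3) → i ≢ j → Next i j ⊎ Next j i
    all zero             zero             i≢j = contradiction ≡.refl i≢j
    all zero             (suc zero)       _   = inj₁ (inj₁ ≡.refl)
    all zero             (suc (suc zero)) _   = inj₂ (inj₂ (≡.refl , ≡.refl))
    all (suc zero)       zero             _   = inj₂ (inj₁ ≡.refl)
    all (suc zero)       (suc zero)       i≢j = contradiction ≡.refl i≢j
    all (suc zero)       (suc (suc zero)) _   = inj₁ (inj₁ ≡.refl)
    all (suc (suc zero)) zero             _   = inj₁ (inj₂ (≡.refl , ≡.refl))
    all (suc (suc zero)) (suc zero)       _   = inj₂ (inj₁ ≡.refl)
    all (suc (suc zero)) (suc (suc zero)) i≢j = contradiction ≡.refl i≢j

-- Energy bounds from an orthonormal eigenbasis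

module Energy (F : RealField) where

  open Combinatorics
  open import Data.List.Base using (List; []; _∷_; map)
  open import Data.List.Relation.Unary.All using (All; []; _∷_)
  open import Data.List.Relation.Unary.AllPairs using ([]; _∷_)
  open import Data.List.Relation.Unary.Unique.Propositional using (Unique)
  open import Data.Nat.Base using (⌈_/2⌉)
  open RealField F
  open CommutativeRing commutativeRing renaming (Carrier to A) hiding (zero)
  open CommutativeAlgebra commutativeRing scalar
  open import Algebra.Solver.Ring ℚ.+-*-rawRing (fromCommutativeRing commutativeRing) scalar ℚ-equal?
    using (Polynomial)
  open _-Raw-AlmostCommutative⟶_ scalar using (⟦_⟧; +-homo; 0-homo; 1-homo)
  open IsRotation
  import Algebra.Properties.Ring ring as Ring
  open import Relation.Binary.Reasoning.Setoid setoid

  private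
    variable
      n : ℕ

  -- Over the reals this unfolds to `fromℕ`, so bounds by `ι` already have the form of the
  -- statement.
  ι : ℕ → A
  ι k = ⟦ ℤ.+ k ℚ./ 1 ⟧

  -- `ℚ._/_` divides by a gcd that does not reduce for a variable `k`; the explicit fraction
  -- computes.
  /1-normal : ∀ k → ℤ.+ k ℚ./ 1 ≡ mkℚ (ℤ.+ k) 0 (Coprime.sym (Coprime.1-coprimeTo k))
  /1-normal k = ℚ.↥p/↧p≡p (mkℚ (ℤ.+ k) 0 (Coprime.sym (Coprime.1-coprimeTo k)))

  ι-+ : ∀ k l → ι (k ℕ.+ l) ≈ ι k + ι l
  ι-+ k l = trans (reflexive (≡.cong ⟦_⟧ (≡.sym (≡.trans
    (≡.cong₂ ℚ._+_ (/1-normal k) (/1-normal l))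
    (≡.cong (ℚ._/ 1) (≡.cong₂ ℤ._+_ (ℤ.*-identityʳ (ℤ.+ k)) (ℤ.*-identityʳ (ℤ.+ l)))))))) (+-homo _ _)

  ι-mono : ∀ {k l} → k ℕ.≤ l → ι k ≼ ι l
  ι-mono {k} {l} k≤l = scalar-mono (≡.subst₂ ℚ._≤_ (≡.sym (/1-normal k)) (≡.sym (/1-normal l))
    (ℚ.*≤* (≡.subst₂ ℤ._≤_ (≡.sym (ℤ.*-identityʳ (ℤ.+ k))) (≡.sym (ℤ.*-identityʳ (ℤ.+ l))) (ℤ.+≤+ k≤l))))

  ι-injective : ∀ {k l} → ι k ≈ ι l → k ≡ l
  ι-injective {k} {l} eq = ℤ.+-injective (≡.cong ℚ.numerator
    (≡.trans (≡.sym (/1-normal k)) (≡.trans (scalar-cancel eq) (/1-normal l))))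

  ι-0 : ι 0 ≈ 0#
  ι-0 = 0-homo

  ι-1 : ι 1 ≈ 1#
  ι-1 = 1-homo

  x-y≈0⇒x≈y : ∀ {x y} → x - y ≈ 0# → x ≈ y
  x-y≈0⇒x≈y {x} {y} x-y≈0 = trans (solve 2 (λ x y → x := (x :- y) :+ y) refl x y)
    (trans (+-congʳ x-y≈0) (+-identityˡ y))

  x≈y⇒x-y≈0 : ∀ {x y} → x ≈ y → x - y ≈ 0#
  x≈y⇒x-y≈0 x≈y = trans (+-congʳ x≈y) (-‿inverseʳ _)

  -- (c , s) is (x , y) divided by its length.
  unitVector : ∀ x y → ¬ ¬ (∃[ c ] ∃[ s ] c * c + s * s ≈ 1# × c * y ≈ s * x)
  unitVector x y = do
    inj₂ t≉0 ← ¬¬-em (x * x + y * y ≈ 0#)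
      where
      -- The zero vector has no direction; (1 , 0) satisfies the equation since y ≈ 0.
      inj₁ t≈0 → return (1# , 0#
        , trans (+-cong (*-identityˡ 1#) (zeroˡ 0#)) (+-identityʳ 1#)
        , trans (*-identityˡ y) (trans (y≈0 t≈0) (sym (zeroˡ x))))
    w , w²t≈1 ← inverseSqrt t≥0 t≉0
    return (x * w , y * w
      , trans (solve 3 (λ x y w → x :* w :* (x :* w) :+ y :* w :* (y :* w) := w :* w :* (x :* x :+ y :* y)) refl x y w) w²t≈1
      , solve 3 (λ x y w → x :* w :* y := y :* w :* x) refl x y w)
    where
    t≥0 : 0# ≼ x * x + y * y
    t≥0 = ≼-trans (≼-reflexive (sym (+-identityˡ 0#))) (+-mono-≼ (square-nonNeg x) (square-nonNeg y))
    y≈0 : x * x + y * y ≈ 0# → y ≈ 0#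
    y≈0 t≈0 = ≈-stable λ y≉0 → y≉0 (*-cancel y≉0 (≼-antisym
      (≼-trans (≼-reflexive (sym (+-identityˡ _)))
        (≼-trans (+-mono-≼ (square-nonNeg x) (≼-reflexive refl)) (≼-reflexive t≈0)))
      (square-nonNeg y)))

  ι-distinct : ∀ {i j} → i ≢ j → ¬ ι i - ι j ≈ 0#
  ι-distinct i≢j eq = i≢j (ι-injective (x-y≈0⇒x≈y eq))

  ≼-refl : ∀ {x} → x ≼ x
  ≼-refl = ≼-reflexive refl

  ∑-mono : {u v : Vector A n} → (∀ i → u i ≼ v i) → ∑ u ≼ ∑ v
  ∑-mono {zero}  u≼v = ≼-reflexive (trans (∑-empty _) (sym (∑-empty _)))
  ∑-mono {suc n} u≼v = ≼-trans (≼-reflexive (∑-suc _))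
    (≼-trans (+-mono-≼ (u≼v zero) (∑-mono (u≼v ∘ suc))) (≼-reflexive (sym (∑-suc _))))

  ∑-const : ∀ x → ∑ {n} (const x) ≈ ι n * x
  ∑-const {zero}  x = trans (∑-empty _) (sym (trans (*-congʳ ι-0) (zeroˡ x)))
  ∑-const {suc n} x = trans (∑-suc _) (trans
    (+-cong (trans (sym (*-identityˡ x)) (*-congʳ (sym ι-1))) (∑-const {n} x))
    (trans (sym (distribʳ x _ _)) (*-congʳ (sym (ι-+ 1 n)))))

  ∑-neg : (u : Vector A n) → ∑ (λ i → - u i) ≈ - ∑ u
  ∑-neg u = trans (∑-cong λ i → sym (trans (sym (Ring.-‿distribˡ-* 1# (u i))) (-‿cong (*-identityˡ _))))
    (trans (∑-* (- 1#) u) (trans (sym (Ring.-‿distribˡ-* 1# (∑ u))) (-‿cong (*-identityˡ _))))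

  ≼-by-difference : ∀ {x y} → 0# ≼ y - x → x ≼ y
  ≼-by-difference {x} {y} 0≼y-x = ≼-trans (≼-reflexive (sym (+-identityˡ x)))
    (≼-trans (+-mono-≼ 0≼y-x (≼-refl {x}))
      (≼-reflexive (solve 2 (λ x y → (y :- x) :+ x := y) refl x y)))

  difference : ∀ {x y} → x ≼ y → 0# ≼ y - x
  difference {x} {y} x≼y = ≼-trans (≼-reflexive (sym (-‿inverseʳ x))) (+-mono-≼ x≼y ≼-refl)

  neg-anti : ∀ {x y} → x ≼ y → - y ≼ - x
  neg-anti {x} {y} x≼y = ≼-by-difference (≼-trans (difference x≼y)
    (≼-reflexive (solve 2 (λ x y → y :- x := :- x :- (:- y)) refl x y)))

  ½ : A
  ½ = ⟦ ℚ.½ ⟧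

  ½-nonNeg : 0# ≼ ½
  ½-nonNeg = ≼-trans (≼-reflexive (sym 0-homo)) (scalar-mono (ℚ.nonNegative⁻¹ ℚ.½))

  ½+½ : ∀ x → ½ * x + ½ * x ≈ x
  ½+½ x = solve 1 (λ x → con ℚ.½ :* x :+ con ℚ.½ :* x := x) refl x

  -- Termwise a b ≤ (a² + b²) / 2, and a permutation does not change the sum of squares.
  ∑-permute-≼ : (u : Vector A n) (π : Permutation′ n) →
    ∑ (λ i → u i * u (π ⟨$⟩ʳ i)) ≼ ∑ (λ i → u i * u i)
  ∑-permute-≼ u π = ≼-trans (∑-mono λ i → ≼-by-difference (≼-trans
      (*-nonNeg ½-nonNeg (square-nonNeg (u i - u (π ⟨$⟩ʳ i))))
      (≼-reflexive (solve 2 (λ a b → con ℚ.½ :* ((a :- b) :* (a :- b))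
        := con ℚ.½ :* (a :* a) :+ con ℚ.½ :* (b :* b) :- a :* b) refl (u i) (u (π ⟨$⟩ʳ i))))))
    (≼-reflexive (trans (∑-linear ½ ½ _ _) (trans
      (+-congˡ (*-congˡ (sym (∑-permute (λ i → u i * u i) π)))) (½+½ _))))

  ∑-permute-≽ : (u : Vector A n) (π : Permutation′ n) →
    - ∑ (λ i → u i * u (π ⟨$⟩ʳ i)) ≼ ∑ (λ i → u i * u i)
  ∑-permute-≽ u π = ≼-trans (≼-reflexive (sym (∑-neg _)))
    (≼-trans (∑-mono λ i → ≼-by-difference (≼-trans
      (*-nonNeg ½-nonNeg (square-nonNeg (u i + u (π ⟨$⟩ʳ i))))
      (≼-reflexive (solve 2 (λ a b → con ℚ.½ :* ((a :+ b) :* (a :+ b))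
        := con ℚ.½ :* (a :* a) :+ con ℚ.½ :* (b :* b) :- (:- (a :* b))) refl (u i) (u (π ⟨$⟩ʳ i))))))
    (≼-reflexive (trans (∑-linear ½ ½ _ _) (trans
      (+-congˡ (*-congˡ (sym (∑-permute (λ i → u i * u i) π)))) (½+½ _)))))

  x*y≼∣x∣ : ∀ x y → y ≼ 1# → - y ≼ 1# → x * y ≼ ∣ x ∣
  x*y≼∣x∣ x y y≼1 -y≼1 = ≼-stable (≼-sign x >>= λ where
    (inj₁ 0≼x) → return (≼-trans (≼-by-difference (≼-trans (*-nonNeg 0≼x (difference y≼1))
      (≼-reflexive (trans (solve 3 (λ x y e → x :* (e :- y) := x :* e :- x :* y) refl x y 1#)
        (+-congʳ (*-identityʳ x))))))
      (≼-reflexive (sym (∣∣-nonNeg 0≼x))))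
    (inj₂ x≼0) → return (≼-trans (≼-by-difference (≼-trans (*-nonNeg (difference x≼0) (difference -y≼1))
      (≼-reflexive (trans (solve 4 (λ x y e z → (z :- x) :* (e :- (:- y)) := (z :* e :- x :* e :+ z :* y) :- x :* y) refl x y 1# 0#)
        (+-congʳ (trans (+-cong (trans (+-congʳ (zeroˡ _)) (trans (+-identityˡ _) (-‿cong (*-identityʳ x)))) (zeroˡ y)) (+-identityʳ _)))))))
      (≼-reflexive (sym (∣∣-nonPos x≼0)))))

  δ-diagonal : (i : Fin n) → δ i i ≈ 1#
  δ-diagonal zero    = refl
  δ-diagonal (suc i) = δ-diagonal i

  δ-distinct : {i j : Fin n} → i ≢ j → δ i j ≈ 0#
  δ-distinct {i = zero}  {zero}  0≢0 = contradiction ≡.refl 0≢0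
  δ-distinct {i = zero}  {suc j} _   = refl
  δ-distinct {i = suc i} {zero}  _   = refl
  δ-distinct {i = suc i} {suc j} i≢j = δ-distinct (i≢j ∘ ≡.cong suc)

  module _ {B : Matrix A n} {λs : Vector A n} {Q : Matrix A n} (basis : Eigenbasis B λs Q) where

    private
      rotation : IsRotation Q
      rotation = proj₁ basis
      eigen : ∀ k i → (B ▹ Q k) i ≈ λs k * Q k i
      eigen = proj₂ basis

    orthonormal : ∀ i j → ∑ (λ k → Q k i * Q k j) ≈ δ i j
    orthonormal = columns rotation

    norm : ∀ k → ∑ (λ i → Q k i * Q k i) ≈ 1#
    norm k = trans (rows rotation k k) (δ-diagonal k)

    -- The decomposition B = Σₖ λₖ qₖ qₖᵀ read at the entries (i, α i) and summed; α = id gives the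
    -- trace.
    trace : ∀ (α : Fin n → Fin n) → ∑ (λ k → λs k * ∑ λ i → Q k i * Q k (α i)) ≈ ∑ λ i → B i (α i)
    trace α = begin
      ∑ (λ k → λs k * ∑ λ i → Q k i * Q k (α i))
        ≈⟨ (∑-cong λ k → trans (sym (∑-* (λs k) _)) (∑-cong λ i → trans (sym (*-assoc _ _ _)) (*-congʳ (sym (eigen k i))))) ⟩
      ∑ (λ k → ∑ λ i → (B ▹ Q k) i * Q k (α i))
        ≈⟨ ∑-swap _ ⟩
      ∑ (λ i → ∑ λ k → (B ▹ Q k) i * Q k (α i))
        ≈⟨ (∑-cong λ i → trans (∑-cong λ k → trans (*-comm _ _) (trans (sym (∑-* (Q k (α i)) _))
             (∑-cong λ j → solve 3 (λ q b p → q :* (b :* p) := b :* (p :* q)) refl (Q k (α i)) (B i j) (Q k j)))) (∑-swap _)) ⟩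
      ∑ (λ i → ∑ λ j → ∑ λ k → B i j * (Q k j * Q k (α i)))
        ≈⟨ (∑-cong λ i → ∑-cong λ j → trans (∑-* (B i j) _) (trans (*-congˡ (columns rotation j (α i)))
             (trans (*-comm _ _) (*-congʳ (δ-sym j (α i)))))) ⟩
      ∑ (λ i → ∑ λ j → δ (α i) j * B i j)
        ≈⟨ (∑-cong λ i → δ-▹ (B i) (α i)) ⟩
      ∑ (λ i → B i (α i)) ∎

    permutation-bound : ∀ (π : Permutation′ n) → ∑ (λ i → B i (π ⟨$⟩ʳ i)) ≼ ∑ (λ k → ∣ λs k ∣)
    permutation-bound π = ≼-trans (≼-reflexive (sym (trace (π ⟨$⟩ʳ_))))
      (∑-mono λ k → x*y≼∣x∣ (λs k) _
        (≼-trans (∑-permute-≼ (Q k) π) (≼-reflexive (norm k)))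
        (≼-trans (∑-permute-≽ (Q k) π) (≼-reflexive (norm k))))

  -- Complete graphs

  module Complete {m} {B : Matrix A (suc m)} (B≈1-δ : ∀ i j → B i j ≈ 1# - δ i j)
    {λs : Vector A (suc m)} {Q : Matrix A (suc m)} (basis : Eigenbasis B λs Q) where

    private
      μ : A
      μ = ι m
      1+μ : ι (suc m) ≈ ι 1 + μ
      1+μ = ι-+ 1 m

    -- Let s be the sum of the coordinates of qₖ. The matrix sends qₖ(i) to s - qₖ(i), so (λ + 1)
    -- qₖ(i) = s for every i, and summation over i gives (λ + 1) s = (m + 1) s. As qₖ has norm 1,
    -- the vector can be removed from the product.
    annihilated : ∀ k → (λs k - μ) * (λs k + ι 1) ≈ 0#
    annihilated k = begin
      (x - μ) * (x + ι 1)
        ≈⟨ trans (*-congˡ (norm basis k)) (*-identityʳ _) ⟨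
      (x - μ) * (x + ι 1) * ∑ (λ i → Q k i * Q k i)
        ≈⟨ ∑-* _ _ ⟨
      ∑ (λ i → (x - μ) * (x + ι 1) * (Q k i * Q k i))
        ≈⟨ ∑-zero (λ i → trans (solve 4 (λ x μ e q → (x :- μ) :* (x :+ e) :* (q :* q) := q :* ((x :- μ) :* ((x :+ e) :* q))) refl x μ (ι 1) (Q k i))
             (trans (*-congˡ (trans (*-congˡ (shifted i)) s-annihilated)) (zeroʳ _))) ⟩
      0# ∎
      where
      x s : A
      x = λs k
      s = ∑ (Q k)
      shifted : ∀ i → (x + ι 1) * Q k i ≈ s
      shifted i = begin
        (x + ι 1) * Q k i
          ≈⟨ trans (distribʳ _ x (ι 1)) (+-cong (sym (proj₂ basis k i)) (trans (*-congʳ ι-1) (*-identityˡ _))) ⟩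
        (B ▹ Q k) i + Q k i
          ≈⟨ +-congʳ (∑-cong λ j → trans (*-congʳ (B≈1-δ i j))
               (trans (solve 3 (λ e d q → (e :- d) :* q := e :* q :+ (:- e) :* (d :* q) :+ (e :* (d :* q) :- d :* q)) refl 1# (δ i j) (Q k j))
                 (trans (+-congˡ (trans (+-congʳ (*-identityˡ _)) (-‿inverseʳ _))) (+-identityʳ _)))) ⟩
        ∑ (λ j → 1# * Q k j + (- 1#) * (δ i j * Q k j)) + Q k i
          ≈⟨ +-congʳ (trans (∑-linear 1# (- 1#) _ _) (+-cong (*-identityˡ s)
               (trans (sym (Ring.-‿distribˡ-* _ _)) (-‿cong (trans (*-identityˡ _) (δ-▹ (Q k) i)))))) ⟩
        s - Q k i + Q k i
          ≈⟨ solve 2 (λ s q → s :- q :+ q := s) refl s (Q k i) ⟩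
        s ∎
      s-annihilated : (x - μ) * s ≈ 0#
      s-annihilated = begin
        (x - μ) * s
          ≈⟨ solve 4 (λ x μ s e → (x :- μ) :* s := (x :+ e) :* s :- (e :+ μ) :* s) refl x μ s (ι 1) ⟩
        (x + ι 1) * s - (ι 1 + μ) * s
          ≈⟨ +-cong (sym (∑-* (x + ι 1) (Q k))) (-‿cong (trans (*-congʳ (sym 1+μ)) (sym (∑-const {suc m} s)))) ⟩
        ∑ (λ i → (x + ι 1) * Q k i) - ∑ (const s)
          ≈⟨ +-congʳ (∑-cong shifted) ⟩
        ∑ {suc m} (const s) - ∑ {suc m} (const s)
          ≈⟨ -‿inverseʳ _ ⟩
        0# ∎

    -- The line through (-1, 1) and (m, m), the points of the graph of |λ| over the two possible
    -- eigenvalues, multiplied by m + 1 to clear the denominator.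
    ∣λ∣ : ∀ k → ι (suc m) * ∣ λs k ∣ ≈ (μ - ι 1) * λs k + (μ + μ)
    ∣λ∣ k = ≈-stable (¬¬-em (λs k + ι 1 ≈ 0#) >>= λ where
      (inj₁ λ+1≈0) → return (begin
        ι (suc m) * ∣ λs k ∣
          ≈⟨ *-cong 1+μ (∣∣-nonPos (≼-trans (≼-reflexive (negative λ+1≈0))
               (≼-trans (neg-anti (≼-trans (≼-reflexive (sym ι-0)) (ι-mono {0} {1} ℕ.z≤n))) (≼-reflexive Ring.-0#≈0#)))) ⟩
        (ι 1 + μ) * - λs k
          ≈⟨ *-congˡ (-‿cong (negative λ+1≈0)) ⟩
        (ι 1 + μ) * - - ι 1
          ≈⟨ solve 1 (λ μ → (con one :+ μ) :* (:- (:- con one)) := (μ :- con one) :* (:- con one) :+ (μ :+ μ)) refl μ ⟩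
        (μ - ι 1) * - ι 1 + (μ + μ)
          ≈⟨ +-congʳ (*-congˡ (sym (negative λ+1≈0))) ⟩
        (μ - ι 1) * λs k + (μ + μ) ∎)
      (inj₂ λ+1≉0) → return (let λ≈μ = x-y≈0⇒x≈y (*-cancel λ+1≉0 (trans (*-comm _ _) (annihilated k))) in begin
        ι (suc m) * ∣ λs k ∣
          ≈⟨ *-cong 1+μ (∣∣-nonNeg (≼-trans (≼-reflexive (sym ι-0))
               (≼-trans (ι-mono {0} {m} ℕ.z≤n) (≼-reflexive (sym λ≈μ))))) ⟩
        (ι 1 + μ) * λs k
          ≈⟨ *-congˡ λ≈μ ⟩
        (ι 1 + μ) * μ
          ≈⟨ solve 1 (λ μ → (con one :+ μ) :* μ := (μ :- con one) :* μ :+ (μ :+ μ)) refl μ ⟩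
        (μ - ι 1) * μ + (μ + μ)
          ≈⟨ +-congʳ (*-congˡ (sym λ≈μ)) ⟩
        (μ - ι 1) * λs k + (μ + μ) ∎))
      where
      one : ℚ
      one = ℤ.+ 1 ℚ./ 1
      negative : λs k + ι 1 ≈ 0# → λs k ≈ - ι 1
      negative eq = trans (solve 2 (λ x e → x := (x :+ e) :+ (:- e)) refl (λs k) (ι 1)) (trans (+-congʳ eq) (+-identityˡ _))

    energy : ∑ (λ k → ∣ λs k ∣) ≈ ι (2 ℕ.* m)
    energy = trans (x-y≈0⇒x≈y (*-cancel suc≉0 scaled)) (trans (sym (ι-+ m m)) (reflexive (≡.cong (λ z → ι (m ℕ.+ z)) (≡.sym (ℕ.+-identityʳ m)))))
      where
      E : A
      E = ∑ (λ k → ∣ λs k ∣)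
      suc≉0 : ¬ ι (suc m) ≈ 0#
      suc≉0 eq with () ← ι-injective {suc m} {0} (trans eq (sym ι-0))
      ∑λ≈0 : ∑ λs ≈ 0#
      ∑λ≈0 = begin
        ∑ λs
          ≈⟨ (∑-cong λ k → trans (sym (*-identityʳ _)) (*-congˡ (sym (norm basis k)))) ⟩
        ∑ (λ k → λs k * ∑ λ i → Q k i * Q k i)
          ≈⟨ trace basis id ⟩
        ∑ (λ i → B i i)
          ≈⟨ ∑-zero (λ i → trans (B≈1-δ i i) (x≈y⇒x-y≈0 (sym (δ-diagonal i)))) ⟩
        0# ∎
      scaled : ι (suc m) * (E - (μ + μ)) ≈ 0#
      scaled = trans (solve 3 (λ a e b → a :* (e :- b) := a :* e :- a :* b) refl (ι (suc m)) E (μ + μ)) (x≈y⇒x-y≈0 (begin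
        ι (suc m) * E
          ≈⟨ ∑-* _ _ ⟨
        ∑ (λ k → ι (suc m) * ∣ λs k ∣)
          ≈⟨ ∑-cong ∣λ∣ ⟩
        ∑ (λ k → (μ - ι 1) * λs k + (μ + μ))
          ≈⟨ trans (∑-+ _ _) (+-cong (∑-* _ _) (∑-const {suc m} _)) ⟩
        (μ - ι 1) * ∑ λs + ι (suc m) * (μ + μ)
          ≈⟨ trans (+-congʳ (trans (*-congˡ ∑λ≈0) (zeroʳ _))) (+-identityˡ _) ⟩
        ι (suc m) * (μ + μ) ∎))

  -- Odd cycles: the sextic minorant and the power sums

  ι-nonNeg : ∀ k → 0# ≼ ι k
  ι-nonNeg k = ≼-trans (≼-reflexive (sym ι-0)) (ι-mono {0} {k} ℕ.z≤n)

  +-nonNeg : ∀ {x y} → 0# ≼ x → 0# ≼ y → 0# ≼ x + y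
  +-nonNeg 0≼x 0≼y = ≼-trans (≼-reflexive (sym (+-identityˡ 0#))) (+-mono-≼ 0≼x 0≼y)

  κ : ∀ {m} → ℕ → Polynomial m
  κ k = con (ℤ.+ k ℚ./ 1)

  ι-* : ∀ k l → ι (k ℕ.* l) ≈ ι k * ι l
  ι-* zero    l = trans ι-0 (sym (trans (*-congʳ ι-0) (zeroˡ _)))
  ι-* (suc k) l = trans (ι-+ l (k ℕ.* l)) (trans
    (+-cong (trans (sym (*-identityˡ _)) (*-congʳ (sym ι-1))) (ι-* k l))
    (trans (sym (distribʳ (ι l) (ι 1) (ι k))) (*-congʳ (sym (ι-+ 1 k)))))

  -- t (2t - 3)² (2 - t) (20t² + 100t + 147) ≥ 0: the even polynomial below lies
  -- under |x| on [-2, 2] and touches it at x = ±3/2 and x = ±2.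
  sextic-nonNeg : ∀ t → 0# ≼ t → t ≼ ι 2 →
    ι 3051 * (t * t) + ι 80 * ((t * t * t) * (t * t * t)) ≼ ι 2646 * t + ι 752 * ((t * t) * (t * t))
  sextic-nonNeg t 0≼t t≼2 = ≼-by-difference (≼-trans
    (*-nonNeg (*-nonNeg (*-nonNeg 0≼t (square-nonNeg (ι 2 * t - ι 3))) (difference t≼2))
      (+-nonNeg (+-nonNeg (*-nonNeg (ι-nonNeg 20) (square-nonNeg t)) (*-nonNeg (ι-nonNeg 100) 0≼t)) (ι-nonNeg 147)))
    (≼-reflexive (solve 1 (λ t →
      t :* ((κ 2 :* t :- κ 3) :* (κ 2 :* t :- κ 3)) :* (κ 2 :- t) :* (κ 20 :* (t :* t) :+ κ 100 :* t :+ κ 147)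
      := κ 2646 :* t :+ κ 752 :* ((t :* t) :* (t :* t)) :- (κ 3051 :* (t :* t) :+ κ 80 :* ((t :* t :* t) :* (t :* t :* t))))
      refl t)))

  sextic : ∀ x → x ≼ ι 2 → - x ≼ ι 2 →
    ι 3051 * (x * x) + ι 80 * ((x * x * x) * (x * x * x)) ≼ ι 2646 * ∣ x ∣ + ι 752 * ((x * x) * (x * x))
  sextic x x≼2 -x≼2 = ≼-stable (≼-sign x >>= λ where
    (inj₁ 0≼x) → return (≼-trans (sextic-nonNeg x 0≼x x≼2)
      (≼-reflexive (+-congʳ (*-congˡ (sym (∣∣-nonNeg 0≼x))))))
    (inj₂ x≼0) → return (≼-trans (≼-trans (≼-reflexive (invariant x))
      (sextic-nonNeg (- x) (≼-trans (≼-reflexive (sym Ring.-0#≈0#)) (neg-anti x≼0)) -x≼2))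
      (≼-reflexive (+-cong (*-congˡ (sym (∣∣-nonPos x≼0)))
        (solve 1 (λ x → κ 752 :* (((:- x) :* (:- x)) :* ((:- x) :* (:- x))) := κ 752 :* ((x :* x) :* (x :* x))) refl x)))))
    where
    invariant : ∀ x → ι 3051 * (x * x) + ι 80 * ((x * x * x) * (x * x * x)) ≈
      ι 3051 * (- x * - x) + ι 80 * ((- x * - x * - x) * (- x * - x * - x))
    invariant = solve 1 (λ x → κ 3051 :* (x :* x) :+ κ 80 :* ((x :* x :* x) :* (x :* x :* x))
      := κ 3051 :* ((:- x) :* (:- x)) :+ κ 80 :* (((:- x) :* (:- x) :* (:- x)) :* ((:- x) :* (:- x) :* (:- x)))) refl

  module Cycle (λs : Vector A n) (U : Matrix A n)
    (norm : ∀ k → ∑ (λ i → U k i * U k i) ≈ 1#)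
    (gram : ∀ i j → ∑ (λ k → U k i * U k j) ≈ δ i j)
    (π : Permutation′ n) (shift : ∀ k i → λs k * U k i ≈ U k (π ⟨$⟩ʳ i) + U k (π ⟨$⟩ˡ i))
    where

    private
      σ ρ : Fin n → Fin n
      σ = π ⟨$⟩ʳ_
      ρ = π ⟨$⟩ˡ_

    -- A formal combination of vertices read as a vector indexed by k. The columns of `U` are
    -- orthonormal, so for distinct vertices its squared norm is `weight`.
    combination : List (ℕ × Fin n) → Fin n → A
    combination []            k = ι 0
    combination ((c , i) ∷ l) k = ι c * U k i + combination l k

    weight : List (ℕ × Fin n) → ℕ
    weight []            = 0
    weight ((c , i) ∷ l) = c ℕ.* c ℕ.+ weight l

    orthogonal : ∀ {j} l → All (j ≢_) (map proj₂ l) → ∑ (λ k → U k j * combination l k) ≈ 0#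
    orthogonal []            []           = ∑-zero λ k → trans (*-congˡ ι-0) (zeroʳ _)
    orthogonal {j} ((c , i) ∷ l) (j≢i ∷ j∉l) = begin
      ∑ (λ k → U k j * (ι c * U k i + combination l k))
        ≈⟨ (∑-cong λ k → trans (solve 4 (λ u c v r → u :* (c :* v :+ r) := c :* (u :* v) :+ u :* r) refl (U k j) (ι c) (U k i) _)
             (+-congˡ (sym (*-identityˡ _)))) ⟩
      ∑ (λ k → ι c * (U k j * U k i) + 1# * (U k j * combination l k))
        ≈⟨ ∑-linear (ι c) 1# _ _ ⟩
      ι c * ∑ (λ k → U k j * U k i) + 1# * ∑ (λ k → U k j * combination l k)
        ≈⟨ +-cong (*-congˡ (trans (gram j i) (δ-distinct j≢i))) (*-congˡ (orthogonal l j∉l)) ⟩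
      ι c * 0# + 1# * 0#
        ≈⟨ trans (+-cong (zeroʳ _) (zeroʳ _)) (+-identityˡ _) ⟩
      0# ∎

    pythagoras : ∀ l → Unique (map proj₂ l) →
      ∑ (λ k → combination l k * combination l k) ≈ ι (weight l)
    pythagoras []            []           = trans (∑-zero λ k → trans (*-congʳ ι-0) (zeroˡ _)) (sym ι-0)
    pythagoras ((c , i) ∷ l) (i∉l ∷ uniq) = begin
      ∑ (λ k → (ι c * U k i + combination l k) * (ι c * U k i + combination l k))
        ≈⟨ (∑-cong λ k → trans (solve 3 (λ c u r → (c :* u :+ r) :* (c :* u :+ r)
               := (c :* c) :* (u :* u) :+ (r :* r :+ (c :+ c) :* (u :* r))) refl (ι c) (U k i) _)
             (+-congˡ (+-congʳ (sym (*-identityˡ _))))) ⟩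
      ∑ (λ k → ι c * ι c * (U k i * U k i) + (1# * (combination l k * combination l k) + (ι c + ι c) * (U k i * combination l k)))
        ≈⟨ trans (∑-+ _ _) (+-cong (∑-* _ _) (∑-linear 1# (ι c + ι c) _ _)) ⟩
      ι c * ι c * ∑ (λ k → U k i * U k i) +
        (1# * ∑ (λ k → combination l k * combination l k) + (ι c + ι c) * ∑ (λ k → U k i * combination l k))
        ≈⟨ +-cong (trans (*-congˡ (trans (gram i i) (δ-diagonal i))) (*-identityʳ _))
             (+-cong (trans (*-identityˡ _) (pythagoras l uniq)) (trans (*-congˡ (orthogonal l i∉l)) (zeroʳ _))) ⟩
      ι c * ι c + (ι (weight l) + 0#)
        ≈⟨ +-cong (sym (ι-* c c)) (+-identityʳ _) ⟩
      ι (c ℕ.* c) + ι (weight l)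
        ≈⟨ ι-+ (c ℕ.* c) (weight l) ⟨
      ι (c ℕ.* c ℕ.+ weight l) ∎

    -- The squared Frobenius norm of the matrix with eigenvectors `U k` and eigenvalues `f k`,
    -- computed once from the eigenvalues and once row by row; `l i` lists the entries of row i.
    moment : (f : Vector A n) (l : Fin n → List (ℕ × Fin n)) (w : ℕ) →
      (∀ k i → f k * U k i ≈ combination (l i) k) → (∀ i → Unique (map proj₂ (l i))) → (∀ i → weight (l i) ≡ w) →
      ∑ (λ k → f k * f k) ≈ ι (n ℕ.* w)
    moment f l w eigen uniq weighs = begin
      ∑ (λ k → f k * f k)
        ≈⟨ (∑-cong λ k → trans (sym (trans (*-congˡ (norm k)) (*-identityʳ _))) (trans (sym (∑-* _ _)) (∑-cong λ i →
             trans (solve 2 (λ f u → f :* f :* (u :* u) := (f :* u) :* (f :* u)) refl (f k) (U k i)) (*-cong (eigen k i) (eigen k i))))) ⟩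
      ∑ (λ k → ∑ λ i → combination (l i) k * combination (l i) k)
        ≈⟨ ∑-swap _ ⟩
      ∑ (λ i → ∑ λ k → combination (l i) k * combination (l i) k)
        ≈⟨ (∑-cong λ i → trans (pythagoras (l i) (uniq i)) (reflexive (≡.cong ι (weighs i)))) ⟩
      ∑ (λ i → ι w)
        ≈⟨ ∑-const {n} (ι w) ⟩
      ι n * ι w
        ≈⟨ ι-* n w ⟨
      ι (n ℕ.* w) ∎

    σ² ρ² σ³ ρ³ : Fin n → Fin n
    σ² = σ ∘ σ
    ρ² = ρ ∘ ρ
    σ³ = σ ∘ σ²
    ρ³ = ρ ∘ ρ²

    shift² : ∀ k i → λs k * λs k * U k i ≈ U k (σ² i) + U k i + (U k i + U k (ρ² i))
    shift² k i = begin
      λs k * λs k * U k i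
        ≈⟨ trans (*-assoc _ _ _) (*-congˡ (shift k i)) ⟩
      λs k * (U k (σ i) + U k (ρ i))
        ≈⟨ trans (distribˡ _ _ _) (+-cong (shift k (σ i)) (shift k (ρ i))) ⟩
      U k (σ² i) + U k (ρ (σ i)) + (U k (σ (ρ i)) + U k (ρ² i))
        ≈⟨ +-cong (+-congˡ (reflexive (≡.cong (U k) (inverseˡ π)))) (+-congʳ (reflexive (≡.cong (U k) (inverseʳ π)))) ⟩
      U k (σ² i) + U k i + (U k i + U k (ρ² i)) ∎

    shift³ : ∀ k i → λs k * λs k * λs k * U k i ≈
      (U k (σ³ i) + U k (σ i)) + (U k (σ i) + U k (ρ i)) + (U k (σ i) + U k (ρ i) + (U k (ρ i) + U k (ρ³ i)))
    shift³ k i = begin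
      λs k * λs k * λs k * U k i
        ≈⟨ solve 2 (λ x u → x :* x :* x :* u := x :* (x :* x :* u)) refl (λs k) (U k i) ⟩
      λs k * (λs k * λs k * U k i)
        ≈⟨ *-congˡ (shift² k i) ⟩
      λs k * (U k (σ² i) + U k i + (U k i + U k (ρ² i)))
        ≈⟨ solve 4 (λ x a u b → x :* (a :+ u :+ (u :+ b)) := x :* a :+ x :* u :+ (x :* u :+ x :* b)) refl (λs k) (U k (σ² i)) (U k i) (U k (ρ² i)) ⟩
      λs k * U k (σ² i) + λs k * U k i + (λs k * U k i + λs k * U k (ρ² i))
        ≈⟨ +-cong (+-cong (shift k (σ² i)) (shift k i)) (+-cong (shift k i) (shift k (ρ² i))) ⟩
      (U k (σ³ i) + U k (ρ (σ² i))) + (U k (σ i) + U k (ρ i)) + (U k (σ i) + U k (ρ i) + (U k (σ (ρ² i)) + U k (ρ³ i)))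
        ≈⟨ +-cong (+-congʳ (+-congˡ (reflexive (≡.cong (U k) (inverseˡ π)))))
             (+-congˡ (+-congʳ (reflexive (≡.cong (U k) (inverseʳ π))))) ⟩
      (U k (σ³ i) + U k (σ i)) + (U k (σ i) + U k (ρ i)) + (U k (σ i) + U k (ρ i) + (U k (ρ i) + U k (ρ³ i))) ∎

    -- The Rayleigh quotient of a unit eigenvector is a sum of two terms, each between -1 and 1.
    λ≼2 : ∀ k → λs k ≼ ι 2 × - λs k ≼ ι 2
    λ≼2 k = ≼-trans (≼-reflexive split) (≼-trans
              (+-mono-≼ (∑-permute-≼ (U k) π) (∑-permute-≼ (U k) (flip π))) (≼-reflexive total))
          , ≼-trans (≼-reflexive (trans (-‿cong split) (solve 2 (λ a b → :- (a :+ b) := :- a :+ :- b) refl _ _))) (≼-trans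
              (+-mono-≼ (∑-permute-≽ (U k) π) (∑-permute-≽ (U k) (flip π))) (≼-reflexive total))
      where
      total : ∑ (λ i → U k i * U k i) + ∑ (λ i → U k i * U k i) ≈ ι 2
      total = trans (+-cong (trans (norm k) (sym ι-1)) (trans (norm k) (sym ι-1))) (sym (ι-+ 1 1))
      split : λs k ≈ ∑ (λ i → U k i * U k (σ i)) + ∑ (λ i → U k i * U k (ρ i))
      split = begin
        λs k
          ≈⟨ trans (*-congˡ (norm k)) (*-identityʳ _) ⟨
        λs k * ∑ (λ i → U k i * U k i)
          ≈⟨ ∑-* _ _ ⟨
        ∑ (λ i → λs k * (U k i * U k i))
          ≈⟨ (∑-cong λ i → trans (solve 2 (λ x u → x :* (u :* u) := u :* (x :* u)) refl (λs k) (U k i))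
               (trans (*-congˡ (shift k i)) (distribˡ _ _ _))) ⟩
        ∑ (λ i → U k i * U k (σ i) + U k i * U k (ρ i))
          ≈⟨ ∑-+ _ _ ⟩
        ∑ (λ i → U k i * U k (σ i)) + ∑ (λ i → U k i * U k (ρ i)) ∎

    -- The rows of A, A² and A³ have entries 1 1, then 1 2 1, then 1 3 3 1, with sums of squares 2,
    -- 6 and 20, as long as their positions are distinct. Two positions in one row differ by a shift
    -- of 2, 4 or 6.
    module _ (σ²≢id : ∀ i → σ² i ≢ i) (σ⁴≢id : ∀ i → σ² (σ² i) ≢ i) (σ⁶≢id : ∀ i → σ³ (σ³ i) ≢ i) where

      private
        σ-injective : ∀ {i j} → σ i ≡ σ j → i ≡ j
        σ-injective eq = ≡.trans (≡.sym (inverseˡ π)) (≡.trans (≡.cong ρ eq) (inverseˡ π))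
        σ²ρ² : ∀ i → σ² (ρ² i) ≡ i
        σ²ρ² i = ≡.trans (≡.cong σ (inverseʳ π)) (inverseʳ π)
        σ³ρ³ : ∀ i → σ³ (ρ³ i) ≡ i
        σ³ρ³ i = ≡.trans (≡.cong σ (σ²ρ² (ρ i))) (inverseʳ π)

      moment₂ : ∑ (λ k → λs k * λs k) ≈ ι (n ℕ.* 2)
      moment₂ = moment λs (λ i → (1 , σ i) ∷ (1 , ρ i) ∷ []) 2
        (λ k i → trans (shift k i) (solve 2 (λ a b → a :+ b := κ 1 :* a :+ (κ 1 :* b :+ κ 0)) refl _ _))
        (λ i → ((λ σi≡ρi → σ²≢id i (≡.trans (≡.cong σ σi≡ρi) (inverseʳ π))) ∷ []) ∷ [] ∷ [])
        (λ _ → ≡.refl)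

      moment₄ : ∑ (λ k → (λs k * λs k) * (λs k * λs k)) ≈ ι (n ℕ.* 6)
      moment₄ = moment (λ k → λs k * λs k) (λ i → (1 , σ² i) ∷ (2 , i) ∷ (1 , ρ² i) ∷ []) 6
        (λ k i → trans (shift² k i) (solve 3 (λ a u b → a :+ u :+ (u :+ b)
          := κ 1 :* a :+ (κ 2 :* u :+ (κ 1 :* b :+ κ 0))) refl _ _ _))
        (λ i → (σ²≢id i ∷ (λ eq → σ⁴≢id i (≡.trans (≡.cong σ² eq) (σ²ρ² i))) ∷ [])
             ∷ ((λ eq → σ²≢id i (≡.trans (≡.cong σ² eq) (σ²ρ² i))) ∷ []) ∷ [] ∷ [])
        (λ _ → ≡.refl)

      moment₆ : ∑ (λ k → (λs k * λs k * λs k) * (λs k * λs k * λs k)) ≈ ι (n ℕ.* 20)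
      moment₆ = moment (λ k → λs k * λs k * λs k) (λ i → (1 , σ³ i) ∷ (3 , σ i) ∷ (3 , ρ i) ∷ (1 , ρ³ i) ∷ []) 20
        (λ k i → trans (shift³ k i) (solve 4 (λ a x y b → (a :+ x) :+ (x :+ y) :+ (x :+ y :+ (y :+ b))
          := κ 1 :* a :+ (κ 3 :* x :+ (κ 3 :* y :+ (κ 1 :* b :+ κ 0)))) refl _ _ _ _))
        (λ i → ((λ eq → σ²≢id i (σ-injective eq))
              ∷ (λ eq → σ⁴≢id i (≡.trans (≡.cong σ eq) (inverseʳ π)))
              ∷ (λ eq → σ⁶≢id i (≡.trans (≡.cong σ³ eq) (σ³ρ³ i))) ∷ [])
             ∷ ((λ eq → σ²≢id i (≡.trans (≡.cong σ eq) (inverseʳ π)))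
              ∷ (λ eq → σ⁴≢id i (≡.trans (≡.cong σ³ eq) (σ³ρ³ i))) ∷ [])
             ∷ ((λ eq → σ²≢id i (≡.trans (≡.sym (≡.cong σ² (inverseʳ π))) (≡.trans (≡.cong σ³ eq) (σ³ρ³ i)))) ∷ []) ∷ [] ∷ [])
        (λ _ → ≡.refl)

      energy : 5 ℕ.≤ n → ι (suc n) ≼ ∑ (λ k → ∣ λs k ∣)
      energy 5≤n = ≼-by-difference (≼-trans (*-nonNeg c-nonNeg (difference scaled))
        (≼-reflexive (solve 3 (λ x y z → con c :* (κ 2646 :* y :+ z :- (κ 2646 :* x :+ z)) := y :- x) refl (ι (suc n)) E (ι 752 * ι (n ℕ.* 6)))))
        where
        c : ℚ
        c = ℤ.+ 1 ℚ./ 2646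
        c-nonNeg : 0# ≼ ⟦ c ⟧
        c-nonNeg = ≼-trans (≼-reflexive (sym 0-homo)) (scalar-mono (ℚ.nonNegative⁻¹ c))
        E : A
        E = ∑ (λ k → ∣ λs k ∣)
        summed : ι 3051 * ι (n ℕ.* 2) + ι 80 * ι (n ℕ.* 20) ≼ ι 2646 * E + ι 752 * ι (n ℕ.* 6)
        summed = ≼-trans (≼-reflexive (sym (trans (∑-linear (ι 3051) (ι 80) _ _) (+-cong (*-congˡ moment₂) (*-congˡ moment₆)))))
          (≼-trans (∑-mono λ k → sextic (λs k) (proj₁ (λ≼2 k)) (proj₂ (λ≼2 k)))
            (≼-reflexive (trans (∑-linear (ι 2646) (ι 752) _ _) (+-congˡ (*-congˡ moment₄)))))
        d : ℕ
        d = proj₁ (ℕ.m≤n⇒∃[o]m+o≡n 5≤n)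
        n≈5+d : ι n ≈ ι 5 + ι d
        n≈5+d = trans (reflexive (≡.cong ι (≡.sym (proj₂ (ℕ.m≤n⇒∃[o]m+o≡n 5≤n))))) (ι-+ 5 d)
        -- 3051·2 - 752·6 + 80·20 = 3190, and 3190 n - 2646 (n + 1) = 544 d + 74 for n = 5 + d. At n
        -- = 4 the difference would be negative.
        counted : ι 2646 * ι (suc n) + ι 752 * ι (n ℕ.* 6) ≼ ι 3051 * ι (n ℕ.* 2) + ι 80 * ι (n ℕ.* 20)
        counted = ≼-by-difference (≼-trans (+-nonNeg (*-nonNeg (ι-nonNeg 544) (ι-nonNeg d)) (ι-nonNeg 74))
          (≼-reflexive (sym (trans
            (+-cong (+-cong (*-congˡ (times 2)) (*-congˡ (times 20)))
              (-‿cong (+-cong (*-congˡ (trans (ι-+ 1 n) (+-congˡ n≈5+d))) (*-congˡ (times 6)))))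
            (solve 1 (λ d → κ 3051 :* ((κ 5 :+ d) :* κ 2) :+ κ 80 :* ((κ 5 :+ d) :* κ 20)
              :- (κ 2646 :* (κ 1 :+ (κ 5 :+ d)) :+ κ 752 :* ((κ 5 :+ d) :* κ 6)) := κ 544 :* d :+ κ 74) refl (ι d))))))
          where
          times : ∀ j → ι (n ℕ.* j) ≈ (ι 5 + ι d) * ι j
          times j = trans (ι-* n j) (*-congʳ n≈5+d)
        scaled : ι 2646 * ι (suc n) + ι 752 * ι (n ℕ.* 6) ≼ ι 2646 * E + ι 752 * ι (n ℕ.* 6)
        scaled = ≼-trans counted summed

  -- Adjacency matrices of the three classes of graphs

  entry : Bool → A
  entry b = if b then 1# else 0#

  adjacencyMatrix : Graph n → Matrix A n
  adjacencyMatrix G i j = entry (does (adj? G i j))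

  entry-yes : {P : Set} (P? : Dec P) → P → entry (does P?) ≈ 1#
  entry-yes (yes _) _ = refl
  entry-yes (no ¬p) p = contradiction p ¬p

  entry-no : {P : Set} (P? : Dec P) → ¬ P → entry (does P?) ≈ 0#
  entry-no (yes p) ¬p = contradiction p ¬p
  entry-no (no _)  _  = refl

  ∑-entry : (b : Fin n → Bool) → ∑ (λ i → entry (b i)) ≈ ι (card b)
  ∑-entry {zero}  b = trans (∑-empty _) (sym ι-0)
  ∑-entry {suc n} b = trans (∑-suc _) (trans (+-cong (single (b zero)) (∑-entry (b ∘ suc))) (sym (ι-+ (indicator (b zero)) _)))
    where
    single : ∀ b → entry b ≈ ι (indicator b)
    single true  = sym ι-1
    single false = sym ι-0

  adjacency-symmetric : (G : Graph n) → ∀ i j → adjacencyMatrix G j i ≈ adjacencyMatrix G i j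
  adjacency-symmetric G i j with adj? G i j
  ... | yes e = entry-yes (adj? G j i) (Graph.symm G e)
  ... | no ¬e = entry-no (adj? G j i) (¬e ∘ Graph.symm G)

  module _ (G : Graph n) {λs : Vector A n} {Q : Matrix A n} (basis : Eigenbasis (adjacencyMatrix G) λs Q) where

    private
      energy : A
      energy = ∑ (λ k → ∣ λs k ∣)

    bipartite-energy : IsBipartite G → ι (2 ℕ.* τ G) ≼ energy
    bipartite-energy bip = let π , bound = bipartite-matching G bip in
      ≼-trans (ι-mono bound) (≼-trans (≼-reflexive (sym (∑-entry λ i → does (adj? G i (π ⟨$⟩ʳ i)))))
        (permutation-bound basis π))

  complete-energy : (G : Graph n) {λs : Vector A n} {Q : Matrix A n} →
    Eigenbasis (adjacencyMatrix G) λs Q → IsComplete G → ∑ (λ k → ∣ λs k ∣) ≈ ι (2 ℕ.* τ G)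
  -- Without vertices the empty set is a cover, so τ is 0, and so is the empty sum.
  complete-energy {zero}  G basis complete = trans (∑-empty _) (trans (sym ι-0)
    (reflexive (≡.cong ι (≡.cong (2 ℕ.*_) (≡.sym (ℕ.n≤0⇒n≡0 (τ-minimal G Vec.[] λ ())))))))
  complete-energy {suc m} G {λs} {Q} basis complete =
    trans (Complete.energy entries basis) (reflexive (≡.cong (λ t → ι (2 ℕ.* t)) (≡.sym (τ-complete G complete))))
    where
    entries : ∀ i j → adjacencyMatrix G i j ≈ 1# - δ i j
    entries i j = by (i Fin.≟ j)
      where
      open import Algebra.Properties.Ring ring using (-0#≈0#)
      by : Dec (i ≡ j) → adjacencyMatrix G i j ≈ 1# - δ i j
      by (yes ≡.refl) = trans (entry-no (adj? G i i) (Graph.irrefl G i))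
        (sym (x≈y⇒x-y≈0 (sym (δ-diagonal i))))
      by (no i≢j)     = trans (entry-yes (adj? G i j) (complete i j i≢j))
        (sym (trans (+-congˡ (trans (-‿cong (δ-distinct i≢j)) -0#≈0#)) (+-identityʳ 1#)))

  module CycleEnergy (G : Graph n) (3≤n : 3 ℕ.≤ n) (v : Permutation′ n)
    (adjacent : ∀ i j → Adj G (v ⟨$⟩ʳ i) (v ⟨$⟩ʳ j) ⇔ (Next i j ⊎ Next j i))
    {λs : Vector A n} {Q : Matrix A n} (basis : Eigenbasis (adjacencyMatrix G) λs Q) where

    private
      module C = CycleGraph G 3≤n v adjacent

    even-energy : even n ≡ true → ι (2 ℕ.* τ G) ≼ ∑ (λ k → ∣ λs k ∣)
    even-energy parity = ≼-trans
      (ι-mono (≡.subst (2 ℕ.* τ G ℕ.≤_) (2*⌈n/2⌉-even n parity) C.τ≤))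
      (≼-trans (≼-reflexive (sym all-adjacent)) (permutation-bound basis C.rotation))
      where
      all-adjacent : ∑ (λ w → adjacencyMatrix G w (C.rotation ⟨$⟩ʳ w)) ≈ ι n
      all-adjacent = trans (∑-cong λ w → entry-yes (adj? G w (C.rotation ⟨$⟩ʳ w)) (C.rotation-adjacent w))
        (trans (∑-const {n} 1#) (*-identityʳ _))

    module _ (parity : even n ≡ false) (n≢3 : n ≢ 3) where

      4≤n : 4 ℕ.≤ n
      4≤n = ℕ.≤∧≢⇒< 3≤n (n≢3 ∘ ≡.sym)
      odd-≢ : ∀ m → even m ≡ true → m ≢ n
      odd-≢ m even-m ≡.refl with () ← ≡.trans (≡.sym even-m) parity
      5≤n : 5 ℕ.≤ n
      5≤n = ℕ.≤∧≢⇒< 4≤n (odd-≢ 4 ≡.refl)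
      2∤ : ¬ n ∣ 2
      2∤ d = ℕ.<⇒≱ 3≤n (∣⇒≤ d)
      4∤ : ¬ n ∣ 4
      4∤ d = ℕ.<⇒≱ 5≤n (∣⇒≤ d)
      6∤ : ¬ n ∣ 6
      6∤ d with ℕ.m≤n⇒m<n∨m≡n (∣⇒≤ d)
      ... | inj₂ n≡6 = odd-≢ 6 ≡.refl (≡.sym n≡6)
      ... | inj₁ n<6 = from-no (5 ∣? 6) (≡.subst (_∣ 6) (ℕ.≤-antisym (ℕ.≤-pred n<6) 5≤n) d)
      -- The eigenvectors with coordinates listed along the cycle, where the adjacency matrix
      -- becomes the sum of a rotation and its inverse.
      U : Matrix A n
      U k i = Q k (v ⟨$⟩ʳ i)
      norm′ : ∀ k → ∑ (λ i → U k i * U k i) ≈ 1#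
      norm′ k = trans (sym (∑-permute (λ i → Q k i * Q k i) v)) (norm basis k)
      gram : ∀ i j → ∑ (λ k → U k i * U k j) ≈ δ i j
      gram i j = trans (orthonormal basis (v ⟨$⟩ʳ i) (v ⟨$⟩ʳ j)) (by (i Fin.≟ j))
        where
        by : Dec (i ≡ j) → δ (v ⟨$⟩ʳ i) (v ⟨$⟩ʳ j) ≈ δ i j
        by (yes ≡.refl) = trans (δ-diagonal (v ⟨$⟩ʳ i)) (sym (δ-diagonal i))
        by (no i≢j)     = trans (δ-distinct λ eq → i≢j (≡.trans (≡.sym (inverseˡ v)) (≡.trans (≡.cong (v ⟨$⟩ˡ_) eq) (inverseˡ v))))
          (sym (δ-distinct i≢j))
      -- Otherwise the sum of Kronecker deltas in `entries` would take the value 2.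
      σ≢ρ : ∀ i → C.σ i ≢ C.ρ i
      σ≢ρ i eq = 2∤ (C.σ²-fixed i (≡.trans (≡.cong C.σ eq) (inverseʳ C.next)))
      entries : ∀ i j → adjacencyMatrix G (v ⟨$⟩ʳ i) (v ⟨$⟩ʳ j) ≈ δ (C.σ i) j + δ (C.ρ i) j
      entries i j = by (j Fin.≟ C.σ i) (j Fin.≟ C.ρ i)
        where
        by : Dec (j ≡ C.σ i) → Dec (j ≡ C.ρ i) →
          adjacencyMatrix G (v ⟨$⟩ʳ i) (v ⟨$⟩ʳ j) ≈ δ (C.σ i) j + δ (C.ρ i) j
        by (yes ≡.refl) _ = trans (entry-yes (adj? G _ _) (C.adjacent-σ i))
          (sym (trans (+-cong (δ-diagonal (C.σ i)) (δ-distinct (σ≢ρ i ∘ ≡.sym))) (+-identityʳ 1#)))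
        by (no _) (yes ≡.refl) = trans (entry-yes (adj? G _ _) (C.adjacent-ρ i))
          (sym (trans (+-cong (δ-distinct (σ≢ρ i)) (δ-diagonal (C.ρ i))) (+-identityˡ 1#)))
        by (no j≢σi) (no j≢ρi) = trans (entry-no (adj? G _ _) λ e → neither (C.adjacent⇒ i j e))
          (sym (trans (+-cong (δ-distinct (j≢σi ∘ ≡.sym)) (δ-distinct (j≢ρi ∘ ≡.sym))) (+-identityˡ 0#)))
          where
          neither : ¬ (j ≡ C.σ i ⊎ j ≡ C.ρ i)
          neither (inj₁ j≡σi) = j≢σi j≡σi
          neither (inj₂ j≡ρi) = j≢ρi j≡ρi
      shift : ∀ k i → λs k * U k i ≈ U k (C.σ i) + U k (C.ρ i)
      shift k i = begin
        λs k * U k i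
          ≈⟨ proj₂ basis k (v ⟨$⟩ʳ i) ⟨
        ∑ (λ w → adjacencyMatrix G (v ⟨$⟩ʳ i) w * Q k w)
          ≈⟨ ∑-permute _ v ⟩
        ∑ (λ j → adjacencyMatrix G (v ⟨$⟩ʳ i) (v ⟨$⟩ʳ j) * U k j)
          ≈⟨ (∑-cong λ j → trans (*-congʳ (entries i j)) (distribʳ _ _ _)) ⟩
        ∑ (λ j → δ (C.σ i) j * U k j + δ (C.ρ i) j * U k j)
          ≈⟨ trans (∑-+ _ _) (+-cong (δ-▹ (U k) (C.σ i)) (δ-▹ (U k) (C.ρ i))) ⟩
        U k (C.σ i) + U k (C.ρ i) ∎

      odd-energy : ι (2 ℕ.* τ G) ≼ ∑ (λ k → ∣ λs k ∣)
      odd-energy = ≼-trans (ι-mono (≡.subst (2 ℕ.* τ G ℕ.≤_) (2*⌈n/2⌉-odd n parity) C.τ≤))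
        (Cycle.energy λs U norm′ gram C.next shift
          (λ i → 2∤ ∘ C.σ²-fixed i) (λ i → 4∤ ∘ C.σ⁴-fixed i) (λ i → 6∤ ∘ C.σ⁶-fixed i) 5≤n)

  cycle-energy : (G : Graph n) {λs : Vector A n} {Q : Matrix A n} →
    Eigenbasis (adjacencyMatrix G) λs Q → IsCycle G → ι (2 ℕ.* τ G) ≼ ∑ (λ k → ∣ λs k ∣)
  cycle-energy {n} G {λs} basis cycle@(3≤n , v , adjacent) = by (even n) ≡.refl (n ℕ.≟ 3)
    where
    open CycleEnergy G 3≤n v adjacent basis
    by : ∀ b → even n ≡ b → Dec (n ≡ 3) → ι (2 ℕ.* τ G) ≼ ∑ (λ k → ∣ λs k ∣)
    by true  parity _         = even-energy parity
    by false parity (yes n≡3) = ≼-reflexive (sym (complete-energy G basis (triangle-complete G n≡3 cycle)))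
    by false parity (no n≢3)  = odd-energy parity n≢3

  eigenbasis : (G : Graph n) (λs : Vector A n) →
    (∀ x → LinearAlgebra.det rawRing (characteristicMatrix (adjacencyMatrix G) x) ≈ LinearAlgebra.∏ rawRing λ i → x - λs i) →
    ¬ ¬ ∃ (Eigenbasis (adjacencyMatrix G) λs)
  eigenbasis G λs spec = spectral *-cancel unitVector ι ι-distinct
    (adjacencyMatrix G) (adjacency-symmetric G) λs λ x → trans (reflexive (det-unfold _)) (spec x)

  module _ (G : Graph n) (λs : Vector A n) (E : A) (E≈ : E ≈ LinearAlgebra.∑ rawRing (λ i → ∣ λs i ∣))
    (spec : ∀ x → LinearAlgebra.det rawRing (characteristicMatrix (adjacencyMatrix G) x) ≈ LinearAlgebra.∏ rawRing λ i → x - λs i)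
    where

    private
      E≈∑ : E ≈ ∑ (λ i → ∣ λs i ∣)
      E≈∑ = trans E≈ (reflexive (≡.sym (∑-unfold _)))

    complete-case : IsComplete G → E ≈ ι (2 ℕ.* τ G)
    complete-case complete = ≈-stable (eigenbasis G λs spec >>= λ (Q , basis) →
      return (trans E≈∑ (complete-energy G basis complete)))

    bipartite-case : IsBipartite G → ι (2 ℕ.* τ G) ≼ E
    bipartite-case bip = ≼-stable (eigenbasis G λs spec >>= λ (Q , basis) →
      return (≼-trans (bipartite-energy G basis bip) (≼-reflexive (sym E≈∑))))

    cycle-case : IsCycle G → ι (2 ℕ.* τ G) ≼ E
    cycle-case cycle = ≼-stable (eigenbasis G λs spec >>= λ (Q , basis) →
      return (≼-trans (cycle-energy G basis cycle) (≼-reflexive (sym E≈∑))))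

-- The Cauchy reals: ring laws, order and stability

module Reals where

  open Defs
  open +-*-Solver using (solve; con; _:=_; _:+_; _:-_; _:*_; :-_)

  <⇒≱ : ∀ {p q} → p ℚ.< q → ¬ q ℚ.≤ p
  <⇒≱ p<q q≤p = ℚ.<-irrefl ≡.refl (ℚ.<-≤-trans p<q q≤p)

  *-positive : ∀ {p q} → 0ℚ ℚ.< p → 0ℚ ℚ.< q → 0ℚ ℚ.< p ℚ.* q
  *-positive {p} {q} p>0 q>0 =
    ℚ.positive⁻¹ (p ℚ.* q) {{ℚ.pos*pos⇒pos p {{ℚ.positive p>0}} q {{ℚ.positive q>0}}}}

  *-nonNegative : ∀ {p q} → 0ℚ ℚ.≤ p → 0ℚ ℚ.≤ q → 0ℚ ℚ.≤ p ℚ.* q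
  *-nonNegative {p} {q} p≥0 q≥0 = ℚ.nonNegative⁻¹ (p ℚ.* q)
    {{ℚ.nonNeg*nonNeg⇒nonNeg p {{ℚ.nonNegative p≥0}} q {{ℚ.nonNegative q≥0}}}}

  ℚ-*-mono-≤ : ∀ {p q r s} → 0ℚ ℚ.≤ p → 0ℚ ℚ.≤ s → p ℚ.≤ q → r ℚ.≤ s → p ℚ.* r ℚ.≤ q ℚ.* s
  ℚ-*-mono-≤ {p} {q} {r} {s} p≥0 s≥0 p≤q r≤s = ℚ.≤-trans
    (ℚ.*-monoˡ-≤-nonNeg p {{ℚ.nonNegative p≥0}} r≤s)
    (ℚ.*-monoʳ-≤-nonNeg s {{ℚ.nonNegative s≥0}} p≤q)

  square-nonNegative : ∀ p → 0ℚ ℚ.≤ p ℚ.* p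
  square-nonNegative p with ℚ.≤-total 0ℚ p
  ... | inj₁ p≥0 = *-nonNegative p≥0 p≥0
  ... | inj₂ p≤0 = ℚ.nonNegative⁻¹ (p ℚ.* p)
    {{ℚ.nonPos*nonPos⇒nonPos p {{ℚ.nonPositive p≤0}} p {{ℚ.nonPositive p≤0}}}}

  p≤∣p∣ : ∀ p → p ℚ.≤ ℚ.∣ p ∣
  p≤∣p∣ p with ℚ.≤-total 0ℚ p
  ... | inj₁ p≥0 = ℚ.≤-reflexive (≡.sym (ℚ.0≤p⇒∣p∣≡p p≥0))
  ... | inj₂ p≤0 = ℚ.≤-trans p≤0 (ℚ.0≤∣p∣ p)

  ∣p∣-least : ∀ {p b} → p ℚ.< b → ℚ.- p ℚ.< b → ℚ.∣ p ∣ ℚ.< b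
  ∣p∣-least {p} {b} p<b -p<b with ℚ.∣p∣≡p∨∣p∣≡-p p
  ... | inj₁ eq = ≡.subst (ℚ._< b) (≡.sym eq) p<b
  ... | inj₂ eq = ≡.subst (ℚ._< b) (≡.sym eq) -p<b

  p-q<r⇒p<q+r : ∀ {p q r} → p ℚ.- q ℚ.< r → p ℚ.< q ℚ.+ r
  p-q<r⇒p<q+r {p} {q} p-q<r = ≡.subst (ℚ._< _)
    (solve 2 (λ p q → q :+ (p :- q) := p) ≡.refl p q) (ℚ.+-monoʳ-< q p-q<r)

  p<q+r⇒p-q<r : ∀ {p q r} → p ℚ.< q ℚ.+ r → p ℚ.- q ℚ.< r
  p<q+r⇒p-q<r {p} {q} {r} p<q+r = ≡.subst (_ ℚ.<_)
    (solve 2 (λ q r → (q :+ r) :- q := r) ≡.refl q r) (ℚ.+-monoˡ-< (ℚ.- q) p<q+r)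

  +-cancelʳ-< : ∀ r {p q} → p ℚ.+ r ℚ.< q ℚ.+ r → p ℚ.< q
  +-cancelʳ-< r {p} {q} p+r<q+r = ≡.subst₂ ℚ._<_
    (solve 2 (λ p r → (p :+ r) :- r := p) ≡.refl p r) (solve 2 (λ p r → (p :+ r) :- r := p) ≡.refl q r)
    (ℚ.+-monoˡ-< (ℚ.- r) p+r<q+r)

  ∣p∣≤∣p-q∣+∣q∣ : ∀ p q → ℚ.∣ p ∣ ℚ.≤ ℚ.∣ p ℚ.- q ∣ ℚ.+ ℚ.∣ q ∣
  ∣p∣≤∣p-q∣+∣q∣ p q = ≡.subst (λ z → ℚ.∣ z ∣ ℚ.≤ ℚ.∣ p ℚ.- q ∣ ℚ.+ ℚ.∣ q ∣)
    (solve 2 (λ p q → (p :- q) :+ q := p) ≡.refl p q) (ℚ.∣p+q∣≤∣p∣+∣q∣ (p ℚ.- q) q)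

  half : ℚ → ℚ
  half ε = ℚ.½ ℚ.* ε

  half>0 : ∀ {ε} → 0ℚ ℚ.< ε → 0ℚ ℚ.< half ε
  half>0 = *-positive (ℚ.positive⁻¹ ℚ.½)

  half+half : ∀ ε → half ε ℚ.+ half ε ≡ ε
  half+half ε = ≡.trans (≡.sym (ℚ.*-distribʳ-+ ε ℚ.½ ℚ.½)) (ℚ.*-identityˡ ε)

  quotient : ∀ {K} → 0ℚ ℚ.< K → ∀ {ε} → 0ℚ ℚ.< ε → ∃[ δ ] 0ℚ ℚ.< δ × K ℚ.* δ ≡ ε
  quotient {K} K>0 {ε} ε>0 = ℚ.1/ K ℚ.* ε
    , *-positive (ℚ.positive⁻¹ (ℚ.1/ K) {{ℚ.1/pos⇒pos K}}) ε>0
    , ≡.trans (≡.sym (ℚ.*-assoc K (ℚ.1/ K) ε)) (≡.trans (≡.cong (ℚ._* ε) (ℚ.*-inverseʳ K)) (ℚ.*-identityˡ ε))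
    where
    instance
      K-pos : ℚ.Positive K
      K-pos = ℚ.positive K>0
      K-nonZero : ℚ.NonZero K
      K-nonZero = ℚ.pos⇒nonZero K

  archimedean : ∀ q → ∃[ k ] q ℚ.≤ mkℚ (ℤ.+ k) 0 (Coprime.sym (Coprime.1-coprimeTo k))
  archimedean (mkℚ (ℤ.+ k)    d _) = k , *≤* (≡.subst₂ ℤ._≤_
    (≡.sym (ℤ.*-identityʳ (ℤ.+ k))) (ℤ.pos-* k (suc d)) (ℤ.+≤+ (ℕ.m≤m*n k (suc d))))
  archimedean (mkℚ ℤ.-[1+ k ] d _) = 0 , *≤* ℤ.-≤+

  recip : ℕ → ℚ
  recip n = mkℚ (ℤ.+ 1) n (Coprime.1-coprimeTo (suc n))

  recip-small : ∀ ε → 0ℚ ℚ.< ε → ∃[ N ] ∀ n → N ℕ.≤ n → recip n ℚ.≤ ε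
  recip-small (mkℚ ℤ.+[1+ k ] d _) _ = d , λ n d≤n → *≤* (≡.subst₂ ℤ._≤_
    (ℤ.pos-* 1 (suc d)) (ℤ.pos-* (suc k) (suc n))
    (ℤ.+≤+ (ℕ.≤-trans (ℕ.≤-reflexive (ℕ.*-identityˡ (suc d)))
      (ℕ.≤-trans (ℕ.s≤s d≤n) (ℕ.m≤n*m (suc n) (suc k))))))
  recip-small (mkℚ (ℤ.+ 0) d _) ε>0 = contradiction (ℚ.drop-*<* ε>0) λ { (ℤ.+<+ ()) }
  recip-small (mkℚ ℤ.-[1+ k ] d _) ε>0 = contradiction (ℚ.drop-*<* ε>0) λ ()

  ≈-refl : ∀ {x} → x ≈ x
  ≈-refl {x} ε ε>0 = 0 , λ n _ → ≡.subst (λ z → ℚ.∣ z ∣ ℚ.< ε) (≡.sym (ℚ.+-inverseʳ (seq x n))) ε>0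

  pointwise : ∀ x y → (∀ n → seq x n ≡ seq y n) → x ≈ y
  pointwise x y x≡y ε ε>0 = 0 , λ n _ →
    ≡.subst (λ z → ℚ.∣ seq x n ℚ.- z ∣ ℚ.< ε) (x≡y n) (proj₂ (≈-refl {x} ε ε>0) n ℕ.z≤n)

  ≈-sym : ∀ {x y} → x ≈ y → y ≈ x
  ≈-sym {x} {y} x≈y ε ε>0 with x≈y ε ε>0
  ... | N , close = N , λ n N≤n → ≡.subst (ℚ._< ε)
    (≡.trans (≡.sym (ℚ.∣-p∣≡∣p∣ (seq x n ℚ.- seq y n)))
      (≡.cong ℚ.∣_∣ (solve 2 (λ p q → :- (p :- q) := q :- p) ≡.refl (seq x n) (seq y n))))
    (close n N≤n)

  Null : (ℕ → ℚ) → Set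
  Null f = ∀ ε → 0ℚ ℚ.< ε → ∃[ N ] ∀ n → N ℕ.≤ n → ℚ.∣ f n ∣ ℚ.< ε

  +-null : ∀ {f g : ℕ → ℚ} → Null f → Null g → Null (λ n → f n ℚ.+ g n)
  +-null {f} {g} f-small g-small ε ε>0 with f-small _ (half>0 ε>0) | g-small _ (half>0 ε>0)
  ... | N , hN | M , hM = N ℕ.⊔ M , λ n n≥ → ℚ.≤-<-trans (ℚ.∣p+q∣≤∣p∣+∣q∣ (f n) (g n))
    (≡.subst (_ ℚ.<_) (half+half ε)
      (ℚ.+-mono-< (hN n (ℕ.m⊔n≤o⇒m≤o N M n≥)) (hM n (ℕ.m⊔n≤o⇒n≤o N M n≥))))

  Null-resp : ∀ {f g : ℕ → ℚ} → (∀ n → f n ≡ g n) → Null f → Null g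
  Null-resp f≡g f-small ε ε>0 with f-small ε ε>0
  ... | N , hN = N , λ n n≥ → ≡.subst (λ z → ℚ.∣ z ∣ ℚ.< ε) (f≡g n) (hN n n≥)

  ≈-trans : ∀ {x y z} → x ≈ y → y ≈ z → x ≈ z
  ≈-trans {x} {y} {z} x≈y y≈z = Null-resp
    (λ n → solve 3 (λ p q r → (p :- q) :+ (q :- r) := p :- r) ≡.refl (seq x n) (seq y n) (seq z n))
    (+-null {λ n → seq x n ℚ.- seq y n} {λ n → seq y n ℚ.- seq z n} x≈y y≈z)

  +-cong : ∀ {x y u v} → x ≈ y → u ≈ v → x + u ≈ y + v
  +-cong {x} {y} {u} {v} x≈y u≈v = Null-resp
    (λ n → solve 4 (λ p q r s → (p :- q) :+ (r :- s) := (p :+ r) :- (q :+ s)) ≡.refl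
      (seq x n) (seq y n) (seq u n) (seq v n))
    (+-null {λ n → seq x n ℚ.- seq y n} {λ n → seq u n ℚ.- seq v n} x≈y u≈v)

  -‿cong : ∀ {x y} → x ≈ y → - x ≈ - y
  -‿cong {x} {y} x≈y = Null-resp
    (λ n → solve 2 (λ p q → q :- p := (:- p) :- (:- q)) ≡.refl (seq x n) (seq y n)) (≈-sym {x} {y} x≈y)

  bounded : ∀ x → ∃[ K ] 0ℚ ℚ.< K × ∃[ N ] ∀ n → N ℕ.≤ n → ℚ.∣ seq x n ∣ ℚ.≤ K
  bounded x with cauchy x 1ℚ (ℚ.positive⁻¹ 1ℚ)
  ... | N , close = 1ℚ ℚ.+ ℚ.∣ seq x N ∣
    , ℚ.+-mono-<-≤ (ℚ.positive⁻¹ 1ℚ) (ℚ.0≤∣p∣ (seq x N))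
    , N , λ n N≤n → ℚ.≤-trans (∣p∣≤∣p-q∣+∣q∣ (seq x n) (seq x N))
        (ℚ.+-monoˡ-≤ ℚ.∣ seq x N ∣ (ℚ.<⇒≤ (close n N N≤n ℕ.≤-refl)))

  *-null : ∀ x {f : ℕ → ℚ} →
    Null f →
    Null (λ n → seq x n ℚ.* f n)
  *-null x {f} f-small ε ε>0 =
    let K , K>0 , N , hN = bounded x
        δ , δ>0 , Kδ≡ε = quotient K>0 ε>0
        M , hM = f-small δ δ>0
    in N ℕ.⊔ M , λ n n≥ → begin-strict
      ℚ.∣ seq x n ℚ.* f n ∣          ≡⟨ ℚ.∣p*q∣≡∣p∣*∣q∣ (seq x n) (f n) ⟩
      ℚ.∣ seq x n ∣ ℚ.* ℚ.∣ f n ∣    ≤⟨ ℚ.*-monoʳ-≤-nonNeg ℚ.∣ f n ∣ {{ℚ.∣-∣-nonNeg (f n)}} (hN n (ℕ.m⊔n≤o⇒m≤o N M n≥)) ⟩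
      K ℚ.* ℚ.∣ f n ∣                <⟨ ℚ.*-monoʳ-<-pos K {{ℚ.positive K>0}} (hM n (ℕ.m⊔n≤o⇒n≤o N M n≥)) ⟩
      K ℚ.* δ                        ≡⟨ Kδ≡ε ⟩
      ε                              ∎
    where open ℚ.≤-Reasoning

  *-cong : ∀ {x y u v} → x ≈ y → u ≈ v → x * u ≈ y * v
  *-cong {x} {y} {u} {v} x≈y u≈v = Null-resp
    (λ n → solve 4 (λ p q r s → p :* (r :- s) :+ s :* (p :- q) := p :* r :- q :* s) ≡.refl
      (seq x n) (seq y n) (seq u n) (seq v n))
    (+-null {λ n → seq x n ℚ.* (seq u n ℚ.- seq v n)} {λ n → seq v n ℚ.* (seq x n ℚ.- seq y n)}
      (*-null x u≈v) (*-null v x≈y))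

  ℝ-commutativeRing : CommutativeRing 0ℓ 0ℓ
  ℝ-commutativeRing = record
    { Carrier = ℝ ; _≈_ = _≈_ ; _+_ = _+_ ; _*_ = _*_ ; -_ = -_ ; 0# = 0ℝ ; 1# = 1ℝ
    ; isCommutativeRing = record
      { isRing = record
        { +-isAbelianGroup = record
          { isGroup = record
            { isMonoid = record
              { isSemigroup = record
                { isMagma = record
                  { isEquivalence = record
                    { refl  = λ {x} → ≈-refl {x}
                    ; sym   = λ {x} {y} → ≈-sym {x} {y}
                    ; trans = λ {x} {y} {z} → ≈-trans {x} {y} {z} }
                  ; ∙-cong = λ {x} {y} {u} {v} → +-cong {x} {y} {u} {v} }
                ; assoc = λ x y z → pointwise (x + y + z) (x + (y + z)) λ n → ℚ.+-assoc (seq x n) (seq y n) (seq z n) }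
              ; identity = (λ x → pointwise (0ℝ + x) (x) λ n → ℚ.+-identityˡ (seq x n))
                         , (λ x → pointwise (x + 0ℝ) (x) λ n → ℚ.+-identityʳ (seq x n)) }
            ; inverse = (λ x → pointwise (- x + x) (0ℝ) λ n → ℚ.+-inverseˡ (seq x n))
                      , (λ x → pointwise (x - x) (0ℝ) λ n → ℚ.+-inverseʳ (seq x n))
            ; ⁻¹-cong = λ {x} {y} → -‿cong {x} {y} }
          ; comm = λ x y → pointwise (x + y) (y + x) λ n → ℚ.+-comm (seq x n) (seq y n) }
        ; *-cong = λ {x} {y} {u} {v} → *-cong {x} {y} {u} {v}
        ; *-assoc = λ x y z → pointwise (x * y * z) (x * (y * z)) λ n → ℚ.*-assoc (seq x n) (seq y n) (seq z n)
        ; *-identity = (λ x → pointwise (1ℝ * x) (x) λ n → ℚ.*-identityˡ (seq x n))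
                     , (λ x → pointwise (x * 1ℝ) (x) λ n → ℚ.*-identityʳ (seq x n))
        ; distrib = (λ x y z → pointwise (x * (y + z)) (x * y + x * z) λ n → ℚ.*-distribˡ-+ (seq x n) (seq y n) (seq z n))
                  , (λ x y z → pointwise ((y + z) * x) (y * x + z * x) λ n → ℚ.*-distribʳ-+ (seq x n) (seq y n) (seq z n)) }
      ; *-comm = λ x y → pointwise (x * y) (y * x) λ n → ℚ.*-comm (seq x n) (seq y n) } }

  scalar : ℚ.+-*-rawRing -Raw-AlmostCommutative⟶ fromCommutativeRing ℝ-commutativeRing
  scalar = record
    { ⟦_⟧    = fromℚ
    ; +-homo = λ p q → ≈-refl {fromℚ p + fromℚ q}
    ; *-homo = λ p q → ≈-refl {fromℚ p * fromℚ q}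
    ; -‿homo = λ p → ≈-refl { - fromℚ p}
    ; 0-homo = ≈-refl {0ℝ}
    ; 1-homo = ≈-refl {1ℝ}
    }

  Apart : ℝ → Set
  Apart x = ∃[ δ ] 0ℚ ℚ.< δ × ∃[ N ] ∀ n → N ℕ.≤ n → δ ℚ.≤ ℚ.∣ seq x n ∣

  -- One rational comparison decides: from index N on the terms stay within ε/4 of term N, so
  -- testing |x| at N against ε/2 leaves a margin on both sides.
  dichotomy : ∀ x ε → 0ℚ ℚ.< ε →
    (∃[ N ] ∀ n → N ℕ.≤ n → ℚ.∣ seq x n ∣ ℚ.< ε) ⊎ Apart x
  dichotomy x ε ε>0 with cauchy x (half (half ε)) (half>0 (half>0 ε>0))
  ... | N , close with ℚ.∣ seq x N ∣ ℚ.<? half ε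
  ... | yes small = inj₁ (N , λ n N≤n → begin-strict
    ℚ.∣ seq x n ∣                                    ≤⟨ ∣p∣≤∣p-q∣+∣q∣ (seq x n) (seq x N) ⟩
    ℚ.∣ seq x n ℚ.- seq x N ∣ ℚ.+ ℚ.∣ seq x N ∣      <⟨ ℚ.+-mono-< (ℚ.<-trans (close n N N≤n ℕ.≤-refl) q<h) small ⟩
    half ε ℚ.+ half ε                                ≡⟨ half+half ε ⟩
    ε                                                ∎)
    where
    open ℚ.≤-Reasoning
    q<h : half (half ε) ℚ.< half ε
    q<h = ≡.subst₂ ℚ._<_ (ℚ.+-identityʳ _) (half+half (half ε)) (ℚ.+-monoʳ-< (half (half ε)) (half>0 (half>0 ε>0)))
  ... | no  large = inj₂ (half (half ε) , half>0 (half>0 ε>0) , N , λ n N≤n → ℚ.≮⇒≥ λ x<q → large (begin-strict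
    ℚ.∣ seq x N ∣                                    ≤⟨ ∣p∣≤∣p-q∣+∣q∣ (seq x N) (seq x n) ⟩
    ℚ.∣ seq x N ℚ.- seq x n ∣ ℚ.+ ℚ.∣ seq x n ∣      <⟨ ℚ.+-mono-< (close N n ℕ.≤-refl N≤n) x<q ⟩
    half (half ε) ℚ.+ half (half ε)                  ≡⟨ half+half (half ε) ⟩
    half ε                                           ∎))
    where open ℚ.≤-Reasoning

  null⇒≈0 : ∀ x → Null (seq x) → x ≈ 0ℝ
  null⇒≈0 x = Null-resp λ n → ≡.sym (ℚ.+-identityʳ (seq x n))

  ≈0⇒null : ∀ x → x ≈ 0ℝ → Null (seq x)
  ≈0⇒null x = Null-resp λ n → ℚ.+-identityʳ (seq x n)

  apart⇒≉0 : ∀ x → Apart x → ¬ x ≈ 0ℝ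
  apart⇒≉0 x (δ , δ>0 , N , large) x≈0 with ≈0⇒null x x≈0 δ δ>0
  ... | M , small = <⇒≱ (small (N ℕ.⊔ M) (ℕ.m≤n⊔m N M)) (large (N ℕ.⊔ M) (ℕ.m≤m⊔n N M))

  ≉0⇒apart : ∀ x → ¬ x ≈ 0ℝ → ¬ ¬ Apart x
  ≉0⇒apart x x≉0 ¬apart = x≉0 (null⇒≈0 x λ ε ε>0 → small ε ε>0 (dichotomy x ε ε>0))
    where
    small : ∀ ε → 0ℚ ℚ.< ε → _ ⊎ Apart x → ∃[ N ] ∀ n → N ℕ.≤ n → ℚ.∣ seq x n ∣ ℚ.< ε
    small ε ε>0 (inj₁ s) = s
    small ε ε>0 (inj₂ a) = contradiction a ¬apart

  -- `dichotomy` decides for each ε separately, and its second branch refutes x ≈ y, against the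
  -- double negation.
  ≈-stable : ∀ {x y} → ¬ ¬ x ≈ y → x ≈ y
  ≈-stable {x} {y} ¬¬x≈y ε ε>0 with dichotomy (x - y) ε ε>0
  ... | inj₁ small = small
  ... | inj₂ apart = contradiction
    (λ x≈y → apart⇒≉0 (x - y) apart (null⇒≈0 (x - y) x≈y)) ¬¬x≈y

  *-cancel-0 : ∀ {x y} → ¬ x ≈ 0ℝ → x * y ≈ 0ℝ → y ≈ 0ℝ
  *-cancel-0 {x} {y} x≉0 xy≈0 = ≈-stable {y} {0ℝ} (≉0⇒apart x x≉0 >>= λ apart → return (cancel apart))
    where
    cancel : Apart x → y ≈ 0ℝ
    cancel (δ , δ>0 , N , large) = null⇒≈0 y λ ε ε>0 →
      let M , hM = ≈0⇒null (x * y) xy≈0 (δ ℚ.* ε) (*-positive δ>0 ε>0)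
      in N ℕ.⊔ M , λ n n≥ → ℚ.*-cancelˡ-<-nonNeg δ {{ℚ.nonNegative (ℚ.<⇒≤ δ>0)}} (begin-strict
        δ ℚ.* ℚ.∣ seq y n ∣            ≤⟨ ℚ.*-monoʳ-≤-nonNeg ℚ.∣ seq y n ∣ {{ℚ.∣-∣-nonNeg (seq y n)}} (large n (ℕ.m⊔n≤o⇒m≤o N M n≥)) ⟩
        ℚ.∣ seq x n ∣ ℚ.* ℚ.∣ seq y n ∣  ≡⟨ ℚ.∣p*q∣≡∣p∣*∣q∣ (seq x n) (seq y n) ⟨
        ℚ.∣ seq x n ℚ.* seq y n ∣      <⟨ hM n (ℕ.m⊔n≤o⇒n≤o N M n≥) ⟩
        δ ℚ.* ε                        ∎)
      where open ℚ.≤-Reasoning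

  ≤-pointwise : ∀ {x y} → (∀ n → seq x n ℚ.≤ seq y n) → x ≤ y
  ≤-pointwise {x} {y} x≤y ε ε>0 = 0 , λ n _ → ≡.subst (ℚ._< seq y n ℚ.+ ε)
    (ℚ.+-identityʳ (seq x n)) (ℚ.+-mono-≤-< (x≤y n) ε>0)

  ≤-reflexive : ∀ {x y} → x ≈ y → x ≤ y
  ≤-reflexive {x} {y} x≈y ε ε>0 with x≈y ε ε>0
  ... | N , close = N , λ n N≤n → p-q<r⇒p<q+r {seq x n} {seq y n} (ℚ.≤-<-trans (p≤∣p∣ _) (close n N≤n))

  ≤-trans : ∀ {x y z} → x ≤ y → y ≤ z → x ≤ z
  ≤-trans {x} {y} {z} x≤y y≤z ε ε>0 with x≤y _ (half>0 ε>0) | y≤z _ (half>0 ε>0)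
  ... | N , hN | M , hM = N ℕ.⊔ M , λ n n≥ → begin-strict
    seq x n                              <⟨ hN n (ℕ.m⊔n≤o⇒m≤o N M n≥) ⟩
    seq y n ℚ.+ half ε                   <⟨ ℚ.+-monoˡ-< (half ε) (hM n (ℕ.m⊔n≤o⇒n≤o N M n≥)) ⟩
    seq z n ℚ.+ half ε ℚ.+ half ε        ≡⟨ ℚ.+-assoc (seq z n) (half ε) (half ε) ⟩
    seq z n ℚ.+ (half ε ℚ.+ half ε)      ≡⟨ ≡.cong (seq z n ℚ.+_) (half+half ε) ⟩
    seq z n ℚ.+ ε                        ∎
    where open ℚ.≤-Reasoning

  ≤-antisym : ∀ {x y} → x ≤ y → y ≤ x → x ≈ y
  ≤-antisym {x} {y} x≤y y≤x ε ε>0 with x≤y ε ε>0 | y≤x ε ε>0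
  ... | N , hN | M , hM = N ℕ.⊔ M , λ n n≥ → ∣p∣-least
    (p<q+r⇒p-q<r {seq x n} {seq y n} (hN n (ℕ.m⊔n≤o⇒m≤o N M n≥)))
    (≡.subst (ℚ._< ε) (solve 2 (λ p q → q :- p := :- (p :- q)) ≡.refl (seq x n) (seq y n))
      (p<q+r⇒p-q<r {seq y n} {seq x n} (hM n (ℕ.m⊔n≤o⇒n≤o N M n≥))))

  +-mono-≤ : ∀ {x y u v} → x ≤ y → u ≤ v → x + u ≤ y + v
  +-mono-≤ {x} {y} {u} {v} x≤y u≤v ε ε>0 with x≤y _ (half>0 ε>0) | u≤v _ (half>0 ε>0)
  ... | N , hN | M , hM = N ℕ.⊔ M , λ n n≥ → ≡.subst (seq x n ℚ.+ seq u n ℚ.<_)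
    (≡.trans (solve 3 (λ p q h → (p :+ h) :+ (q :+ h) := (p :+ q) :+ (h :+ h)) ≡.refl (seq y n) (seq v n) (half ε))
      (≡.cong (seq y n ℚ.+ seq v n ℚ.+_) (half+half ε)))
    (ℚ.+-mono-< (hN n (ℕ.m⊔n≤o⇒m≤o N M n≥)) (hM n (ℕ.m⊔n≤o⇒n≤o N M n≥)))

  abs-nonNegative : ∀ {x} → 0ℝ ≤ x → abs x ≈ x
  abs-nonNegative {x} 0≤x ε ε>0 with 0≤x _ (half>0 ε>0)
  ... | N , hN = N , λ n N≤n → bound (seq x n) (hN n N≤n)
    where
    bound : ∀ p → 0ℚ ℚ.< p ℚ.+ half ε → ℚ.∣ ℚ.∣ p ∣ ℚ.- p ∣ ℚ.< ε
    bound p 0<p+h with ℚ.≤-total 0ℚ p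
    ... | inj₁ p≥0 = ≡.subst (λ z → ℚ.∣ z ∣ ℚ.< ε)
      (≡.sym (≡.trans (≡.cong (ℚ._- p) (ℚ.0≤p⇒∣p∣≡p p≥0)) (ℚ.+-inverseʳ p))) ε>0
    ... | inj₂ p≤0 = ≡.subst (λ z → ℚ.∣ z ∣ ℚ.< ε) (≡.cong (ℚ._- p) (≡.sym ∣p∣≡-p))
      (≡.subst (ℚ._< ε) (≡.sym (ℚ.0≤p⇒∣p∣≡p 0≤-p-p)) (≡.subst (_ ℚ.<_) (half+half ε) (ℚ.+-mono-< -p<h -p<h)))
      where
      -p<h : ℚ.- p ℚ.< half ε
      -p<h = ≡.subst₂ ℚ._<_ (ℚ.+-identityˡ (ℚ.- p)) (solve 2 (λ p h → (p :+ h) :- p := h) ≡.refl p (half ε)) (ℚ.+-monoˡ-< (ℚ.- p) 0<p+h)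
      -p≥0 : 0ℚ ℚ.≤ ℚ.- p
      -p≥0 = ℚ.neg-antimono-≤ p≤0
      ∣p∣≡-p : ℚ.∣ p ∣ ≡ ℚ.- p
      ∣p∣≡-p = ≡.trans (≡.sym (ℚ.∣-p∣≡∣p∣ p)) (ℚ.0≤p⇒∣p∣≡p -p≥0)
      0≤-p-p : 0ℚ ℚ.≤ ℚ.- p ℚ.- p
      0≤-p-p = ℚ.+-mono-≤ -p≥0 -p≥0

  -- 0 ≤ x amounts to |x| ≈ x, and equality is stable.
  ≤-stable-0 : ∀ {x} → ¬ ¬ 0ℝ ≤ x → 0ℝ ≤ x
  ≤-stable-0 {x} ¬¬0≤x = ≤-trans {0ℝ} {abs x} {x} (≤-pointwise {0ℝ} {abs x} λ n → ℚ.0≤∣p∣ (seq x n))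
    (≤-reflexive {abs x} {x} (≈-stable {abs x} {x} (¬¬0≤x >>= λ 0≤x → return (abs-nonNegative {x} 0≤x))))

  -- If term N exceeds ε/2, all later terms are positive and 0 ≤ x follows; otherwise they stay
  -- below ε.
  ≰⇒≥-0 : ∀ {x} → ¬ 0ℝ ≤ x → x ≤ 0ℝ
  ≰⇒≥-0 {x} 0≰x ε ε>0 with cauchy x (half ε) (half>0 ε>0)
  ... | N , close with seq x N ℚ.≤? half ε
  ... | yes small = N , λ n N≤n → ≡.subst (seq x n ℚ.<_) (≡.trans (half+half ε) (≡.sym (ℚ.+-identityˡ ε)))
    (ℚ.<-≤-trans (p-q<r⇒p<q+r {seq x n} {seq x N} (ℚ.≤-<-trans (p≤∣p∣ _) (close n N N≤n ℕ.≤-refl)))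
      (ℚ.+-monoˡ-≤ (half ε) small))
  ... | no  large = contradiction
    (λ η η>0 → N , λ n N≤n → ℚ.<-trans
      (+-cancelʳ-< (half ε) {0ℚ} {seq x n} (ℚ.<-trans (≡.subst (ℚ._< seq x N) (≡.sym (ℚ.+-identityˡ (half ε))) (ℚ.≰⇒> large))
        (p-q<r⇒p<q+r {seq x N} {seq x n} (ℚ.≤-<-trans (p≤∣p∣ _) (close N n ℕ.≤-refl N≤n)))))
      (≡.subst (ℚ._< seq x n ℚ.+ η) (ℚ.+-identityʳ (seq x n)) (ℚ.+-monoʳ-< (seq x n) η>0)))
    0≰x

  -- Inverse square roots by search on rational grids

  bracket : ∀ {P : ℕ → Set} → Unary.Decidable P → P 0 → ∀ k → ¬ P k → ∃[ i ] P i × ¬ P (suc i)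
  bracket P? P0 zero    ¬Pk = contradiction P0 ¬Pk
  bracket P? P0 (suc k) ¬Pk with P? k
  ... | yes Pk = k , Pk , ¬Pk
  ... | no ¬Pk′ = bracket P? P0 k ¬Pk′

  module InverseSquareRoot (t : ℝ) (δ : ℚ) (δ>0 : 0ℚ ℚ.< δ)
    (N : ℕ) (δ≤t : ∀ n → N ℕ.≤ n → δ ℚ.≤ seq t n) where

    open ℚ.≤-Reasoning

    -- This is 1 + 1/δ, above every w with w² s ≤ 1 when s ≥ δ: for w ≥ W one has w² s ≥ W δ = δ +
    -- 1.
    W : ℚ
    W = 1ℚ ℚ.+ proj₁ (quotient δ>0 (ℚ.positive⁻¹ 1ℚ))

    1≤W : 1ℚ ℚ.≤ W
    1≤W = ≡.subst (ℚ._≤ W) (ℚ.+-identityʳ 1ℚ)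
      (ℚ.+-monoʳ-≤ 1ℚ (ℚ.<⇒≤ (proj₁ (proj₂ (quotient δ>0 (ℚ.positive⁻¹ 1ℚ))))))

    0≤1 : 0ℚ ℚ.≤ 1ℚ
    0≤1 = ℚ.nonNegative⁻¹ 1ℚ

    0≤W : 0ℚ ℚ.≤ W
    0≤W = ℚ.≤-trans 0≤1 1≤W

    W≤w⇒1<w²s : ∀ w s → W ℚ.≤ w → δ ℚ.≤ s → 1ℚ ℚ.< w ℚ.* w ℚ.* s
    W≤w⇒1<w²s w s W≤w δ≤s = begin-strict
      1ℚ                ≡⟨ ℚ.+-identityˡ 1ℚ ⟨
      0ℚ ℚ.+ 1ℚ         <⟨ ℚ.+-monoˡ-< 1ℚ δ>0 ⟩
      δ ℚ.+ 1ℚ          ≡⟨ ≡.cong₂ ℚ._+_ (≡.sym (ℚ.*-identityʳ δ)) (≡.sym (proj₂ (proj₂ (quotient δ>0 (ℚ.positive⁻¹ 1ℚ))))) ⟩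
      δ ℚ.* 1ℚ ℚ.+ δ ℚ.* _  ≡⟨ ℚ.*-distribˡ-+ δ 1ℚ _ ⟨
      δ ℚ.* W           ≡⟨ ≡.trans (ℚ.*-comm δ W) (≡.cong (ℚ._* δ) (≡.sym (ℚ.*-identityˡ W))) ⟩
      1ℚ ℚ.* W ℚ.* δ    ≤⟨ ℚ-*-mono-≤ (*-nonNegative 0≤1 0≤W) (ℚ.≤-trans (ℚ.<⇒≤ δ>0) δ≤s)
                             (ℚ-*-mono-≤ 0≤1 0≤w (ℚ.≤-trans 1≤W W≤w) W≤w) δ≤s ⟩
      w ℚ.* w ℚ.* s     ∎
      where
      0≤w : 0ℚ ℚ.≤ w
      0≤w = ℚ.≤-trans 0≤W W≤w

    Approximation : ℚ → ℚ → ℚ → Set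
    Approximation h s w = 0ℚ ℚ.≤ w × w ℚ.* w ℚ.* s ℚ.≤ 1ℚ × 1ℚ ℚ.< (w ℚ.+ h) ℚ.* (w ℚ.+ h) ℚ.* s

    -- A multiple of `h` that satisfies w² s ≤ 1 while the next multiple fails; the search is finite
    -- because multiples from `W` on fail.
    approximate : ∀ h s → 0ℚ ℚ.< h → δ ℚ.≤ s → ∃ (Approximation h s)
    approximate h s h>0 δ≤s =
      let k , q≤k = archimedean (proj₁ W/h)
          i , Pi , ¬Pi+1 = bracket P? P0 k (<⇒≱ (W≤w⇒1<w²s (grid k) s (W≤grid k q≤k) δ≤s))
      in grid i , grid≥0 i , Pi , ≡.subst (λ w → 1ℚ ℚ.< w ℚ.* w ℚ.* s) (grid-suc i) (ℚ.≰⇒> ¬Pi+1)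
      where
      W/h : ∃[ q ] 0ℚ ℚ.< q × h ℚ.* q ≡ W
      W/h = quotient h>0 (ℚ.<-≤-trans (ℚ.positive⁻¹ 1ℚ) 1≤W)
      natural : ℕ → ℚ
      natural k = mkℚ (ℤ.+ k) 0 (Coprime.sym (Coprime.1-coprimeTo k))
      grid : ℕ → ℚ
      grid k = h ℚ.* natural k
      P : ℕ → Set
      P k = grid k ℚ.* grid k ℚ.* s ℚ.≤ 1ℚ
      P? : Unary.Decidable P
      P? k = grid k ℚ.* grid k ℚ.* s ℚ.≤? 1ℚ
      P0 : P 0
      P0 = ≡.subst (ℚ._≤ 1ℚ) (≡.sym (≡.trans (≡.cong (λ z → z ℚ.* z ℚ.* s) (ℚ.*-zeroʳ h)) (ℚ.*-zeroˡ s))) 0≤1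
      grid≥0 : ∀ k → 0ℚ ℚ.≤ grid k
      grid≥0 k = *-nonNegative (ℚ.<⇒≤ h>0) (ℚ.nonNegative⁻¹ (natural k))
      W≤grid : ∀ k → proj₁ W/h ℚ.≤ natural k → W ℚ.≤ grid k
      W≤grid k q≤k = ≡.subst (ℚ._≤ grid k) (proj₂ (proj₂ W/h))
        (ℚ.*-monoˡ-≤-nonNeg h {{ℚ.nonNegative (ℚ.<⇒≤ h>0)}} q≤k)
      grid-suc : ∀ k → grid (suc k) ≡ grid k ℚ.+ h
      grid-suc k = ≡.trans (≡.cong (h ℚ.*_) (natural-suc k))
        (≡.trans (ℚ.*-distribˡ-+ h (natural k) 1ℚ) (≡.cong (grid k ℚ.+_) (ℚ.*-identityʳ h)))
        where
        natural-suc : ∀ k → natural (suc k) ≡ natural k ℚ.+ 1ℚ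
        natural-suc k = ≡.sym (≡.trans
          (≡.cong (ℚ._/ 1) (≡.trans (≡.cong (ℤ._+ ℤ.+ 1) (ℤ.*-identityʳ (ℤ.+ k))) (≡.cong ℤ.+_ (ℕ.+-comm k 1))))
          (ℚ.↥p/↧p≡p (natural (suc k))))

    -- Equal to `seq t n` from N on; the maximum with `δ` lets the search succeed at earlier indices
    -- too.
    clamped : ℕ → ℚ
    clamped n = δ ℚ.⊔ seq t n

    chosen : ∀ n → ∃ (Approximation (recip n) (clamped n))
    chosen n = approximate (recip n) (clamped n) (ℚ.positive⁻¹ (recip n)) (ℚ.p≤p⊔q δ (seq t n))

    root : ℕ → ℚ
    root n = proj₁ (chosen n)

    0≤root : ∀ n → 0ℚ ℚ.≤ root n
    0≤root n = proj₁ (proj₂ (chosen n))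

    module _ {n} (N≤n : N ℕ.≤ n) where

      clamped≡t : clamped n ≡ seq t n
      clamped≡t = ℚ.p≤q⇒p⊔q≡q (δ≤t n N≤n)

      root²t≤1 : root n ℚ.* root n ℚ.* seq t n ℚ.≤ 1ℚ
      root²t≤1 = ≡.subst (λ z → root n ℚ.* root n ℚ.* z ℚ.≤ 1ℚ) clamped≡t (proj₁ (proj₂ (proj₂ (chosen n))))

      1<[root+h]²t : 1ℚ ℚ.< (root n ℚ.+ recip n) ℚ.* (root n ℚ.+ recip n) ℚ.* seq t n
      1<[root+h]²t = ≡.subst (λ z → 1ℚ ℚ.< (root n ℚ.+ recip n) ℚ.* (root n ℚ.+ recip n) ℚ.* z) clamped≡t
        (proj₂ (proj₂ (proj₂ (chosen n))))

      t≥0 : 0ℚ ℚ.≤ seq t n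
      t≥0 = ℚ.≤-trans (ℚ.<⇒≤ δ>0) (δ≤t n N≤n)

      root≤W : root n ℚ.≤ W
      root≤W = ℚ.≮⇒≥ λ W<root → <⇒≱ (W≤w⇒1<w²s (root n) (seq t n) (ℚ.<⇒≤ W<root) (δ≤t n N≤n)) root²t≤1

    -- If root n + 2e ≤ root m while recip n ≤ e, then a = root n + e has
    -- a² t n > 1 ≥ (a + e)² t m, which forces t n - t m away from 0.
    separated : ∀ {m n} → N ℕ.≤ m → N ℕ.≤ n → ∀ e → 0ℚ ℚ.< e → recip n ℚ.≤ e →
      root n ℚ.+ e ℚ.+ e ℚ.≤ root m →
      e ℚ.* e ℚ.* δ ℚ.< (W ℚ.+ e) ℚ.* (W ℚ.+ e) ℚ.* ℚ.∣ seq t n ℚ.- seq t m ∣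
    separated {m} {n} N≤m N≤n e e>0 h≤e a+e≤root = begin-strict
      e ℚ.* e ℚ.* δ
        ≤⟨ ℚ.*-monoˡ-≤-nonNeg (e ℚ.* e) {{ℚ.nonNegative (square-nonNegative e)}} (δ≤t m N≤m) ⟩
      e ℚ.* e ℚ.* seq t m
        ≡⟨ ℚ.+-identityˡ _ ⟨
      0ℚ ℚ.+ e ℚ.* e ℚ.* seq t m
        ≤⟨ ℚ.+-monoˡ-≤ _ (*-nonNegative (*-nonNegative (ℚ.+-mono-≤ a≥0 a≥0) (ℚ.<⇒≤ e>0)) (t≥0 N≤m)) ⟩
      (a ℚ.+ a) ℚ.* e ℚ.* seq t m ℚ.+ e ℚ.* e ℚ.* seq t m
        ≡⟨ solve 3 (λ a e t → (a :+ a) :* e :* t :+ e :* e :* t := (a :+ e) :* (a :+ e) :* t :- a :* a :* t) ≡.refl a e (seq t m) ⟩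
      (a ℚ.+ e) ℚ.* (a ℚ.+ e) ℚ.* seq t m ℚ.- a ℚ.* a ℚ.* seq t m
        ≤⟨ ℚ.+-monoˡ-≤ _ (ℚ.≤-trans (ℚ-*-mono-≤ (square-nonNegative (a ℚ.+ e)) (t≥0 N≤m)
             (ℚ-*-mono-≤ (ℚ.+-mono-≤ a≥0 (ℚ.<⇒≤ e>0)) (0≤root m) a+e≤root a+e≤root) ℚ.≤-refl) (root²t≤1 N≤m)) ⟩
      1ℚ ℚ.- a ℚ.* a ℚ.* seq t m
        <⟨ ℚ.+-monoˡ-< _ (ℚ.<-≤-trans (1<[root+h]²t N≤n)
             (ℚ-*-mono-≤ (square-nonNegative (root n ℚ.+ recip n)) (t≥0 N≤n)
               (ℚ-*-mono-≤ b≥0 a≥0 b≤a b≤a) ℚ.≤-refl)) ⟩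
      a ℚ.* a ℚ.* seq t n ℚ.- a ℚ.* a ℚ.* seq t m
        ≡⟨ solve 3 (λ a s t → a :* a :* s :- a :* a :* t := a :* a :* (s :- t)) ≡.refl a (seq t n) (seq t m) ⟩
      a ℚ.* a ℚ.* (seq t n ℚ.- seq t m)
        ≤⟨ ℚ.*-monoˡ-≤-nonNeg (a ℚ.* a) {{ℚ.nonNegative (square-nonNegative a)}} (p≤∣p∣ _) ⟩
      a ℚ.* a ℚ.* ℚ.∣ seq t n ℚ.- seq t m ∣
        ≤⟨ ℚ.*-monoʳ-≤-nonNeg _ {{ℚ.∣-∣-nonNeg (seq t n ℚ.- seq t m)}} (ℚ-*-mono-≤ a≥0 (ℚ.≤-trans a≥0 a≤W+e) a≤W+e a≤W+e) ⟩
      (W ℚ.+ e) ℚ.* (W ℚ.+ e) ℚ.* ℚ.∣ seq t n ℚ.- seq t m ∣ ∎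
      where
      a : ℚ
      a = root n ℚ.+ e
      b≥0 : 0ℚ ℚ.≤ root n ℚ.+ recip n
      b≥0 = ℚ.+-mono-≤ (0≤root n) (ℚ.nonNegative⁻¹ (recip n))
      b≤a : root n ℚ.+ recip n ℚ.≤ a
      b≤a = ℚ.+-monoʳ-≤ (root n) h≤e
      a≥0 : 0ℚ ℚ.≤ a
      a≥0 = ℚ.≤-trans b≥0 b≤a
      a≤W+e : a ℚ.≤ W ℚ.+ e
      a≤W+e = ℚ.+-monoˡ-≤ e (root≤W N≤n)

    root-cauchy : Cauchy root
    root-cauchy ε ε>0 =
      let e = half ε
          e>0 = half>0 ε>0
          W+e>0 = ℚ.+-mono-≤-< 0≤W e>0
          -- Two terms of `t` closer than e² δ / (W + e)² contradict `separated`, whose hypothesis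
          -- is a gap of 2e = ε between the roots.
          η , η>0 , Kη≡ = quotient (*-positive W+e>0 W+e>0) (*-positive (*-positive e>0 e>0) δ>0)
          M₁ , close = cauchy t η η>0
          M₂ , small = recip-small e e>0
          M = N ℕ.⊔ (M₁ ℕ.⊔ M₂)
          below : ∀ m n → M ℕ.≤ m → M ℕ.≤ n → root m ℚ.- root n ℚ.< ε
          below m n m≥ n≥ = ℚ.≰⇒> λ ε≤gap → ℚ.<-asym
            (separated (ℕ.m⊔n≤o⇒m≤o N _ m≥) (ℕ.m⊔n≤o⇒m≤o N _ n≥) e e>0
              (small n (ℕ.m⊔n≤o⇒n≤o M₁ M₂ (ℕ.m⊔n≤o⇒n≤o N _ n≥)))
              (≡.subst₂ ℚ._≤_
                (≡.trans (≡.cong (ℚ._+ root n) (≡.sym (half+half ε)))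
                  (solve 2 (λ e r → (e :+ e) :+ r := (r :+ e) :+ e) ≡.refl e (root n)))
                (solve 2 (λ p q → (p :- q) :+ q := p) ≡.refl (root m) (root n))
                (ℚ.+-monoˡ-≤ (root n) ε≤gap)))
            (≡.subst ((W ℚ.+ e) ℚ.* (W ℚ.+ e) ℚ.* ℚ.∣ seq t n ℚ.- seq t m ∣ ℚ.<_) Kη≡
              (ℚ.*-monoʳ-<-pos ((W ℚ.+ e) ℚ.* (W ℚ.+ e)) {{ℚ.positive (*-positive W+e>0 W+e>0)}}
                (close n m (ℕ.m⊔n≤o⇒m≤o M₁ M₂ (ℕ.m⊔n≤o⇒n≤o N _ n≥)) (ℕ.m⊔n≤o⇒m≤o M₁ M₂ (ℕ.m⊔n≤o⇒n≤o N _ m≥)))))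
      in M , λ m n m≥ n≥ → ∣p∣-least (below m n m≥ n≥)
        (≡.subst (ℚ._< ε) (solve 2 (λ p q → q :- p := :- (p :- q)) ≡.refl (root m) (root n)) (below n m n≥ m≥))

    w : ℝ
    w = mkℝ root root-cauchy

    w²t≈1 : w * w * t ≈ 1ℝ
    w²t≈1 ε ε>0 =
      let T , T>0 , M₁ , t≤T = bounded t
          -- From (r + h)² s - r² s = (2r + h) s h with r ≤ W, h ≤ 1 and s ≤ T.
          K = (W ℚ.+ W ℚ.+ 1ℚ) ℚ.* T
          K>0 = *-positive (ℚ.+-mono-≤-< (ℚ.+-mono-≤ 0≤W 0≤W) (ℚ.positive⁻¹ 1ℚ)) T>0
          η , η>0 , Kη≡ε = quotient K>0 ε>0
          M₂ , small = recip-small η η>0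
      in N ℕ.⊔ (M₁ ℕ.⊔ M₂) , λ n n≥ →
        let N≤n = ℕ.m⊔n≤o⇒m≤o N _ n≥
            r = root n
            h = recip n
            s = seq t n
        in ∣p∣-least
          (ℚ.≤-<-trans (≡.subst (r ℚ.* r ℚ.* s ℚ.- 1ℚ ℚ.≤_) (ℚ.+-inverseʳ 1ℚ) (ℚ.+-monoˡ-≤ (ℚ.- 1ℚ) (root²t≤1 N≤n))) ε>0)
          (begin-strict
            ℚ.- (r ℚ.* r ℚ.* s ℚ.- 1ℚ)
              ≡⟨ solve 2 (λ x o → :- (x :- o) := o :- x) ≡.refl (r ℚ.* r ℚ.* s) 1ℚ ⟩
            1ℚ ℚ.- r ℚ.* r ℚ.* s
              <⟨ ℚ.+-monoˡ-< _ (1<[root+h]²t N≤n) ⟩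
            (r ℚ.+ h) ℚ.* (r ℚ.+ h) ℚ.* s ℚ.- r ℚ.* r ℚ.* s
              ≡⟨ solve 3 (λ r h s → (r :+ h) :* (r :+ h) :* s :- r :* r :* s := (r :+ r :+ h) :* s :* h) ≡.refl r h s ⟩
            (r ℚ.+ r ℚ.+ h) ℚ.* s ℚ.* h
              ≤⟨ ℚ-*-mono-≤
                   (*-nonNegative (ℚ.+-mono-≤ (ℚ.+-mono-≤ (0≤root n) (0≤root n)) (ℚ.nonNegative⁻¹ h)) (t≥0 N≤n))
                   (ℚ.<⇒≤ η>0)
                   (ℚ-*-mono-≤ (ℚ.+-mono-≤ (ℚ.+-mono-≤ (0≤root n) (0≤root n)) (ℚ.nonNegative⁻¹ h)) (ℚ.<⇒≤ T>0)
                     (ℚ.+-mono-≤ (ℚ.+-mono-≤ (root≤W N≤n) (root≤W N≤n)) (recip≤1 n))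
                     (ℚ.≤-trans (p≤∣p∣ s) (t≤T n (ℕ.m⊔n≤o⇒m≤o M₁ M₂ (ℕ.m⊔n≤o⇒n≤o N _ n≥)))))
                   (small n (ℕ.m⊔n≤o⇒n≤o M₁ M₂ (ℕ.m⊔n≤o⇒n≤o N _ n≥))) ⟩
            K ℚ.* η
              ≡⟨ Kη≡ε ⟩
            ε ∎)
      where
      recip≤1 : ∀ n → recip n ℚ.≤ 1ℚ
      recip≤1 n = *≤* (ℤ.+≤+ (ℕ.s≤s ℕ.z≤n))

  fromℚ-injective : ∀ {p q} → fromℚ p ≈ fromℚ q → p ≡ q
  fromℚ-injective {p} {q} p≈q with p ℚ.≟ q
  ... | yes p≡q = p≡q
  ... | no  p≢q = contradiction (null⇒≈0 (fromℚ p - fromℚ q) p≈q)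
    (apart⇒≉0 (fromℚ p - fromℚ q) (ℚ.∣ p ℚ.- q ∣ , ℚ.≰⇒> gap , 0 , λ _ _ → ℚ.≤-refl))
    where
    gap : ¬ ℚ.∣ p ℚ.- q ∣ ℚ.≤ 0ℚ
    gap ∣p-q∣≤0 = p≢q (≡.trans (≡.sym (≡.trans (ℚ.+-assoc p (ℚ.- q) q)
      (≡.trans (≡.cong (p ℚ.+_) (ℚ.+-inverseˡ q)) (ℚ.+-identityʳ p))))
      (≡.trans (≡.cong (ℚ._+ q) (ℚ.∣p∣≡0⇒p≡0 (p ℚ.- q) (ℚ.≤-antisym ∣p-q∣≤0 (ℚ.0≤∣p∣ (p ℚ.- q)))))
        (ℚ.+-identityˡ q)))

  ≤-stable : ∀ {x y} → ¬ ¬ x ≤ y → x ≤ y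
  ≤-stable {x} {y} ¬¬x≤y = ≤-trans {x} {0ℝ + x} {y}
    (≤-pointwise {x} {0ℝ + x} λ n → ℚ.≤-reflexive (≡.sym (ℚ.+-identityˡ (seq x n))))
    (≤-trans {0ℝ + x} {y - x + x} {y}
      (+-mono-≤ {0ℝ} {y - x} {x} {x} (≤-stable-0 {y - x} (¬¬x≤y >>= λ x≤y → return
        (≤-trans {0ℝ} {x - x} {y - x}
          (≤-pointwise {0ℝ} {x - x} λ n → ℚ.≤-reflexive (≡.sym (ℚ.+-inverseʳ (seq x n))))
          (+-mono-≤ {x} {y} { - x} { - x} x≤y (≤-reflexive { - x} { - x} (≈-refl { - x}))))))
        (≤-reflexive {x} {x} (≈-refl {x})))
      (≤-pointwise {y - x + x} {y} λ n → ℚ.≤-reflexive (≡.trans (ℚ.+-assoc (seq y n) _ (seq x n))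
        (≡.trans (≡.cong (seq y n ℚ.+_) (ℚ.+-inverseˡ (seq x n))) (ℚ.+-identityʳ (seq y n))))))

  abs-nonPositive : ∀ {x} → x ≤ 0ℝ → abs x ≈ - x
  abs-nonPositive {x} x≤0 = ≈-trans {abs x} {abs (- x)} { - x}
    (pointwise (abs x) (abs (- x)) λ n → ≡.sym (ℚ.∣-p∣≡∣p∣ (seq x n)))
    (abs-nonNegative { - x} (≤-trans {0ℝ} {x - x} { - x}
      (≤-pointwise {0ℝ} {x - x} λ n → ℚ.≤-reflexive (≡.sym (ℚ.+-inverseʳ (seq x n))))
      (≤-trans {x - x} {0ℝ - x} { - x}
        (+-mono-≤ {x} {0ℝ} { - x} { - x} x≤0 (≤-reflexive { - x} { - x} (≈-refl { - x})))
        (≤-pointwise {0ℝ - x} { - x} λ n → ℚ.≤-reflexive (ℚ.+-identityˡ (ℚ.- seq x n))))))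

  -- Single terms of x y may be negative; those of |x| |y| are not, and the two products are equal
  -- as reals.
  *-nonNegative-ℝ : ∀ {x y} → 0ℝ ≤ x → 0ℝ ≤ y → 0ℝ ≤ x * y
  *-nonNegative-ℝ {x} {y} 0≤x 0≤y = ≤-trans {0ℝ} {abs x * abs y} {x * y}
    (≤-pointwise {0ℝ} {abs x * abs y} λ n → *-nonNegative (ℚ.0≤∣p∣ (seq x n)) (ℚ.0≤∣p∣ (seq y n)))
    (≤-reflexive {abs x * abs y} {x * y}
      (*-cong {abs x} {x} {abs y} {y} (abs-nonNegative {x} 0≤x) (abs-nonNegative {y} 0≤y)))

  ≤-sign : ∀ x → ¬ ¬ (0ℝ ≤ x ⊎ x ≤ 0ℝ)
  ≤-sign x = ¬¬-em (0ℝ ≤ x) >>= λ where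
    (inj₁ 0≤x) → return (inj₁ 0≤x)
    (inj₂ 0≰x) → return (inj₂ (≰⇒≥-0 {x} 0≰x))

  inverseSquareRoot : ∀ {x} → 0ℝ ≤ x → ¬ x ≈ 0ℝ → ¬ ¬ (∃[ w ] w * w * x ≈ 1ℝ)
  inverseSquareRoot {x} 0≤x x≉0 = ≉0⇒apart x x≉0 >>= λ (δ , δ>0 , N , δ≤∣x∣) →
    -- `Apart` bounds the absolute values of the terms from below, so the root is taken of |x|,
    -- which equals x.
    let module Root = InverseSquareRoot (abs x) δ δ>0 N δ≤∣x∣
        w = Root.w
    in return (w , ≈-trans {w * w * x} {w * w * abs x} {1ℝ}
      (*-cong {w * w} {w * w} {x} {abs x} (≈-refl {w * w})
        (≈-sym {abs x} {x} (abs-nonNegative {x} 0≤x)))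
      Root.w²t≈1)

  ℝ-realField : RealField
  ℝ-realField = record
    { commutativeRing = ℝ-commutativeRing
    ; _≼_           = _≤_
    ; ∣_∣           = abs
    ; scalar        = scalar
    ; scalar-cancel = fromℚ-injective
    ; scalar-mono   = λ {p} {q} p≤q → ≤-pointwise {fromℚ p} {fromℚ q} λ _ → p≤q
    ; ≈-stable      = λ {x} {y} → ≈-stable {x} {y}
    ; *-cancel      = λ {x} {y} → *-cancel-0 {x} {y}
    ; inverseSqrt   = λ {x} → inverseSquareRoot {x}
    ; ≼-reflexive   = λ {x} {y} → ≤-reflexive {x} {y}
    ; ≼-trans       = λ {x} {y} {z} → ≤-trans {x} {y} {z}
    ; ≼-antisym     = λ {x} {y} → ≤-antisym {x} {y}
    ; ≼-stable      = λ {x} {y} → ≤-stable {x} {y}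
    ; ≼-sign        = ≤-sign
    ; +-mono-≼      = λ {x} {y} {u} {v} → +-mono-≤ {x} {y} {u} {v}
    ; *-nonNeg      = λ {x} {y} → *-nonNegative-ℝ {x} {y}
    ; square-nonNeg = λ x → ≤-pointwise {0ℝ} {x * x} λ n → square-nonNegative (seq x n)
    ; ∣∣-nonNeg     = λ {x} → abs-nonNegative {x}
    ; ∣∣-nonPos     = λ {x} → abs-nonPositive {x}
    }

open import Defs

proposition3p1 : ∀ {n : ℕ} (G : Graph n) (E : ℝ) → IsEnergy G E →
    (IsComplete G → E ≈ fromℕ (2 ℕ.* τ G))
    × (IsBipartite G → E ≥ fromℕ (2 ℕ.* τ G))
    × (IsCycle G → E ≥ fromℕ (2 ℕ.* τ G))
proposition3p1 G E (λs , spectrum , E≈) =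
    E.complete-case G λs E E≈ spectrum
  , E.bipartite-case G λs E E≈ spectrum
  , E.cycle-case G λs E E≈ spectrum
  where module E = Energy Reals.ℝ-realField
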